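{- For every constant $\varepsilon>0$ there exist constants $\gamma,\alpha>0$ and $n_0$ such that for all $n\geq n_0$ the following holds. Let $k$ be an integer with $2 \leq k\leq (n/\log n)^{1/4}$, and let $\mathbf{c}=(c_1,\dots,c_k)$ be an initial $k$-color configuration on $n$ nodes with \[ \max\{c_j : j=1,\dots,k\}\leq \frac{n}{k}+\left(\frac{n}{k}\right)^{1-\varepsilon}. \] Run the 3-majority protocol from $\mathbf{C}^{(0)}=\mathbf{c}$ and let $\tau=\inf\{t\in\mathbb{N} : \mathbf{C}^{(t)}\text{ is monochromatic}\}$. Then $\tau\geq \gamma\, k\log n$ with probability at least $1-n^{ -\alpha}$. (That is, $\tau=\Omega(k\log n)$ with high probability.)
   Context: A $k$-color configuration on $n$ nodes is a $k$-tuple $\mathbf{c}=(c_1,\dots,c_k)$ of non-negative integers with $\sum_{j} c_j = n$, where $c_j$ is the number of nodes with color $j\in[k]=\{1,\dots,k\}$. It is monochromatic if $c_j=n$ for some $j\in[k]$. 3-majority protocol (on the clique, synchronous rounds): at every round, every node, independently of the others, picks three nodes uniformly at random (including itself and with repetitions) and recolors itself according to the majority of the colors it sees; if it sees three different colors, it chooses the first one. All nodes update simultaneously, using the colors at the beginning of the round. $\mathbf{C}^{(t)}=(C^{(t)}_1,\dots,C^{(t)}_k)$ is the random configuration at round $t$. $\log$ is the natural logarithm. -}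

module Defs where

open import Data.Bool using (Bool; true; if_then_else_)
open import Data.Fin using (Fin; toℕ)
import Data.Fin.Properties as Fin
open import Data.Integer using (+_)
open import Data.List using (List; []; _∷_; allFin; cartesianProduct; cartesianProductWith; filter; filterᵇ; length)
open import Data.Nat using (ℕ; zero; suc; _⊔_; _!)
import Data.Nat as ℕ
open import Data.Nat.Properties using (_!≢0)
open import Data.Product using (_×_; _,_; ∃-syntax; Σ-syntax)
open import Data.Rational using (ℚ; 0ℚ; 1ℚ; _/_; _+_; _-_; _*_; -_; 1/_; ∣_∣; _≤_; _<_; _≟_; ≢-nonZero)
open import Data.Vec using (Vec; []; _∷_; lookup; tabulate; sum; foldr′)
open import Relation.Binary.PropositionalEquality using (_≡_)
open import Relation.Nullary using (does; yes; no)

-- A real number is a Cauchy sequence of rationals.  Expressions are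
-- evaluated termwise on the underlying sequences, so that every
-- operation below is total; it represents the usual operation whenever
-- its arguments converge and lie in the usual domain (a nonzero limit
-- for a divisor, a positive limit for `log` and for the base of `_^ʳ_`).

Seq : Set
Seq = ℕ → ℚ

record ℝ : Set where
  field
    seq    : Seq
    cauchy : ∀ δ → 0ℚ < δ →
             ∃[ N ] ∀ i j → N ℕ.≤ i → N ℕ.≤ j → ∣ seq i - seq j ∣ ≤ δ

open ℝ public using (seq)

infix  4 _≤ʳ_ _<ʳ_
infixl 6 _+ʳ_ _-ʳ_
infixl 7 _*ʳ_ _/ʳ_
infix  8 -ʳ_
infixr 9 _^ʳ_

-- For convergent sequences these are the order relations of the limits.

_≤ʳ_ : Seq → Seq → Set
x ≤ʳ y = ∀ δ → 0ℚ < δ → ∃[ N ] ∀ m → N ℕ.≤ m → x m ≤ y m + δ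

_<ʳ_ : Seq → Seq → Set
x <ʳ y = Σ[ δ ∈ ℚ ] 0ℚ < δ × (∃[ N ] ∀ m → N ℕ.≤ m → x m + δ ≤ y m)

const : ℚ → Seq
const q _ = q

ι : ℕ → Seq
ι n = const (+ n / 1)

_+ʳ_ _-ʳ_ _*ʳ_ : Seq → Seq → Seq
(x +ʳ y) m = x m + y m
(x -ʳ y) m = x m - y m
(x *ʳ y) m = x m * y m

-ʳ_ : Seq → Seq
(-ʳ x) m = - x m

-- Convention: 1/0 = 0.
recip : ℚ → ℚ
recip q with q ≟ 0ℚ
... | yes _  = 0ℚ
... | no q≢0 = 1/_ q {{≢-nonZero q≢0}}

_/ʳ_ : Seq → Seq → Seq
(x /ʳ y) m = x m * recip (y m)

∑< : ℕ → (ℕ → ℚ) → ℚ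
∑< zero    f = 0ℚ
∑< (suc m) f = ∑< m f + f m

_^ℚ_ : ℚ → ℕ → ℚ
q ^ℚ zero  = 1ℚ
q ^ℚ suc i = q * (q ^ℚ i)

-- exp x = Σ_i xⁱ / i!, the m-th partial sum being taken at the m-th
-- approximation of x; the series converges uniformly on bounded sets.
exp : Seq → Seq
exp x m = ∑< m λ i → (x m ^ℚ i) * (+ 1 / (i !)) {{i !≢0}}

-- Natural logarithm: for x > 0,
--   log x = 2 artanh z = 2 Σ_i z²ⁱ⁺¹ / (2i+1)   with z = (x-1)/(x+1),
-- where |z| < 1; the series converges uniformly for x in compact subsets
-- of (0,∞).
log : Seq → Seq
log x m = (+ 2 / 1) * ∑< m λ i → (z ^ℚ suc (2 ℕ.* i)) * (+ 1 / suc (2 ℕ.* i))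
  where
  z : ℚ
  z = (x m - 1ℚ) * recip (x m + 1ℚ)

_^ʳ_ : Seq → Seq → Seq
x ^ʳ y = exp (y *ʳ log x)

IsConfiguration : ∀ {k} → ℕ → (Fin k → ℕ) → Set
IsConfiguration n c = sum (tabulate c) ≡ n

maxCount : ∀ {k} → (Fin k → ℕ) → ℕ
maxCount c = foldr′ _⊔_ 0 (tabulate c)

Monochromatic : ∀ {k} → ℕ → (Fin k → ℕ) → Set
Monochromatic n c = ∃[ j ] c j ≡ n

Coloring : ℕ → ℕ → Set
Coloring n k = Fin n → Fin k

configuration : ∀ {n k} → Coloring n k → (Fin k → ℕ)
configuration {n} χ j = length (filter (λ v → χ v Fin.≟ j) (allFin n))

-- The nodes picked in one round: an ordered triple for every node.
Picks : ℕ → Set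
Picks n = Vec (Fin n × Fin n × Fin n) n

majority : ∀ {k} → Fin k → Fin k → Fin k → Fin k
majority a b c =
  if does (a Fin.≟ b) then a else
  if does (a Fin.≟ c) then a else
  if does (b Fin.≟ c) then b else
  a

step : ∀ {n k} → Picks n → Coloring n k → Coloring n k
step r χ v = let (u₁ , u₂ , u₃) = lookup r v in majority (χ u₁) (χ u₂) (χ u₃)

-- An outcome of the infinite experiment: the picks of all rounds.
Outcome : ℕ → Set
Outcome n = ℕ → Picks n

run : ∀ {n k} → Coloring n k → Outcome n → ℕ → Coloring n k
run χ ω zero    = χ
run χ ω (suc t) = step (ω t) (run χ ω t)

C : ∀ {n k} → Coloring n k → Outcome n → ℕ → (Fin k → ℕ)
C χ ω t = configuration (run χ ω t)

-- τ ≥ x, for τ = inf {t ∈ ℕ : C⁽ᵗ⁾ is monochromatic} ∈ ℕ ∪ {∞}.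
τ≥ : ∀ {n k} → Coloring n k → Seq → Outcome n → Set
τ≥ {n} χ x ω = ∀ t → Monochromatic n (C χ ω t) → x ≤ʳ ι t

-- The picks of all nodes in all rounds are independent and uniform, so
-- the picks of the first T rounds are uniform on the finite set
-- Vec (Picks n) T.

vectors : ∀ {A : Set} → List A → (m : ℕ) → List (Vec A m)
vectors xs zero    = [] ∷ []
vectors xs (suc m) = cartesianProductWith _∷_ xs (vectors xs m)

allPicks : ∀ n → List (Picks n)
allPicks n = vectors (cartesianProduct (allFin n) (cartesianProduct (allFin n) (allFin n))) n

probability : ∀ n T → (Vec (Picks n) T → Bool) → ℚ
probability n T D =
  (+ length (filterᵇ D Ω) / 1) * recip (+ length Ω / 1)
  where
  Ω : List (Vec (Picks n) T)
  Ω = vectors (allPicks n) T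

firstRounds : ∀ {n} T → Outcome n → Vec (Picks n) T
firstRounds T ω = tabulate (λ i → ω (toℕ i))

-- The event E has probability at least p: it contains an event D
-- determined by finitely many rounds whose probability is at least p.
-- If E is itself determined by finitely many rounds, as {τ ≥ x} is (by
-- any T ≥ x of them), one can take D = E, and this is precisely
-- P(E) ≥ p.  Passing to D avoids requiring E to be decidable.
ℙ[_]≥_ : ∀ {n} → (Outcome n → Set) → Seq → Set
ℙ[_]≥_ {n} E p =
  Σ[ T ∈ ℕ ] Σ[ D ∈ (Vec (Picks n) T → Bool) ]
    (∀ ω → D (firstRounds T ω) ≡ true → E ω)
    × p ≤ʳ const (probability n T D)

{-# OPTIONS --safe #-}

-- Let Δ be the excess of the largest colour class over n / k.  By Cauchy-Schwarz (Σ c² ≥ n² / k) one round multiplies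
-- the expected excess by 1 + O(1/k) at most, and by a Chernoff bound the random fluctuation is below Δ / k, except with
-- probability n^(-O(1)), as soon as Δ is large compared with √(k n log n), which is (n / k)^(1 - Ω(1)) here.  So an excess of
-- at most (n / k)^(1 - ε) stays below n / (4k) during γ k log n rounds, and no colour takes over.
--
-- Probabilities are ratios of cardinalities, hence everything up to the final count is an inequality between natural
-- numbers.  Real powers enter through crude bounds on the partial sums: log x ≤ a / N if x ≤ (1 + 1/N)^a,
-- exp (b / N) ≤ (1 - 1/N)^(-b), and exp (- y) exp y ≈ 1.

module Submission where

-- What shapes the proof is the fluctuation. Let h be n / k rounded down and 2^(-L) the failure
-- probability granted to one colour in one round. A class of about h nodes fluctuates by √(h L),
-- which has to stay below Δ / k; so an excess below k √(h L) cannot be tracked, however balanced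
-- the start is, and the proof begins with an artificially large Δ₀. The horizon multiplies it by at
-- most G, a small power of n, and the result must not pass h / 4. The window from k √(h L) to h /
-- (4 G) is nonempty if k³ L G² is below n up to a constant. The bound on k leaves a power of n to
-- spare here, and this permits crude real powers: the exponent 1/4 may worsen as long as it stays
-- below 1/3. That the initial excess lies below the top of the window costs G against (n / k)^ε;
-- hence G must be smaller for smaller ε, which is why γ depends on ε. The thresholds for the excess
-- are a deterministic sequence. Hence the event that is counted is decidable, and its complement is
-- covered round by round and colour by colour, without conditional probabilities.

module Counting where

  open import Defs hiding (C)
  open import Data.Bool using (Bool; true; false; not; _∧_)
  open import Data.Fin using (Fin; zero; suc)
  import Data.Fin.Properties as Fin
  open import Data.List using (List; []; _∷_; length; _++_; map; cartesianProductWith; cartesianProduct; filter; filterᵇ; allFin; tabulate)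
  open import Data.List.Properties using (length-tabulate)
  open import Data.Nat
  open import Data.Nat.DivMod using (/-monoˡ-≤; m*n/n≡m; m≡m%n+[m/n]*n; m%n<n; m/n*n≤m; m/n≤m)
  open import Data.Nat.Properties
  open import Data.Nat.Tactic.RingSolver using (solve-∀)
  open import Data.Product using (_×_; _,_; ∃-syntax)
  open import Data.Sum using (inj₁; inj₂)
  open import Data.Vec using (Vec; []; _∷_; lookup)
  open import Function using (_∘_; id)
  open import Relation.Binary.PropositionalEquality
  open import Relation.Nullary using (yes; no; does; contradiction)
  open import Relation.Unary using (Decidable)

  -- Powers of natural numbers and Bernoulli's inequality

  ^-distribʳ-* : ∀ m n o → (m * n) ^ o ≡ m ^ o * n ^ o
  ^-distribʳ-* m n zero    = refl
  ^-distribʳ-* m n (suc o) = trans (cong (m * n *_) (^-distribʳ-* m n o)) (swap m n (m ^ o) (n ^ o))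
    where
    swap : ∀ a b c d → a * b * (c * d) ≡ a * c * (b * d)
    swap = solve-∀

  ^-swap : ∀ m a b → (m ^ a) ^ b ≡ (m ^ b) ^ a
  ^-swap m a b = trans (^-*-assoc m a b) (trans (cong (m ^_) (*-comm a b)) (sym (^-*-assoc m b a)))

  ^-cancelˡ-≤ : ∀ m {a b} → 1 < m → m ^ a ≤ m ^ b → a ≤ b
  ^-cancelˡ-≤ m {a} {b} 1<m p with a ≤? b
  ... | yes q = q
  ... | no ¬q = contradiction p (<⇒≱ (^-monoʳ-< m 1<m (≰⇒> ¬q)))

  ^-cancelʳ-≤ : ∀ o .{{_ : NonZero o}} {a b} → a ^ o ≤ b ^ o → a ≤ b
  ^-cancelʳ-≤ o {a} {b} p with a ≤? b
  ... | yes q = q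
  ... | no ¬q = contradiction p (<⇒≱ (^-monoˡ-< o (≰⇒> ¬q)))

  n<2^n : ∀ n → n < 2 ^ n
  n<2^n zero    = s≤s z≤n
  n<2^n (suc n) = +-mono-≤ (m^n>0 2 n) (≤-trans (n<2^n n) (≤-reflexive (sym (+-identityʳ _))))

  -- Bernoulli's inequality for (1 + 1/P)^b, multiplied by P^(b + 1) to stay within the natural
  -- numbers.
  bernoulli-up : ∀ P b → (P + b) * P ^ b ≤ P * (1 + P) ^ b
  bernoulli-up P zero    = ≤-reflexive (cong (_* 1) (+-identityʳ P))
  bernoulli-up P (suc b) = begin
    (P + suc b) * (P * P ^ b)        ≡⟨ e₁ P b (P ^ b) ⟩
    P * ((P + b) * P ^ b) + P * P ^ b
      ≤⟨ +-mono-≤ (*-monoʳ-≤ P (bernoulli-up P b)) (*-monoʳ-≤ P (^-monoˡ-≤ b (n≤1+n P))) ⟩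
    P * (P * (1 + P) ^ b) + P * (1 + P) ^ b ≡⟨ e₂ P ((1 + P) ^ b) ⟩
    P * ((1 + P) * (1 + P) ^ b) ∎
    where
    open ≤-Reasoning
    e₁ : ∀ P b X → (P + suc b) * (P * X) ≡ P * ((P + b) * X) + P * X
    e₁ = solve-∀
    e₂ : ∀ P X → P * (P * X) + P * X ≡ P * ((1 + P) * X)
    e₂ = solve-∀

  -- (1 - 1/P)^n ≥ 1 - n/P for P = 1 + p, with both sides moved so that no subtraction occurs.
  bernoulli-down : ∀ p n → suc p ^ suc n ≤ suc p * p ^ n + n * suc p ^ n
  bernoulli-down p zero    = m≤m+n _ _
  bernoulli-down p (suc n) = begin
    P * (P * P ^ n)                          ≤⟨ *-monoʳ-≤ P (bernoulli-down p n) ⟩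
    P * (P * p ^ n + n * P ^ n)              ≡⟨ e₁ p n (p ^ n) (P ^ n) ⟩
    P * (p * p ^ n) + P * p ^ n + n * (P * P ^ n)
      ≤⟨ +-monoˡ-≤ _ (+-monoʳ-≤ (P * (p * p ^ n)) (*-monoʳ-≤ P (^-monoˡ-≤ n (n≤1+n p)))) ⟩
    P * (p * p ^ n) + P * P ^ n + n * (P * P ^ n) ≡⟨ e₂ (P * (p * p ^ n)) n (P * P ^ n) ⟩
    P * (p * p ^ n) + suc n * (P * P ^ n)    ∎
    where
    open ≤-Reasoning
    P = suc p
    e₁ : ∀ p n X Y → suc p * (suc p * X + n * Y) ≡ suc p * (p * X) + suc p * X + n * (suc p * Y)
    e₁ = solve-∀
    e₂ : ∀ a n Y → a + Y + n * Y ≡ a + suc n * Y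
    e₂ = solve-∀

  -- Here q stands for P - n with P = `suc p`, so that `bernoulli-down` reads (1 - 1/P)^n ≥ q / P.
  bernoulli-down′ : ∀ p n q → q + n ≡ suc p → q * suc p ^ n ≤ suc p * p ^ n
  bernoulli-down′ p n q eq = +-cancelʳ-≤ (n * suc p ^ n) _ _ (begin
    q * suc p ^ n + n * suc p ^ n ≡⟨ *-distribʳ-+ (suc p ^ n) q n ⟨
    (q + n) * suc p ^ n           ≡⟨ cong (_* suc p ^ n) eq ⟩
    suc p ^ suc n                 ≤⟨ bernoulli-down p n ⟩
    suc p * p ^ n + n * suc p ^ n ∎)
    where open ≤-Reasoning

  -- AM-GM for n numbers 1 + b/(Mn) and b numbers 1 - 1/M, of total n + b, where M = 1 + M′:
  -- by Bernoulli the product is at most ((1 + s)(1 - s))^(bn) with s = 1/(Mn).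
  amgm : ∀ M′ n b .{{_ : NonZero n}} → (suc M′ * n + b) ^ n * M′ ^ b ≤ suc M′ ^ (n + b) * n ^ n
  amgm M′ n@(suc n-1) b = *-cancelʳ-≤ _ _ (n ^ b) {{m^n≢0 n b}} (begin
    (P + b) ^ n * M′ ^ b * n ^ b    ≡⟨ *-assoc ((P + b) ^ n) _ _ ⟩
    (P + b) ^ n * (M′ ^ b * n ^ b)  ≡⟨ cong ((P + b) ^ n *_) (^-distribʳ-* M′ n b) ⟨
    (P + b) ^ n * (M′ * n) ^ b      ≤⟨ core ⟩
    P ^ n * P ^ b                   ≡⟨ cong₂ _*_ (^-distribʳ-* M n n) (^-distribʳ-* M n b) ⟩
    M ^ n * n ^ n * (M ^ b * n ^ b) ≡⟨ e₀ (M ^ n) (n ^ n) (M ^ b) (n ^ b) ⟩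
    M ^ n * M ^ b * n ^ n * n ^ b   ≡⟨ cong (λ z → z * n ^ n * n ^ b) (^-distribˡ-+-* M n b) ⟨
    M ^ (n + b) * n ^ n * n ^ b     ∎)
    where
    open ≤-Reasoning
    M = suc M′
    P = M * n
    p = n-1 + M′ * n
    e₀ : ∀ a b c d → a * b * (c * d) ≡ a * c * b * d
    e₀ = solve-∀
    up : (P + b) ^ n * (P ^ b) ^ n ≤ P ^ n * (suc P ^ b) ^ n
    up = begin
      (P + b) ^ n * (P ^ b) ^ n  ≡⟨ ^-distribʳ-* (P + b) (P ^ b) n ⟨
      ((P + b) * P ^ b) ^ n      ≤⟨ ^-monoˡ-≤ n (bernoulli-up P b) ⟩
      (P * suc P ^ b) ^ n        ≡⟨ ^-distribʳ-* P (suc P ^ b) n ⟩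
      P ^ n * (suc P ^ b) ^ n    ∎
    down : (M′ * n) ^ b * (P ^ n) ^ b ≤ P ^ b * (p ^ n) ^ b
    down = begin
      (M′ * n) ^ b * (P ^ n) ^ b ≡⟨ ^-distribʳ-* (M′ * n) (P ^ n) b ⟨
      (M′ * n * P ^ n) ^ b       ≤⟨ ^-monoˡ-≤ b (bernoulli-down′ p n (M′ * n) (+-comm (M′ * n) n)) ⟩
      (P * p ^ n) ^ b            ≡⟨ ^-distribʳ-* P (p ^ n) b ⟩
      P ^ b * (p ^ n) ^ b        ∎
    sq : (suc P ^ b) ^ n * (p ^ n) ^ b ≤ (P ^ b) ^ n * (P ^ n) ^ b
    sq = begin
      (suc P ^ b) ^ n * (p ^ n) ^ b ≡⟨ cong ((suc P ^ b) ^ n *_) (^-swap p n b) ⟩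
      (suc P ^ b) ^ n * (p ^ b) ^ n ≡⟨ two (suc P) p ⟨
      ((suc P * p) ^ b) ^ n         ≤⟨ ^-monoˡ-≤ n (^-monoˡ-≤ b (lt p)) ⟩
      ((P * P) ^ b) ^ n             ≡⟨ two P P ⟩
      (P ^ b) ^ n * (P ^ b) ^ n     ≡⟨ cong ((P ^ b) ^ n *_) (^-swap P b n) ⟩
      (P ^ b) ^ n * (P ^ n) ^ b     ∎
      where
      two : ∀ x y → ((x * y) ^ b) ^ n ≡ (x ^ b) ^ n * (y ^ b) ^ n
      two x y = trans (cong (_^ n) (^-distribʳ-* x y b)) (^-distribʳ-* (x ^ b) (y ^ b) n)
      e : ∀ p → suc p * suc p ≡ suc (suc p) * p + 1
      e = solve-∀
      lt : ∀ p → suc (suc p) * p ≤ suc p * suc p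
      lt p = ≤-trans (m≤m+n _ 1) (≤-reflexive (sym (e p)))
    core : (P + b) ^ n * (M′ * n) ^ b ≤ P ^ n * P ^ b
    core = *-cancelʳ-≤ _ _ ((P ^ b) ^ n * (P ^ n) ^ b)
             {{m*n≢0 _ _ {{m^n≢0 _ n {{m^n≢0 P b}}}} {{m^n≢0 _ b {{m^n≢0 P n}}}}}} (begin
      (P + b) ^ n * (M′ * n) ^ b * ((P ^ b) ^ n * (P ^ n) ^ b) ≡⟨ e₁ ((P + b) ^ n) ((M′ * n) ^ b) ((P ^ b) ^ n) ((P ^ n) ^ b) ⟩
      ((P + b) ^ n * (P ^ b) ^ n) * ((M′ * n) ^ b * (P ^ n) ^ b) ≤⟨ *-mono-≤ up down ⟩
      (P ^ n * (suc P ^ b) ^ n) * (P ^ b * (p ^ n) ^ b)        ≡⟨ e₁ (P ^ n) ((suc P ^ b) ^ n) (P ^ b) ((p ^ n) ^ b) ⟩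
      P ^ n * P ^ b * ((suc P ^ b) ^ n * (p ^ n) ^ b)          ≤⟨ *-monoʳ-≤ (P ^ n * P ^ b) sq ⟩
      P ^ n * P ^ b * ((P ^ b) ^ n * (P ^ n) ^ b)              ∎)
      where
      e₁ : ∀ a b c d → a * b * (c * d) ≡ (a * c) * (b * d)
      e₁ = solve-∀

  -- Bernoulli gives (1 + 1/M)^M ≥ 2, and d contains f blocks of length M.
  double-up : ∀ M .{{_ : NonZero M}} f {d} → M * f ≤ d → 2 ^ f * M ^ d ≤ suc M ^ d
  double-up M f {d} le with m≤n⇒∃[o]m+o≡n le
  ... | e , refl = begin
    2 ^ f * M ^ (M * f + e)             ≡⟨ cong (2 ^ f *_) (split M) ⟩
    2 ^ f * ((M ^ M) ^ f * M ^ e)       ≡⟨ *-assoc (2 ^ f) _ _ ⟨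
    2 ^ f * (M ^ M) ^ f * M ^ e         ≡⟨ cong (_* M ^ e) (^-distribʳ-* 2 (M ^ M) f) ⟨
    (2 * M ^ M) ^ f * M ^ e             ≤⟨ *-mono-≤ (^-monoˡ-≤ f once) (^-monoˡ-≤ e (n≤1+n M)) ⟩
    (suc M ^ M) ^ f * suc M ^ e         ≡⟨ split (suc M) ⟨
    suc M ^ (M * f + e)                 ∎
    where
    open ≤-Reasoning
    split : ∀ x → x ^ (M * f + e) ≡ (x ^ M) ^ f * x ^ e
    split x = trans (^-distribˡ-+-* x (M * f) e) (cong (_* x ^ e) (sym (^-*-assoc x M f)))
    once : 2 * M ^ M ≤ suc M ^ M
    once = *-cancelˡ-≤ M (begin
      M * (2 * M ^ M)   ≡⟨ e₁ M (M ^ M) ⟩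
      (M + M) * M ^ M   ≤⟨ bernoulli-up M M ⟩
      M * suc M ^ M     ∎)
      where
      e₁ : ∀ M X → M * (2 * X) ≡ (M + M) * X
      e₁ = solve-∀

  -- With P = `suc p`, Bernoulli gives (1 - 1/P)^w ≥ 1 - w/P ≥ 1/2, and e blocks of length w cover
  -- b.
  halve-down : ∀ p w e {b} → 2 * w ≤ suc p → .{{_ : NonZero p}} → b ≤ w * e → suc p ^ b ≤ 2 ^ e * p ^ b
  halve-down p w e {b} 2w≤P le with m≤n⇒∃[o]m+o≡n le
  ... | r , eq = *-cancelʳ-≤ _ _ (p ^ r) {{m^n≢0 p r}} (begin
    suc p ^ b * p ^ r      ≤⟨ *-monoʳ-≤ (suc p ^ b) (^-monoˡ-≤ r (n≤1+n p)) ⟩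
    suc p ^ b * suc p ^ r  ≡⟨ whole (suc p) ⟨
    (suc p ^ w) ^ e        ≤⟨ ^-monoˡ-≤ e once ⟩
    (2 * p ^ w) ^ e        ≡⟨ ^-distribʳ-* 2 (p ^ w) e ⟩
    2 ^ e * (p ^ w) ^ e    ≡⟨ cong (2 ^ e *_) (whole p) ⟩
    2 ^ e * (p ^ b * p ^ r) ≡⟨ *-assoc (2 ^ e) _ _ ⟨
    2 ^ e * p ^ b * p ^ r  ∎)
    where
    open ≤-Reasoning
    whole : ∀ x → (x ^ w) ^ e ≡ x ^ b * x ^ r
    whole x = trans (^-*-assoc x w e) (trans (cong (x ^_) (sym eq)) (^-distribˡ-+-* x b r))
    P = suc p
    e₂ : ∀ a → 2 * a ≡ a + a
    e₂ = solve-∀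
    once : P ^ w ≤ 2 * p ^ w
    once = *-cancelˡ-≤ P (+-cancelʳ-≤ (P * P ^ w) _ _ (begin
      P * P ^ w + P * P ^ w            ≡⟨ e₂ (P * P ^ w) ⟨
      2 * (P * P ^ w)                  ≤⟨ *-monoʳ-≤ 2 (bernoulli-down p w) ⟩
      2 * (P * p ^ w + w * P ^ w)      ≡⟨ e₃ P (p ^ w) w (P ^ w) ⟩
      P * (2 * p ^ w) + 2 * w * P ^ w  ≤⟨ +-monoʳ-≤ (P * (2 * p ^ w)) (*-monoˡ-≤ (P ^ w) 2w≤P) ⟩
      P * (2 * p ^ w) + P * P ^ w      ∎))
      where
      e₃ : ∀ P X w Y → 2 * (P * X + w * Y) ≡ P * (2 * X) + 2 * w * Y
      e₃ = solve-∀

  -- Finite sums over ℕ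

  private variable
    A X Y : Set

  ∑ : List A → (A → ℕ) → ℕ
  ∑ []       f = 0
  ∑ (x ∷ xs) f = f x + ∑ xs f

  ∑-cong : ∀ (xs : List A) {f g} → (∀ x → f x ≡ g x) → ∑ xs f ≡ ∑ xs g
  ∑-cong []       e = refl
  ∑-cong (x ∷ xs) e = cong₂ _+_ (e x) (∑-cong xs e)

  ∑-mono : ∀ (xs : List A) {f g} → (∀ x → f x ≤ g x) → ∑ xs f ≤ ∑ xs g
  ∑-mono []       e = z≤n
  ∑-mono (x ∷ xs) e = +-mono-≤ (e x) (∑-mono xs e)

  +-interchange : ∀ a b c d → a + b + (c + d) ≡ a + c + (b + d)
  +-interchange = solve-∀

  ∑-+ : ∀ (xs : List A) f g → ∑ xs (λ x → f x + g x) ≡ ∑ xs f + ∑ xs g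
  ∑-+ []       f g = refl
  ∑-+ (x ∷ xs) f g = trans (cong (f x + g x +_) (∑-+ xs f g)) (+-interchange (f x) (g x) _ _)

  ∑-*ˡ : ∀ (xs : List A) a f → ∑ xs (λ x → a * f x) ≡ a * ∑ xs f
  ∑-*ˡ []       a f = sym (*-zeroʳ a)
  ∑-*ˡ (x ∷ xs) a f = trans (cong (a * f x +_) (∑-*ˡ xs a f)) (sym (*-distribˡ-+ a (f x) _))

  ∑-*ʳ : ∀ (xs : List A) a f → ∑ xs (λ x → f x * a) ≡ ∑ xs f * a
  ∑-*ʳ xs a f = trans (∑-cong xs (λ x → *-comm (f x) a)) (trans (∑-*ˡ xs a f) (*-comm a _))

  ∑-const : ∀ (xs : List A) a → ∑ xs (λ _ → a) ≡ length xs * a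
  ∑-const []       a = refl
  ∑-const (x ∷ xs) a = cong (a +_) (∑-const xs a)

  ∑-swap : ∀ (xs : List X) (ys : List Y) (f : X → Y → ℕ) →
           ∑ xs (λ x → ∑ ys (f x)) ≡ ∑ ys (λ y → ∑ xs (λ x → f x y))
  ∑-swap []       ys f = sym (trans (∑-const ys 0) (*-zeroʳ (length ys)))
  ∑-swap (x ∷ xs) ys f = trans (cong (∑ ys (f x) +_) (∑-swap xs ys f)) (sym (∑-+ ys (f x) _))

  ∑-++ : ∀ (xs ys : List A) f → ∑ (xs ++ ys) f ≡ ∑ xs f + ∑ ys f
  ∑-++ []       ys f = refl
  ∑-++ (x ∷ xs) ys f = trans (cong (f x +_) (∑-++ xs ys f)) (sym (+-assoc (f x) _ _))

  ∑-map : ∀ (h : X → Y) xs f → ∑ (map h xs) f ≡ ∑ xs (f ∘ h)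
  ∑-map h []       f = refl
  ∑-map h (x ∷ xs) f = cong (f (h x) +_) (∑-map h xs f)

  ∑-cartesianProductWith : ∀ (h : X → Y → A) xs ys f →
    ∑ (cartesianProductWith h xs ys) f ≡ ∑ xs (λ x → ∑ ys (λ y → f (h x y)))
  ∑-cartesianProductWith h []       ys f = refl
  ∑-cartesianProductWith h (x ∷ xs) ys f =
    trans (∑-++ (map (h x) ys) _ f) (cong₂ _+_ (∑-map (h x) ys f) (∑-cartesianProductWith h xs ys f))

  length≡∑1 : ∀ (xs : List A) → length xs ≡ ∑ xs (λ _ → 1)
  length≡∑1 xs = sym (trans (∑-const xs 1) (*-identityʳ _))

  length-cartesianProductWith : ∀ (h : X → Y → A) xs ys →
    length (cartesianProductWith h xs ys) ≡ length xs * length ys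
  length-cartesianProductWith h xs ys = trans (length≡∑1 (cartesianProductWith h xs ys))
    (trans (∑-cartesianProductWith h xs ys _) (trans (∑-cong xs (λ _ → sym (length≡∑1 ys))) (∑-const xs _)))

  length-vectors : ∀ (xs : List A) m → length (vectors xs m) ≡ length xs ^ m
  length-vectors xs zero    = refl
  length-vectors xs (suc m) =
    trans (length-cartesianProductWith _∷_ xs (vectors xs m)) (cong (length xs *_) (length-vectors xs m))

  -- Termwise 2ab ≤ a² + b². This is the cross term in the induction step of `cauchySchwarz`.
  ∑² : ∀ (xs : List A) f a → 2 * (a * ∑ xs f) ≤ length xs * (a * a) + ∑ xs (λ x → f x * f x)
  ∑² []       f a = ≤-reflexive (cong (2 *_) (*-zeroʳ a))
  ∑² (x ∷ xs) f a = begin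
    2 * (a * (f x + ∑ xs f))                                ≡⟨ e₁ a (f x) (∑ xs f) ⟩
    2 * (a * f x) + 2 * (a * ∑ xs f)                        ≤⟨ +-mono-≤ (2ab≤a²+b² a (f x)) (∑² xs f a) ⟩
    a * a + f x * f x + (length xs * (a * a) + ∑ xs (λ x → f x * f x)) ≡⟨ +-interchange (a * a) _ _ _ ⟩
    a * a + length xs * (a * a) + (f x * f x + ∑ xs (λ x → f x * f x)) ∎
    where
    open ≤-Reasoning
    e₁ : ∀ a b c → 2 * (a * (b + c)) ≡ 2 * (a * b) + 2 * (a * c)
    e₁ = solve-∀
    ordered : ∀ a b → a ≤ b → 2 * (a * b) ≤ a * a + b * b
    ordered a b le with m≤n⇒∃[o]m+o≡n le
    ... | o , refl = ≤-trans (m≤m+n _ (o * o)) (≤-reflexive (e a o))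
      where
      e : ∀ a o → 2 * (a * (a + o)) + o * o ≡ a * a + (a + o) * (a + o)
      e = solve-∀
    2ab≤a²+b² : ∀ a b → 2 * (a * b) ≤ a * a + b * b
    2ab≤a²+b² a b with ≤-total a b
    ... | inj₁ le = ordered a b le
    ... | inj₂ le = ≤-trans (≤-reflexive (cong (2 *_) (*-comm a b)))
                            (≤-trans (ordered b a le) (≤-reflexive (+-comm (b * b) _)))

  cauchySchwarz : ∀ (xs : List A) f → ∑ xs f * ∑ xs f ≤ length xs * ∑ xs (λ x → f x * f x)
  cauchySchwarz []       f = z≤n
  cauchySchwarz (x ∷ xs) f = begin
    (a + F) * (a + F)                       ≡⟨ e₁ a F ⟩
    a * a + 2 * (a * F) + F * F             ≤⟨ +-mono-≤ (+-monoʳ-≤ (a * a) (∑² xs f a)) (cauchySchwarz xs f) ⟩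
    a * a + (l * (a * a) + S) + l * S       ≡⟨ e₂ a l S ⟩
    suc l * (a * a + S)                     ∎
    where
    open ≤-Reasoning
    a = f x
    F = ∑ xs f
    l = length xs
    S = ∑ xs (λ x → f x * f x)
    e₁ : ∀ a F → (a + F) * (a + F) ≡ a * a + 2 * (a * F) + F * F
    e₁ = solve-∀
    e₂ : ∀ a l S → a * a + (l * (a * a) + S) + l * S ≡ suc l * (a * a + S)
    e₂ = solve-∀

  𝟙 : Bool → ℕ
  𝟙 true  = 1
  𝟙 false = 0

  length-filterᵇ : ∀ (p : A → Bool) xs → length (filterᵇ p xs) ≡ ∑ xs (𝟙 ∘ p)
  length-filterᵇ p []       = refl
  length-filterᵇ p (x ∷ xs) with p x
  ... | true  = cong suc (length-filterᵇ p xs)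
  ... | false = length-filterᵇ p xs

  length-filter : ∀ {P : A → Set} (P? : Decidable P) xs → length (filter P? xs) ≡ ∑ xs (𝟙 ∘ does ∘ P?)
  length-filter P? []       = refl
  length-filter P? (x ∷ xs) with does (P? x)
  ... | true  = cong suc (length-filter P? xs)
  ... | false = length-filter P? xs

  ∑ᵛ : ∀ {m} → (A → ℕ) → Vec A m → ℕ
  ∑ᵛ f []      = 0
  ∑ᵛ f (x ∷ v) = f x + ∑ᵛ f v

  ∏ᵛ : ∀ {m} → (A → ℕ) → Vec A m → ℕ
  ∏ᵛ f []      = 1
  ∏ᵛ f (x ∷ v) = f x * ∏ᵛ f v

  ∑-tabulate : ∀ {n} (f : Fin n → A) g → ∑ (tabulate f) g ≡ ∑ (allFin n) (g ∘ f)
  ∑-tabulate {n = zero}  f g = refl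
  ∑-tabulate {n = suc n} f g = cong (g (f zero) +_) (trans (∑-tabulate (f ∘ suc) g) (sym (∑-tabulate suc (g ∘ f))))

  ∑-lookup : ∀ {n} (f : A → ℕ) (v : Vec A n) → ∑ (allFin n) (λ i → f (lookup v i)) ≡ ∑ᵛ f v
  ∑-lookup f []      = refl
  ∑-lookup {n = suc n} f (x ∷ v) =
    cong (f x +_) (trans (∑-tabulate {n = n} Fin.suc (λ i → f (lookup (x ∷ v) i))) (∑-lookup f v))

  -- Independence of the entries in counted form: expanding the power yields one product for each
  -- vector.
  ∑-∏ᵛ : ∀ (xs : List A) f m → ∑ (vectors xs m) (∏ᵛ f) ≡ ∑ xs f ^ m
  ∑-∏ᵛ xs f zero    = refl
  ∑-∏ᵛ xs f (suc m) = begin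
    ∑ (vectors xs (suc m)) (∏ᵛ f)                           ≡⟨ ∑-cartesianProductWith _∷_ xs (vectors xs m) _ ⟩
    ∑ xs (λ x → ∑ (vectors xs m) (λ v → f x * ∏ᵛ f v))      ≡⟨ ∑-cong xs (λ x → ∑-*ˡ (vectors xs m) (f x) (∏ᵛ f)) ⟩
    ∑ xs (λ x → f x * ∑ (vectors xs m) (∏ᵛ f))              ≡⟨ ∑-*ʳ xs _ f ⟩
    ∑ xs f * ∑ (vectors xs m) (∏ᵛ f)                        ≡⟨ cong (∑ xs f *_) (∑-∏ᵛ xs f m) ⟩
    ∑ xs f * ∑ xs f ^ m                                     ∎
    where open ≡-Reasoning

  -- A Chernoff bound by counting

  -- Each hit replaces a factor M by 1 + M, so the product is (1 + M)^c M^(m - c) for c hits;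
  -- multiplying by M^c avoids the subtraction.
  tilted-weight : ∀ M (p : A → Bool) {m} (v : Vec A m) →
    suc M ^ ∑ᵛ (𝟙 ∘ p) v * M ^ m ≡ ∏ᵛ (λ x → M + 𝟙 (p x)) v * M ^ ∑ᵛ (𝟙 ∘ p) v
  tilted-weight M p []      = refl
  tilted-weight M p {m = suc m} (x ∷ v) with p x | tilted-weight M p v
  ... | true  | ih = trans (e (suc M) (suc M ^ c) M (M ^ m))
                       (trans (cong (suc M * M *_) ih) (trans (e (suc M) M W (M ^ c)) (cong (λ z → z * W * (M * M ^ c)) (+-comm 1 M))))
    where
    c = ∑ᵛ (𝟙 ∘ p) v
    W = ∏ᵛ (λ x → M + 𝟙 (p x)) v
    e : ∀ a b c d → a * b * (c * d) ≡ a * c * (b * d)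
    e = solve-∀
  ... | false | ih = trans (e (suc M ^ c) M (M ^ m))
                       (trans (cong (M *_) ih) (trans (sym (*-assoc M W _)) (cong (λ z → z * W * M ^ c) (sym (+-identityʳ M)))))
    where
    c = ∑ᵛ (𝟙 ∘ p) v
    W = ∏ᵛ (λ x → M + 𝟙 (p x)) v
    e : ∀ a c d → a * (c * d) ≡ c * (a * d)
    e = solve-∀

  -- The exponential moment is that of (1 + 1/M)^(number of hits), cleared of denominators.
  markov : ∀ M .{{_ : NonZero M}} (p : A → Bool) a xs m →
    ∑ (vectors xs m) (λ v → 𝟙 (a ≤ᵇ ∑ᵛ (𝟙 ∘ p) v)) * (suc M ^ a * M ^ m)
      ≤ M ^ a * (M * length xs + ∑ xs (𝟙 ∘ p)) ^ m
  markov M p a xs m = begin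
    ∑ V bad * (suc M ^ a * M ^ m)             ≡⟨ ∑-*ʳ V _ bad ⟨
    ∑ V (λ v → bad v * (suc M ^ a * M ^ m))   ≤⟨ ∑-mono V pointwise ⟩
    ∑ V (λ v → M ^ a * ∏ᵛ w v)                ≡⟨ ∑-*ˡ V (M ^ a) (∏ᵛ w) ⟩
    M ^ a * ∑ V (∏ᵛ w)                        ≡⟨ cong (M ^ a *_) (∑-∏ᵛ xs w m) ⟩
    M ^ a * ∑ xs w ^ m                        ≡⟨ cong (λ z → M ^ a * z ^ m) total ⟩
    M ^ a * (M * length xs + ∑ xs (𝟙 ∘ p)) ^ m ∎
    where
    open ≤-Reasoning
    V = vectors xs m
    w = λ x → M + 𝟙 (p x)
    bad = λ v → 𝟙 (a ≤ᵇ ∑ᵛ (𝟙 ∘ p) v)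
    total : ∑ xs w ≡ M * length xs + ∑ xs (𝟙 ∘ p)
    total = trans (∑-+ xs (λ _ → M) (𝟙 ∘ p)) (cong (_+ ∑ xs (𝟙 ∘ p)) (trans (∑-const xs M) (*-comm (length xs) M)))
    large : ∀ v → a ≤ ∑ᵛ (𝟙 ∘ p) v → suc M ^ a * M ^ m ≤ M ^ a * ∏ᵛ w v
    large v le with m≤n⇒∃[o]m+o≡n le
    ... | e , eq = *-cancelʳ-≤ _ _ (M ^ e) {{m^n≢0 M e}} (begin
      suc M ^ a * M ^ m * M ^ e          ≤⟨ *-monoʳ-≤ (suc M ^ a * M ^ m) (^-monoˡ-≤ e (n≤1+n M)) ⟩
      suc M ^ a * M ^ m * suc M ^ e      ≡⟨ e₁ (suc M ^ a) (M ^ m) (suc M ^ e) ⟩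
      suc M ^ a * suc M ^ e * M ^ m      ≡⟨ cong (_* M ^ m) (^-distribˡ-+-* (suc M) a e) ⟨
      suc M ^ (a + e) * M ^ m            ≡⟨ cong (λ z → suc M ^ z * M ^ m) eq ⟩
      suc M ^ ∑ᵛ (𝟙 ∘ p) v * M ^ m       ≡⟨ tilted-weight M p v ⟩
      ∏ᵛ w v * M ^ ∑ᵛ (𝟙 ∘ p) v          ≡⟨ cong (λ z → ∏ᵛ w v * M ^ z) eq ⟨
      ∏ᵛ w v * M ^ (a + e)               ≡⟨ cong (∏ᵛ w v *_) (^-distribˡ-+-* M a e) ⟩
      ∏ᵛ w v * (M ^ a * M ^ e)           ≡⟨ e₂ (∏ᵛ w v) (M ^ a) (M ^ e) ⟩
      M ^ a * ∏ᵛ w v * M ^ e             ∎)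
      where
      e₁ : ∀ a b c → a * b * c ≡ a * c * b
      e₁ = solve-∀
      e₂ : ∀ a b c → a * (b * c) ≡ b * a * c
      e₂ = solve-∀
    pointwise : ∀ v → bad v * (suc M ^ a * M ^ m) ≤ M ^ a * ∏ᵛ w v
    pointwise v with a ≤ᵇ ∑ᵛ (𝟙 ∘ p) v in eq
    ... | false = z≤n
    ... | true  = ≤-trans (≤-reflexive (*-identityˡ _)) (large v (≤ᵇ⇒≤ a _ (subst Data.Bool.T (sym eq) _)))

  -- The deviation d is compared with the standard deviation through M = 2m:
  -- taking M of order √(b / L) balances the two error terms b / M² and L against d / M.
  chernoff : ∀ m L n b d .{{_ : NonZero m}} .{{_ : NonZero n}} (p : A → Bool) xs →
    length xs ≡ n * (n * n) → ∑ xs (𝟙 ∘ p) ≤ b * (n * n) →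
    b ≤ 4 * (m * m) * L → 6 * (m * L) ≤ d →
    ∑ (vectors xs n) (λ v → 𝟙 (b + d ≤ᵇ ∑ᵛ (𝟙 ∘ p) v)) * 2 ^ L ≤ length xs ^ n
  chernoff m@(suc m-1) L n@(suc _) b d p xs len≡ mean b≤ d≥ = *-cancelʳ-≤ _ _ (suc M ^ a * M′ ^ b * M ^ n) {{nz}} (begin
    #bad * 2 ^ L * (suc M ^ a * M′ ^ b * M ^ n)   ≡⟨ e₁ #bad (2 ^ L) (suc M ^ a) (M′ ^ b) (M ^ n) ⟩
    #bad * (suc M ^ a * M ^ n) * (2 ^ L * M′ ^ b) ≤⟨ *-monoˡ-≤ (2 ^ L * M′ ^ b) (markov M p a xs n) ⟩
    M ^ a * (M * length xs + ∑ xs (𝟙 ∘ p)) ^ n * (2 ^ L * M′ ^ b)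
      ≤⟨ *-monoˡ-≤ (2 ^ L * M′ ^ b) (*-monoʳ-≤ (M ^ a) (^-monoˡ-≤ n total)) ⟩
    M ^ a * ((M * n + b) * (n * n)) ^ n * (2 ^ L * M′ ^ b)
      ≡⟨ cong (λ z → M ^ a * z * (2 ^ L * M′ ^ b)) (^-distribʳ-* (M * n + b) (n * n) n) ⟩
    M ^ a * ((M * n + b) ^ n * (n * n) ^ n) * (2 ^ L * M′ ^ b)
      ≡⟨ e₂ (M ^ a) ((M * n + b) ^ n) ((n * n) ^ n) (2 ^ L) (M′ ^ b) ⟩
    (M * n + b) ^ n * M′ ^ b * (2 ^ L * M ^ a * (n * n) ^ n)
      ≤⟨ *-monoˡ-≤ (2 ^ L * M ^ a * (n * n) ^ n) (amgm M′ n b) ⟩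
    M ^ (n + b) * n ^ n * (2 ^ L * M ^ a * (n * n) ^ n)
      ≡⟨ cong (λ z → z * n ^ n * (2 ^ L * M ^ a * (n * n) ^ n)) (^-distribˡ-+-* M n b) ⟩
    M ^ n * M ^ b * n ^ n * (2 ^ L * M ^ a * (n * n) ^ n)
      ≡⟨ e₃ (M ^ n) (M ^ b) (n ^ n) (2 ^ L) (M ^ a) ((n * n) ^ n) ⟩
    n ^ n * (n * n) ^ n * (2 ^ L * (M ^ a * M ^ b) * M ^ n)
      ≤⟨ *-monoʳ-≤ (n ^ n * (n * n) ^ n) (*-monoˡ-≤ (M ^ n) tilt) ⟩
    n ^ n * (n * n) ^ n * (suc M ^ a * M′ ^ b * M ^ n)
      ≡⟨ cong (_* (suc M ^ a * M′ ^ b * M ^ n)) (^-distribʳ-* n (n * n) n) ⟨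
    (n * (n * n)) ^ n * (suc M ^ a * M′ ^ b * M ^ n)
      ≡⟨ cong (λ z → z ^ n * (suc M ^ a * M′ ^ b * M ^ n)) len≡ ⟨
    length xs ^ n * (suc M ^ a * M′ ^ b * M ^ n)  ∎)
    where
    open ≤-Reasoning
    a = b + d
    M′ = suc (2 * m-1)
    M = suc M′
    #bad = ∑ (vectors xs n) (λ v → 𝟙 (a ≤ᵇ ∑ᵛ (𝟙 ∘ p) v))
    nz : NonZero (suc M ^ a * M′ ^ b * M ^ n)
    nz = m*n≢0 _ _ {{m*n≢0 _ _ {{m^n≢0 (suc M) a}} {{m^n≢0 M′ b}}}} {{m^n≢0 M n}}
    e₁ : ∀ x q s t u → x * q * (s * t * u) ≡ x * (s * u) * (q * t)
    e₁ = solve-∀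
    e₂ : ∀ x y z q t → x * (y * z) * (q * t) ≡ y * t * (q * x * z)
    e₂ = solve-∀
    e₃ : ∀ x y z q s t → x * y * z * (q * s * t) ≡ z * t * (q * (s * y) * x)
    e₃ = solve-∀
    total : M * length xs + ∑ xs (𝟙 ∘ p) ≤ (M * n + b) * (n * n)
    total = begin
      M * length xs + ∑ xs (𝟙 ∘ p)   ≤⟨ +-monoʳ-≤ _ mean ⟩
      M * length xs + b * (n * n)    ≡⟨ cong (λ z → M * z + b * (n * n)) len≡ ⟩
      M * (n * (n * n)) + b * (n * n) ≡⟨ e M b n ⟩
      (M * n + b) * (n * n)          ∎
      where
      e : ∀ M b n → M * (n * (n * n)) + b * (n * n) ≡ (M * n + b) * (n * n)
      e = solve-∀
    M≡ : M ≡ 2 * m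
    M≡ = e m-1
      where
      e : ∀ x → suc (suc (2 * x)) ≡ 2 * suc x
      e = solve-∀
    -- q + 1 = M² - 1 and q + 2 = M², written in the successor form that `halve-down` takes.
    q = suc (suc (2 * m-1 + 2 * m-1 * suc M))
    M²-1 : suc q ≡ suc M * M′
    M²-1 = e (2 * m-1)
      where
      e : ∀ x → suc (suc (suc (x + x * suc (suc (suc x))))) ≡ suc (suc (suc x)) * suc x
      e = solve-∀
    M² : suc (suc q) ≡ M * M
    M² = e (2 * m-1)
      where
      e : ∀ x → suc (suc (suc (suc (x + x * suc (suc (suc x)))))) ≡ suc (suc x) * suc (suc x)
      e = solve-∀
    down : (M * M) ^ b ≤ 2 ^ (2 * L) * (suc M * M′) ^ b
    down = subst₂ (λ x y → x ^ b ≤ 2 ^ (2 * L) * y ^ b) M² M²-1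
      (halve-down (suc q) (2 * (m * m)) (2 * L)
        (≤-reflexive (trans (e m) (trans (cong (λ z → z * z) (sym M≡)) (sym M²))))
        (≤-trans b≤ (≤-reflexive (e′ m L))))
      where
      e : ∀ m → 2 * (2 * (m * m)) ≡ 2 * m * (2 * m)
      e = solve-∀
      e′ : ∀ m L → 4 * (m * m) * L ≡ 2 * (m * m) * (2 * L)
      e′ = solve-∀
    -- Of the factor 2^(3L) won from d ≥ 3L M, the part 2^(2L) pays for the variance term in `down`,
    -- and 2^L remains as the tail bound.
    up : 2 ^ (3 * L) * M ^ d ≤ suc M ^ d
    up = double-up M (3 * L) (≤-trans (≤-reflexive (trans (cong (_* (3 * L)) M≡) (e m L))) d≥)
      where
      e : ∀ m L → 2 * m * (3 * L) ≡ 6 * (m * L)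
      e = solve-∀
    tilt : 2 ^ L * (M ^ a * M ^ b) ≤ suc M ^ a * M′ ^ b
    tilt = begin
      2 ^ L * (M ^ (b + d) * M ^ b)       ≡⟨ cong (λ z → 2 ^ L * (z * M ^ b)) (^-distribˡ-+-* M b d) ⟩
      2 ^ L * (M ^ b * M ^ d * M ^ b)     ≡⟨ e₄ (2 ^ L) (M ^ b) (M ^ d) ⟩
      2 ^ L * M ^ d * (M ^ b * M ^ b)     ≡⟨ cong (2 ^ L * M ^ d *_) (^-distribʳ-* M M b) ⟨
      2 ^ L * M ^ d * (M * M) ^ b         ≤⟨ *-monoʳ-≤ (2 ^ L * M ^ d) down ⟩
      2 ^ L * M ^ d * (2 ^ (2 * L) * (suc M * M′) ^ b)
        ≡⟨ e₅ (2 ^ L) (M ^ d) (2 ^ (2 * L)) ((suc M * M′) ^ b) ⟩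
      2 ^ L * 2 ^ (2 * L) * M ^ d * (suc M * M′) ^ b
        ≡⟨ cong (λ z → z * M ^ d * (suc M * M′) ^ b) (^-distribˡ-+-* 2 L (2 * L)) ⟨
      2 ^ (3 * L) * M ^ d * (suc M * M′) ^ b ≤⟨ *-monoˡ-≤ ((suc M * M′) ^ b) up ⟩
      suc M ^ d * (suc M * M′) ^ b        ≡⟨ cong (suc M ^ d *_) (^-distribʳ-* (suc M) M′ b) ⟩
      suc M ^ d * (suc M ^ b * M′ ^ b)    ≡⟨ e₆ (suc M ^ d) (suc M ^ b) (M′ ^ b) ⟩
      suc M ^ b * suc M ^ d * M′ ^ b      ≡⟨ cong (_* M′ ^ b) (^-distribˡ-+-* (suc M) b d) ⟨
      suc M ^ (b + d) * M′ ^ b            ∎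
      where
      e₄ : ∀ q x y → q * (x * y * x) ≡ q * y * (x * x)
      e₄ = solve-∀
      e₅ : ∀ q x r y → q * x * (r * y) ≡ q * r * x * y
      e₅ = solve-∀
      e₆ : ∀ x y z → x * (y * z) ≡ y * x * z
      e₆ = solve-∀

  -- One round of the protocol

  length-allFin : ∀ n → length (allFin n) ≡ n
  length-allFin n = length-tabulate {n = n} id

  δ : ∀ {k} → Fin k → Fin k → ℕ
  δ a b = 𝟙 (does (a Fin.≟ b))

  ∑-δ : ∀ {k} (a : Fin k) (f : Fin k → ℕ) → ∑ (allFin k) (λ h → δ a h * f h) ≡ f a
  ∑-δ {suc k} zero f = begin
    f zero + 0 + ∑ (tabulate Fin.suc) (λ h → δ zero h * f h)  ≡⟨ cong (f zero + 0 +_) (∑-tabulate {n = k} Fin.suc _) ⟩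
    f zero + 0 + ∑ (allFin k) (λ _ → 0)                       ≡⟨ cong (f zero + 0 +_) (∑-const (allFin k) 0) ⟩
    f zero + 0 + length (allFin k) * 0                        ≡⟨ cong₂ _+_ (+-identityʳ (f zero)) (*-zeroʳ (length (allFin k))) ⟩
    f zero + 0                                                ≡⟨ +-identityʳ (f zero) ⟩
    f zero                                                    ∎
    where open ≡-Reasoning
  ∑-δ {suc k} (suc a) f = trans (∑-tabulate {n = k} Fin.suc (λ h → δ (suc a) h * f h)) (∑-δ a (f ∘ suc))

  configuration≡∑ : ∀ {n k} (χ : Coloring n k) j → configuration χ j ≡ ∑ (allFin n) (λ v → δ (χ v) j)
  configuration≡∑ {n} χ j = length-filter (λ v → χ v Fin.≟ j) (allFin n)

  -- Double counting of the pairs (h, v) with χ v = h, each of weight f h.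
  ∑-configuration : ∀ {n k} (χ : Coloring n k) (f : Fin k → ℕ) →
    ∑ (allFin k) (λ h → configuration χ h * f h) ≡ ∑ (allFin n) (f ∘ χ)
  ∑-configuration {n} {k} χ f = begin
    ∑ (allFin k) (λ h → configuration χ h * f h)
      ≡⟨ ∑-cong (allFin k) (λ h → trans (cong (_* f h) (configuration≡∑ χ h)) (sym (∑-*ʳ (allFin n) (f h) _))) ⟩
    ∑ (allFin k) (λ h → ∑ (allFin n) (λ v → δ (χ v) h * f h)) ≡⟨ ∑-swap (allFin k) (allFin n) _ ⟩
    ∑ (allFin n) (λ v → ∑ (allFin k) (λ h → δ (χ v) h * f h)) ≡⟨ ∑-cong (allFin n) (λ v → ∑-δ (χ v) f) ⟩
    ∑ (allFin n) (f ∘ χ) ∎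
    where open ≡-Reasoning

  -- The majority rule is "the third pick decides if it agrees with the second, otherwise the first one does".
  majority-δ : ∀ {k} (a b c j : Fin k) → δ (majority a b c) j + δ b c * δ a j ≡ δ b c * δ b j + δ a j
  majority-δ a b c j with b Fin.≟ c
  majority-δ a b c j | yes refl with a Fin.≟ b
  ... | yes refl = trans (cong (δ a j +_) (+-identityʳ _)) (cong (_+ δ a j) (sym (+-identityʳ _)))
  ... | no _ = cong₂ _+_ (sym (+-identityʳ (δ b j))) (+-identityʳ (δ a j))
  majority-δ a b c j | no _ with a Fin.≟ b | a Fin.≟ c
  ... | yes _ | _     = +-identityʳ _
  ... | no _  | yes _ = +-identityʳ _
  ... | no _  | no _  = +-identityʳ _

  Triple : ℕ → Set
  Triple n = Fin n × Fin n × Fin n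

  triples : ∀ n → List (Triple n)
  triples n = cartesianProduct (allFin n) (cartesianProduct (allFin n) (allFin n))

  ∑-triples : ∀ n f → ∑ (triples n) f ≡ ∑ (allFin n) (λ u → ∑ (allFin n) (λ v → ∑ (allFin n) (λ w → f (u , v , w))))
  ∑-triples n f = trans (∑-cartesianProductWith _,_ (allFin n) _ f)
    (∑-cong (allFin n) (λ u → ∑-cartesianProductWith _,_ (allFin n) (allFin n) (λ t → f (u , t))))

  length-triples : ∀ n → length (triples n) ≡ n * (n * n)
  length-triples n = trans (length-cartesianProductWith _,_ (allFin n) _)
    (cong₂ _*_ (length-allFin n) (trans (length-cartesianProductWith _,_ (allFin n) (allFin n)) (cong₂ _*_ (length-allFin n) (length-allFin n))))

  votes : ∀ {n k} → Coloring n k → Fin k → Triple n → Bool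
  votes χ j (u , v , w) = does (majority (χ u) (χ v) (χ w) Fin.≟ j)

  configuration-step : ∀ {n k} (χ : Coloring n k) r j → configuration (step r χ) j ≡ ∑ᵛ (𝟙 ∘ votes χ j) r
  configuration-step χ r j = trans (configuration≡∑ (step r χ) j) (∑-lookup (𝟙 ∘ votes χ j) r)

  ∑-fin-const : ∀ n a → ∑ (allFin n) (λ _ → a) ≡ n * a
  ∑-fin-const n a = trans (∑-const (allFin n) a) (cong (_* a) (length-allFin n))

  -- Summed over all triples, the four terms of `majority-δ` factor over the three independent
  -- picks. Dividing by n² gives the expected next count of colour j, namely c (1 + c / n - Σ c² /
  -- n²) with c = c_j.
  ∑-votes : ∀ {n k} (χ : Coloring n k) j → let c = configuration χ in
    ∑ (triples n) (𝟙 ∘ votes χ j) + c j * ∑ (allFin k) (λ h → c h * c h) ≡ n * (c j * c j) + c j * (n * n)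
  ∑-votes {n} {k} χ j = begin
    ∑ (triples n) f₁ + c j * S                 ≡⟨ cong (∑ (triples n) f₁ +_) t₂ ⟨
    ∑ (triples n) f₁ + ∑ (triples n) f₂        ≡⟨ ∑-+ (triples n) f₁ f₂ ⟨
    ∑ (triples n) (λ t → f₁ t + f₂ t)          ≡⟨ ∑-cong (triples n) (λ (u , v , w) → majority-δ (χ u) (χ v) (χ w) j) ⟩
    ∑ (triples n) (λ t → f₃ t + f₄ t)          ≡⟨ ∑-+ (triples n) f₃ f₄ ⟩
    ∑ (triples n) f₃ + ∑ (triples n) f₄        ≡⟨ cong₂ _+_ t₃ t₄ ⟩
    n * (c j * c j) + c j * (n * n)            ∎
    where
    open ≡-Reasoning
    c = configuration χ
    S = ∑ (allFin k) (λ h → c h * c h)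
    f₁ f₂ f₃ f₄ : Triple n → ℕ
    f₁ = 𝟙 ∘ votes χ j
    f₂ (u , v , w) = δ (χ v) (χ w) * δ (χ u) j
    f₃ (u , v , w) = δ (χ v) (χ w) * δ (χ v) j
    f₄ (u , v , w) = δ (χ u) j
    δ-sym : ∀ {k} (a b : Fin k) → δ a b ≡ δ b a
    δ-sym a b with a Fin.≟ b | b Fin.≟ a
    ... | yes _ | yes _ = refl
    ... | no _  | no _  = refl
    ... | yes p | no ¬q = contradiction (sym p) ¬q
    ... | no ¬p | yes q = contradiction (sym q) ¬p
    row : ∀ v → ∑ (allFin n) (λ w → δ (χ v) (χ w)) ≡ c (χ v)
    row v = trans (∑-cong (allFin n) (λ w → δ-sym (χ v) (χ w))) (sym (configuration≡∑ χ (χ v)))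
    t₂ : ∑ (triples n) f₂ ≡ c j * S
    t₂ = begin
      ∑ (triples n) f₂ ≡⟨ ∑-triples n f₂ ⟩
      ∑ (allFin n) (λ u → ∑ (allFin n) (λ v → ∑ (allFin n) (λ w → δ (χ v) (χ w) * δ (χ u) j)))
        ≡⟨ ∑-cong (allFin n) (λ u → ∑-cong (allFin n) (λ v → trans (∑-*ʳ (allFin n) (δ (χ u) j) _) (cong (_* δ (χ u) j) (row v)))) ⟩
      ∑ (allFin n) (λ u → ∑ (allFin n) (λ v → c (χ v) * δ (χ u) j))
        ≡⟨ ∑-cong (allFin n) (λ u → ∑-*ʳ (allFin n) (δ (χ u) j) (c ∘ χ)) ⟩
      ∑ (allFin n) (λ u → ∑ (allFin n) (c ∘ χ) * δ (χ u) j) ≡⟨ ∑-*ˡ (allFin n) (∑ (allFin n) (c ∘ χ)) (λ u → δ (χ u) j) ⟩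
      ∑ (allFin n) (c ∘ χ) * ∑ (allFin n) (λ u → δ (χ u) j)
        ≡⟨ cong₂ _*_ (sym (∑-configuration χ c)) (sym (configuration≡∑ χ j)) ⟩
      S * c j ≡⟨ *-comm S (c j) ⟩
      c j * S ∎
    t₃ : ∑ (triples n) f₃ ≡ n * (c j * c j)
    t₃ = begin
      ∑ (triples n) f₃ ≡⟨ ∑-triples n f₃ ⟩
      ∑ (allFin n) (λ u → ∑ (allFin n) (λ v → ∑ (allFin n) (λ w → δ (χ v) (χ w) * δ (χ v) j)))
        ≡⟨ ∑-fin-const n _ ⟩
      n * ∑ (allFin n) (λ v → ∑ (allFin n) (λ w → δ (χ v) (χ w) * δ (χ v) j))
        ≡⟨ cong (n *_) (∑-cong (allFin n) (λ v → trans (∑-*ʳ (allFin n) (δ (χ v) j) _) (trans (cong (_* δ (χ v) j) (row v)) (*-comm _ (δ (χ v) j))))) ⟩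
      n * ∑ (allFin n) (λ v → δ (χ v) j * c (χ v)) ≡⟨ cong (n *_) (∑-configuration χ (λ h → δ h j * c h)) ⟨
      n * ∑ (allFin k) (λ h → c h * (δ h j * c h))
        ≡⟨ cong (n *_) (∑-cong (allFin k) (λ h → trans (e (c h) (δ h j)) (cong (_* (c h * c h)) (δ-sym h j)))) ⟩
      n * ∑ (allFin k) (λ h → δ j h * (c h * c h)) ≡⟨ cong (n *_) (∑-δ j (λ h → c h * c h)) ⟩
      n * (c j * c j) ∎
      where
      e : ∀ c d → c * (d * c) ≡ d * (c * c)
      e = solve-∀
    t₄ : ∑ (triples n) f₄ ≡ c j * (n * n)
    t₄ = begin
      ∑ (triples n) f₄ ≡⟨ ∑-triples n f₄ ⟩
      ∑ (allFin n) (λ u → ∑ (allFin n) (λ v → ∑ (allFin n) (λ w → δ (χ u) j)))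
        ≡⟨ ∑-cong (allFin n) (λ u → trans (∑-fin-const n _) (trans (cong (n *_) (∑-fin-const n _)) (sym (*-assoc n n _)))) ⟩
      ∑ (allFin n) (λ u → n * n * δ (χ u) j) ≡⟨ ∑-*ˡ (allFin n) (n * n) (λ u → δ (χ u) j) ⟩
      n * n * ∑ (allFin n) (λ u → δ (χ u) j) ≡⟨ cong (n * n *_) (configuration≡∑ χ j) ⟨
      n * n * c j ≡⟨ *-comm (n * n) (c j) ⟩
      c j * (n * n) ∎

  ∑-configuration-1 : ∀ {n k} (χ : Coloring n k) → ∑ (allFin k) (configuration χ) ≡ n
  ∑-configuration-1 {n} {k} χ = begin
    ∑ (allFin k) (configuration χ)                ≡⟨ ∑-cong (allFin k) (λ h → sym (*-identityʳ _)) ⟩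
    ∑ (allFin k) (λ h → configuration χ h * 1)    ≡⟨ ∑-configuration χ (λ _ → 1) ⟩
    ∑ (allFin n) (λ _ → 1)                        ≡⟨ ∑-fin-const n 1 ⟩
    n * 1                                         ≡⟨ *-identityʳ n ⟩
    n ∎
    where open ≡-Reasoning

  -- The expected next count is c (n² + n c - Σ c²) / n², and n c - Σ c² ≤ n (c - n / k) by Cauchy-Schwarz.
  ∑-votes-≤ : ∀ {n k} .{{_ : NonZero k}} (χ : Coloring n k) j h Δ d →
    configuration χ j ≤ h + Δ → k * h ≤ n → Δ ≤ h → Δ ≤ k * suc d →
    ∑ (triples n) (𝟙 ∘ votes χ j) ≤ (h + Δ + 2 * suc d) * (n * n)
  ∑-votes-≤ {n} {k} χ j h Δ d c≤ kh≤n Δ≤h Δ≤ = begin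
    N                               ≤⟨ N≤ ⟩
    c * (n * (n + Δ))               ≤⟨ *-monoˡ-≤ (n * (n + Δ)) c≤ ⟩
    (h + Δ) * (n * (n + Δ))         ≡⟨ e₁ h Δ n ⟩
    ((h + Δ) * n + (h + Δ) * Δ) * n ≤⟨ *-monoˡ-≤ n (+-monoʳ-≤ ((h + Δ) * n) quad) ⟩
    ((h + Δ) * n + 2 * (n * suc d)) * n ≡⟨ e₂ h Δ n (suc d) ⟩
    (h + Δ + 2 * suc d) * (n * n)   ∎
    where
    open ≤-Reasoning
    c = configuration χ j
    N = ∑ (triples n) (𝟙 ∘ votes χ j)
    S = ∑ (allFin k) (λ h → configuration χ h * configuration χ h)
    cs : n * n ≤ k * S
    cs = begin
      n * n ≡⟨ cong₂ _*_ (∑-configuration-1 χ) (∑-configuration-1 χ) ⟨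
      ∑ (allFin k) (configuration χ) * ∑ (allFin k) (configuration χ) ≤⟨ cauchySchwarz (allFin k) (configuration χ) ⟩
      length (allFin k) * S ≡⟨ cong (_* S) (length-allFin k) ⟩
      k * S ∎
    N≤ : N ≤ c * (n * (n + Δ))
    N≤ = *-cancelˡ-≤ k (+-cancelʳ-≤ (c * (n * n)) _ _ (begin
      k * N + c * (n * n)               ≤⟨ +-monoʳ-≤ (k * N) (*-monoʳ-≤ c cs) ⟩
      k * N + c * (k * S)               ≡⟨ e₃ k N c S ⟩
      k * (N + c * S)                   ≡⟨ cong (k *_) (∑-votes χ j) ⟩
      k * (n * (c * c) + c * (n * n))   ≡⟨ e₄ k n c ⟩
      c * (n * (k * c + k * n))         ≤⟨ *-monoʳ-≤ c (*-monoʳ-≤ n (+-monoˡ-≤ (k * n) kc)) ⟩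
      c * (n * (n + k * Δ + k * n))     ≡⟨ e₅ c n k Δ ⟩
      k * (c * (n * (n + Δ))) + c * (n * n) ∎))
      where
      kc : k * c ≤ n + k * Δ
      kc = begin
        k * c         ≤⟨ *-monoʳ-≤ k c≤ ⟩
        k * (h + Δ)   ≡⟨ *-distribˡ-+ k h Δ ⟩
        k * h + k * Δ ≤⟨ +-monoˡ-≤ (k * Δ) kh≤n ⟩
        n + k * Δ     ∎
      e₃ : ∀ k N c S → k * N + c * (k * S) ≡ k * (N + c * S)
      e₃ = solve-∀
      e₄ : ∀ k n c → k * (n * (c * c) + c * (n * n)) ≡ c * (n * (k * c + k * n))
      e₄ = solve-∀
      e₅ : ∀ c n k D → c * (n * (n + k * D + k * n)) ≡ k * (c * (n * (n + D))) + c * (n * n)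
      e₅ = solve-∀
    -- After division by n this bounds the drift (h + Δ) Δ / n by 2 (d + 1), the two units that
    -- `next` reserves for it.
    quad : (h + Δ) * Δ ≤ 2 * (n * suc d)
    quad = begin
      (h + Δ) * Δ         ≤⟨ *-mono-≤ (+-monoʳ-≤ h Δ≤h) Δ≤ ⟩
      (h + h) * (k * suc d) ≡⟨ e₆ h k (suc d) ⟩
      2 * (k * h * suc d) ≤⟨ *-monoʳ-≤ 2 (*-monoˡ-≤ (suc d) kh≤n) ⟩
      2 * (n * suc d)     ∎
      where
      e₆ : ∀ h k d → (h + h) * (k * d) ≡ 2 * (k * h * d)
      e₆ = solve-∀
    e₁ : ∀ h D n → (h + D) * (n * (n + D)) ≡ ((h + D) * n + (h + D) * D) * n
    e₁ = solve-∀
    e₂ : ∀ h D n d → ((h + D) * n + 2 * (n * d)) * n ≡ (h + D + 2 * d) * (n * n)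
    e₂ = solve-∀

  ≤-maxCount : ∀ {k} (c : Fin k → ℕ) j → c j ≤ maxCount c
  ≤-maxCount c zero    = m≤m⊔n _ _
  ≤-maxCount c (suc j) = ≤-trans (≤-maxCount (c ∘ suc) j) (m≤n⊔m (c zero) _)

  ≤ᵇ-true : ∀ {a b} → a ≤ b → 𝟙 (a ≤ᵇ b) ≡ 1
  ≤ᵇ-true {a} {b} le with a ≤ᵇ b | ≤⇒≤ᵇ le
  ... | true | _ = refl

  -- Union bound: a maximum above θ is attained by one of the colours.
  maxCount-union : ∀ {k} (c : Fin k → ℕ) θ →
    𝟙 (not (maxCount c ≤ᵇ θ)) ≤ ∑ (allFin k) (λ j → 𝟙 (suc θ ≤ᵇ c j))
  maxCount-union c θ with maxCount c ≤ᵇ θ in eq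
  ... | true  = z≤n
  ... | false = go c (≰⇒> (λ le → subst Data.Bool.T eq (≤⇒≤ᵇ le)))
    where
    go : ∀ {k} (c : Fin k → ℕ) → θ < maxCount c → 1 ≤ ∑ (allFin k) (λ j → 𝟙 (suc θ ≤ᵇ c j))
    go {suc k} c lt with ⊔-sel (c zero) (maxCount (c ∘ suc))
    ... | inj₁ e = ≤-trans (≤-reflexive (sym (≤ᵇ-true (≤-trans lt (≤-reflexive e))))) (m≤m+n _ _)
    ... | inj₂ e = ≤-trans (≤-trans (go (c ∘ suc) (≤-trans lt (≤-reflexive e)))
                     (≤-reflexive (sym (∑-tabulate {n = k} Fin.suc (λ j → 𝟙 (suc θ ≤ᵇ c j))))))
                     (m≤n+m _ (𝟙 (suc θ ≤ᵇ c zero)))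

  ∑-bound : ∀ {A : Set} (xs : List A) f a → (∀ x → f x ≤ a) → ∑ xs f ≤ length xs * a
  ∑-bound xs f a le = ≤-trans (∑-mono xs le) (≤-reflexive (∑-const xs a))

  𝟙-≤ᵇ-mono : ∀ {a b} c → a ≤ b → 𝟙 (b ≤ᵇ c) ≤ 𝟙 (a ≤ᵇ c)
  𝟙-≤ᵇ-mono {a} {b} c a≤b with b ≤ᵇ c in eq
  ... | false = z≤n
  ... | true  = ≤-reflexive (sym (≤ᵇ-true (≤-trans a≤b (≤ᵇ⇒≤ b c (subst Data.Bool.T (sym eq) _)))))

  -- Many rounds

  -- The hypothesis `noise` is the variance condition b ≤ 4 m² L of `chernoff`: the mean bound b is
  -- at most 3 h as long as the excess is at most h / 4.
  module Rounds
    (n k h m L : ℕ) .{{nz-n : NonZero n}} .{{nz-k : NonZero k}} .{{nz-m : NonZero m}} .{{nz-L : NonZero L}}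
    (kh≤n : k * h ≤ n) (2≤h : 2 ≤ h) (noise : 3 * h ≤ 4 * (m * m) * L)
    where

    P : ℕ
    P = length (allPicks n)

    -- Two units of Δ / k cover the drift, the others rounding and the random fluctuation.
    next : ℕ → ℕ
    next Δ = Δ + 4 * (Δ / k)

    -- The thresholds h + Δ, h + `next` Δ, ... do not depend on the picks, so survival is a Boolean
    -- test on the first T rounds.
    good : Coloring n k → ℕ → ∀ {T} → Vec (Picks n) T → Bool
    good χ Δ []       = true
    good χ Δ (r ∷ rs) = (maxCount (configuration (step r χ)) ≤ᵇ h + next Δ) ∧ good (step r χ) (next Δ) rs

    -- `lower` keeps Δ / k above the least deviation that `chernoff` covers. `upper` says that T
    -- further growths by 1 + 4/k still leave the excess at most h / 4.
    record Admissible (χ : Coloring n k) (Δ T : ℕ) : Set where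
      field
        colours : ∀ j → configuration χ j ≤ h + Δ
        lower   : 6 * (m * L) * k ≤ Δ
        upper   : 4 * Δ * (k + 4) ^ T ≤ h * k ^ T

      4Δ≤h : 4 * Δ ≤ h
      4Δ≤h = *-cancelʳ-≤ _ _ (k ^ T) {{m^n≢0 k T}}
               (≤-trans (*-monoʳ-≤ (4 * Δ) (^-monoˡ-≤ T (m≤m+n k 4))) upper)

      Δ≤h : Δ ≤ h
      Δ≤h = ≤-trans (m≤n*m Δ 4) 4Δ≤h

    -- One round spends one factor (k + 4) / k of the reserve in `upper`, since k times `next` Δ is
    -- at most (k + 4) Δ.
    admissible-next : ∀ {χ Δ T} r → Admissible χ Δ (suc T) →
      maxCount (configuration (step r χ)) ≤ h + next Δ → Admissible (step r χ) (next Δ) T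
    admissible-next {χ} {Δ} {T} r adm le = record
      { colours = λ j → ≤-trans (≤-maxCount _ j) le
      ; lower   = ≤-trans (Admissible.lower adm) (m≤m+n Δ _)
      ; upper   = *-cancelˡ-≤ k (begin
          k * (4 * next Δ * (k + 4) ^ T)      ≡⟨ e₁ k (next Δ) ((k + 4) ^ T) ⟩
          4 * (k * next Δ) * (k + 4) ^ T      ≤⟨ *-monoˡ-≤ ((k + 4) ^ T) (*-monoʳ-≤ 4 grow) ⟩
          4 * ((k + 4) * Δ) * (k + 4) ^ T     ≡⟨ e₂ (k + 4) Δ ((k + 4) ^ T) ⟩
          4 * Δ * (k + 4) ^ suc T             ≤⟨ Admissible.upper adm ⟩
          h * k ^ suc T                       ≡⟨ e₃ h k (k ^ T) ⟩
          k * (h * k ^ T)                     ∎)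
      }
      where
      open ≤-Reasoning
      e₁ : ∀ k D X → k * (4 * D * X) ≡ 4 * (k * D) * X
      e₁ = solve-∀
      e₂ : ∀ a D X → 4 * (a * D) * X ≡ 4 * D * (a * X)
      e₂ = solve-∀
      e₃ : ∀ h k X → h * (k * X) ≡ k * (h * X)
      e₃ = solve-∀
      e₄ : ∀ k D d → k * (D + 4 * d) ≡ k * D + 4 * (d * k)
      e₄ = solve-∀
      grow : k * next Δ ≤ (k + 4) * Δ
      grow = begin
        k * (Δ + 4 * (Δ / k))       ≡⟨ e₄ k Δ (Δ / k) ⟩
        k * Δ + 4 * (Δ / k * k)     ≤⟨ +-monoʳ-≤ (k * Δ) (*-monoʳ-≤ 4 (m/n*n≤m Δ k)) ⟩
        k * Δ + 4 * Δ               ≡⟨ *-distribʳ-+ Δ k 4 ⟨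
        (k + 4) * Δ                 ∎

    ∑-oneRound : ∀ {χ Δ T} → Admissible χ Δ T →
      ∑ (allPicks n) (λ r → 𝟙 (not (maxCount (configuration (step r χ)) ≤ᵇ h + next Δ))) * 2 ^ L ≤ k * P
    ∑-oneRound {χ} {Δ} adm = begin
      ∑ Ω (λ r → 𝟙 (not (maxCount (configuration (step r χ)) ≤ᵇ θ))) * 2 ^ L
        ≤⟨ *-monoˡ-≤ (2 ^ L) (∑-mono Ω (λ r → maxCount-union (configuration (step r χ)) θ)) ⟩
      ∑ Ω (λ r → ∑ (allFin k) (λ j → 𝟙 (suc θ ≤ᵇ configuration (step r χ) j))) * 2 ^ L
        ≡⟨ cong (_* 2 ^ L) (∑-swap Ω (allFin k) _) ⟩
      ∑ (allFin k) (λ j → ∑ Ω (λ r → 𝟙 (suc θ ≤ᵇ configuration (step r χ) j))) * 2 ^ L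
        ≡⟨ ∑-*ʳ (allFin k) (2 ^ L) _ ⟨
      ∑ (allFin k) (λ j → ∑ Ω (λ r → 𝟙 (suc θ ≤ᵇ configuration (step r χ) j)) * 2 ^ L)
        ≤⟨ ∑-bound (allFin k) _ P colour ⟩
      length (allFin k) * P ≡⟨ cong (_* P) (length-allFin k) ⟩
      k * P ∎
      where
      open ≤-Reasoning
      open Admissible adm
      Ω = allPicks n
      θ = h + next Δ
      d = Δ / k
      b = h + Δ + 2 * suc d
      d≥ : 6 * (m * L) ≤ d
      d≥ = ≤-trans (≤-reflexive (sym (m*n/n≡m (6 * (m * L)) k))) (/-monoˡ-≤ k lower)
      1≤d : 1 ≤ d
      1≤d = ≤-trans (≤-trans (>-nonZero⁻¹ (m * L) {{m*n≢0 m L}}) (m≤n*m (m * L) 6)) d≥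
      Δ≤ : Δ ≤ k * suc d
      Δ≤ = begin
        Δ                 ≡⟨ m≡m%n+[m/n]*n Δ k ⟩
        Δ % k + d * k     ≤⟨ +-monoˡ-≤ (d * k) (<⇒≤ (m%n<n Δ k)) ⟩
        k + d * k         ≡⟨ *-comm (suc d) k ⟩
        k * suc d         ∎
      b≤ : b ≤ 4 * (m * m) * L
      b≤ = ≤-trans (begin
        h + Δ + 2 * suc d       ≤⟨ +-monoʳ-≤ (h + Δ) (*-monoʳ-≤ 2 (s≤s (m/n≤m Δ k))) ⟩
        h + Δ + 2 * suc Δ       ≡⟨ e₁ h Δ ⟩
        h + 3 * Δ + 2           ≤⟨ +-mono-≤ (+-monoʳ-≤ h (≤-trans (m≤n+m (3 * Δ) Δ) 4Δ≤h)) 2≤h ⟩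
        h + h + h               ≡⟨ e₂ h ⟩
        3 * h                   ∎) noise
        where
        e₁ : ∀ h D → h + D + 2 * suc D ≡ h + 3 * D + 2
        e₁ = solve-∀
        e₂ : ∀ h → h + h + h ≡ 3 * h
        e₂ = solve-∀
      -- b + d is h + Δ + 3 d + 2. Of the final 2, the successor of θ pays one unit, and the fourth
      -- d of `next`, which is at least 1, the other.
      b+d≤ : b + d ≤ suc θ
      b+d≤ = begin
        h + Δ + 2 * suc d + d       ≡⟨ e₁ h Δ d ⟩
        1 + (h + (Δ + 3 * d) + 1)   ≤⟨ +-monoʳ-≤ 1 (+-monoʳ-≤ (h + (Δ + 3 * d)) 1≤d) ⟩
        1 + (h + (Δ + 3 * d) + d)   ≡⟨ e₂ h Δ d ⟩
        suc (h + (Δ + 4 * d))       ∎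
        where
        e₁ : ∀ h D d → h + D + 2 * suc d + d ≡ 1 + (h + (D + 3 * d) + 1)
        e₁ = solve-∀
        e₂ : ∀ h D d → 1 + (h + (D + 3 * d) + d) ≡ suc (h + (D + 4 * d))
        e₂ = solve-∀
      colour : ∀ j → ∑ Ω (λ r → 𝟙 (suc θ ≤ᵇ configuration (step r χ) j)) * 2 ^ L ≤ P
      colour j = begin
        ∑ Ω (λ r → 𝟙 (suc θ ≤ᵇ configuration (step r χ) j)) * 2 ^ L
          ≡⟨ cong (_* 2 ^ L) (∑-cong Ω (λ r → cong (λ z → 𝟙 (suc θ ≤ᵇ z)) (configuration-step χ r j))) ⟩
        ∑ Ω (λ r → 𝟙 (suc θ ≤ᵇ ∑ᵛ (𝟙 ∘ votes χ j) r)) * 2 ^ L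
          ≤⟨ *-monoˡ-≤ (2 ^ L) (∑-mono Ω (λ r → 𝟙-≤ᵇ-mono (∑ᵛ (𝟙 ∘ votes χ j) r) b+d≤)) ⟩
        ∑ Ω (λ r → 𝟙 (b + d ≤ᵇ ∑ᵛ (𝟙 ∘ votes χ j) r)) * 2 ^ L
          ≤⟨ chernoff m L n b d (votes χ j) (triples n) (length-triples n)
               (∑-votes-≤ χ j h Δ d (colours j) kh≤n Δ≤h Δ≤) b≤ d≥ ⟩
        length (triples n) ^ n ≡⟨ length-vectors (triples n) n ⟨
        P ∎

    -- Split on the first round. A bad one, of weight k / 2^L in all, is charged with all P^T
    -- continuations; after any other, `admissible-next` makes the induction hypothesis applicable
    -- to the rest.
    ∑-bad : ∀ T {χ Δ} → Admissible χ Δ T →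
      ∑ (vectors (allPicks n) T) (𝟙 ∘ not ∘ good χ Δ) * 2 ^ L ≤ T * k * P ^ T
    ∑-bad zero    adm = z≤n
    ∑-bad (suc T) {χ} {Δ} adm = begin
      ∑ (vectors Ω (suc T)) (𝟙 ∘ not ∘ good χ Δ) * 2 ^ L
        ≡⟨ cong (_* 2 ^ L) (∑-cartesianProductWith _∷_ Ω (vectors Ω T) _) ⟩
      ∑ Ω (λ r → ∑ (vectors Ω T) (λ rs → 𝟙 (not (good χ Δ (r ∷ rs))))) * 2 ^ L
        ≡⟨ ∑-*ʳ Ω (2 ^ L) _ ⟨
      ∑ Ω (λ r → ∑ (vectors Ω T) (λ rs → 𝟙 (not (good χ Δ (r ∷ rs)))) * 2 ^ L)
        ≤⟨ ∑-mono Ω first ⟩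
      ∑ Ω (λ r → bad r * (2 ^ L * P ^ T) + T * k * P ^ T)
        ≡⟨ ∑-+ Ω _ _ ⟩
      ∑ Ω (λ r → bad r * (2 ^ L * P ^ T)) + ∑ Ω (λ _ → T * k * P ^ T)
        ≡⟨ cong₂ _+_ (∑-*ʳ Ω (2 ^ L * P ^ T) bad) (∑-const Ω _) ⟩
      ∑ Ω bad * (2 ^ L * P ^ T) + P * (T * k * P ^ T)
        ≡⟨ cong (_+ P * (T * k * P ^ T)) (*-assoc (∑ Ω bad) (2 ^ L) (P ^ T)) ⟨
      ∑ Ω bad * 2 ^ L * P ^ T + P * (T * k * P ^ T)
        ≤⟨ +-monoˡ-≤ _ (*-monoˡ-≤ (P ^ T) (∑-oneRound adm)) ⟩
      k * P * P ^ T + P * (T * k * P ^ T)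
        ≡⟨ e k P (P ^ T) T ⟩
      suc T * k * P ^ suc T ∎
      where
      open ≤-Reasoning
      Ω = allPicks n
      ok = λ r → maxCount (configuration (step r χ)) ≤ᵇ h + next Δ
      bad = λ r → 𝟙 (not (ok r))
      e : ∀ k P X T → k * P * X + P * (T * k * X) ≡ (k + T * k) * (P * X)
      e = solve-∀
      𝟙≤1 : ∀ x → 𝟙 x ≤ 1
      𝟙≤1 true  = ≤-refl
      𝟙≤1 false = z≤n
      first : ∀ r → ∑ (vectors Ω T) (λ rs → 𝟙 (not (good χ Δ (r ∷ rs)))) * 2 ^ L ≤ bad r * (2 ^ L * P ^ T) + T * k * P ^ T
      first r with maxCount (configuration (step r χ)) ≤ᵇ h + next Δ in eq
      ... | true  = ∑-bad T (admissible-next r adm (≤ᵇ⇒≤ _ (h + next Δ) (subst Data.Bool.T (sym eq) _)))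
      ... | false = begin
        ∑ (vectors Ω T) (λ rs → 1) * 2 ^ L      ≡⟨ cong (_* 2 ^ L) (length≡∑1 (vectors Ω T)) ⟨
        length (vectors Ω T) * 2 ^ L            ≡⟨ cong (_* 2 ^ L) (length-vectors Ω T) ⟩
        P ^ T * 2 ^ L                           ≡⟨ *-comm (P ^ T) _ ⟩
        2 ^ L * P ^ T                           ≡⟨ +-identityʳ _ ⟨
        1 * (2 ^ L * P ^ T)                     ≤⟨ m≤m+n _ _ ⟩
        1 * (2 ^ L * P ^ T) + T * k * P ^ T     ∎

    -- `run` peels off the last round, `good` the first one; this reconciles them.
    run-suc : (χ : Coloring n k) (ω : Outcome n) → ∀ t → run χ ω (suc t) ≡ run (step (ω 0) χ) (ω ∘ suc) t
    run-suc χ ω zero    = refl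
    run-suc χ ω (suc t) = cong (step (ω (suc t))) (run-suc χ ω t)

    -- Every threshold passed on the way is at most h + h / 4, because `upper` gives 4 Δ ≤ h at each
    -- stage.
    good-sound : ∀ T {χ Δ} → Admissible χ Δ T → ∀ ω → good χ Δ (firstRounds T ω) ≡ true →
      ∀ t → t ≤ T → ∀ j → 4 * configuration (run χ ω t) j ≤ 5 * h
    good-sound T {χ} {Δ} adm ω g zero t≤ j = begin
      4 * configuration χ j  ≤⟨ *-monoʳ-≤ 4 (Admissible.colours adm j) ⟩
      4 * (h + Δ)            ≡⟨ *-distribˡ-+ 4 h Δ ⟩
      4 * h + 4 * Δ          ≤⟨ +-monoʳ-≤ (4 * h) (Admissible.4Δ≤h adm) ⟩
      4 * h + h              ≡⟨ e h ⟩
      5 * h                  ∎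
      where
      open ≤-Reasoning
      e : ∀ h → 4 * h + h ≡ 5 * h
      e = solve-∀
    good-sound (suc T) {χ} {Δ} adm ω g (suc t) (s≤s t≤T) j
      with maxCount (configuration (step (ω 0) χ)) ≤ᵇ h + next Δ in eq
    ... | true = subst (λ ψ → 4 * configuration ψ j ≤ 5 * h) (sym (run-suc χ ω t))
      (good-sound T (admissible-next (ω 0) adm (≤ᵇ⇒≤ _ (h + next Δ) (subst Data.Bool.T (sym eq) _))) (ω ∘ suc) g t t≤T j)

  -- Choice of the constants

  n<m[1+n/m] : ∀ n m .{{_ : NonZero m}} → n < m * suc (n / m)
  n<m[1+n/m] n m = begin-strict
    n                       ≡⟨ m≡m%n+[m/n]*n n m ⟩
    n % m + n / m * m       <⟨ +-monoˡ-< (n / m * m) (m%n<n n m) ⟩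
    m + n / m * m           ≡⟨ *-comm (suc (n / m)) m ⟩
    m * suc (n / m)         ∎
    where open ≤-Reasoning

  ≤-/ : ∀ a m {n} .{{_ : NonZero m}} → a * m ≤ n → a ≤ n / m
  ≤-/ a m le = ≤-trans (≤-reflexive (sym (m*n/n≡m a m))) (/-monoˡ-≤ m le)

  -- A discrete logarithm of n / k to base B / A, rounded up: the search goes downwards and stops at
  -- the last b that works, so the overshoot is at most one factor B / A. It starts at A n, where (B
  -- / A)^(A n) ≥ (1 + 1/A)^(A n) ≥ n by Bernoulli.
  bracket : ∀ A n k .{{_ : NonZero A}} .{{_ : NonZero k}} B → A < B → k ≤ n →
    ∃[ b ] n * A ^ b ≤ k * B ^ b × k * B ^ b * A ≤ n * A ^ b * B
  bracket A n k B A<B k≤n = least (A * n) (begin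
    n * A ^ (A * n)       ≤⟨ *-cancelˡ-≤ A scaled ⟩
    B ^ (A * n)           ≤⟨ m≤n*m _ k ⟩
    k * B ^ (A * n)       ∎)
    where
    open ≤-Reasoning
    scaled : A * (n * A ^ (A * n)) ≤ A * B ^ (A * n)
    scaled = begin
      A * (n * A ^ (A * n))             ≡⟨ *-assoc A n _ ⟨
      A * n * A ^ (A * n)               ≤⟨ *-monoˡ-≤ (A ^ (A * n)) (m≤n+m (A * n) A) ⟩
      (A + A * n) * A ^ (A * n)         ≤⟨ bernoulli-up A (A * n) ⟩
      A * suc A ^ (A * n)               ≤⟨ *-monoʳ-≤ A (^-monoˡ-≤ (A * n) A<B) ⟩
      A * B ^ (A * n)                   ∎
    least : ∀ b → n * A ^ b ≤ k * B ^ b → ∃[ b ] n * A ^ b ≤ k * B ^ b × k * B ^ b * A ≤ n * A ^ b * B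
    least zero    le = 0 , le , *-mono-≤ (*-monoˡ-≤ 1 k≤n) (<⇒≤ A<B)
    least (suc b) le with n * A ^ b ≤? k * B ^ b
    ... | yes le′ = least b le′
    ... | no ¬le  = suc b , le , (begin
      k * (B * B ^ b) * A     ≡⟨ e₁ k B (B ^ b) A ⟩
      k * B ^ b * (B * A)     ≤⟨ *-monoˡ-≤ (B * A) (<⇒≤ (≰⇒> ¬le)) ⟩
      n * A ^ b * (B * A)     ≡⟨ e₂ n (A ^ b) B A ⟩
      n * (A * A ^ b) * B     ∎)
      where
      e₁ : ∀ k B X A → k * (B * X) * A ≡ k * X * (B * A)
      e₁ = solve-∀
      e₂ : ∀ n X B A → n * X * (B * A) ≡ n * (A * X) * B
      e₂ = solve-∀

  -- From (k + 4) k³ ≤ (k + 1)⁴ and (1 + 1/k)^k ≤ 4 one gets (1 + 4/k)^k ≤ 4⁴ = 2⁸ for each of the g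
  -- blocks of k rounds.
  growth : ∀ k .{{_ : NonZero k}} g → (k + 4) ^ (k * g) ≤ 2 ^ (8 * g) * k ^ (k * g)
  growth k g = begin
    (k + 4) ^ (k * g)               ≡⟨ ^-*-assoc (k + 4) k g ⟨
    ((k + 4) ^ k) ^ g               ≤⟨ ^-monoˡ-≤ g four ⟩
    (2 ^ 8 * k ^ k) ^ g             ≡⟨ ^-distribʳ-* (2 ^ 8) (k ^ k) g ⟩
    (2 ^ 8) ^ g * (k ^ k) ^ g       ≡⟨ cong₂ _*_ (^-*-assoc 2 8 g) (^-*-assoc k k g) ⟩
    2 ^ (8 * g) * k ^ (k * g)       ∎
    where
    open ≤-Reasoning
    k≤ : k ≤ suc k / 2 * 2
    k≤ = +-cancelˡ-≤ 1 _ _ (begin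
      suc k                         ≡⟨ m≡m%n+[m/n]*n (suc k) 2 ⟩
      suc k % 2 + suc k / 2 * 2     ≤⟨ +-monoˡ-≤ _ (≤-pred (m%n<n (suc k) 2)) ⟩
      1 + suc k / 2 * 2             ∎)
    one : suc k ^ k ≤ 2 ^ 2 * k ^ k
    one = halve-down k (suc k / 2) 2 (≤-trans (≤-reflexive (*-comm 2 (suc k / 2))) (m/n*n≤m (suc k) 2)) k≤
    four : (k + 4) ^ k ≤ 2 ^ 8 * k ^ k
    four = *-cancelʳ-≤ _ _ ((k ^ 3) ^ k) {{m^n≢0 (k ^ 3) k {{m^n≢0 k 3}}}} (begin
      (k + 4) ^ k * (k ^ 3) ^ k     ≡⟨ ^-distribʳ-* (k + 4) (k ^ 3) k ⟨
      ((k + 4) * k ^ 3) ^ k         ≤⟨ ^-monoˡ-≤ k (≤-trans (m≤m+n _ (6 * (k * k) + 4 * k + 1)) (≤-reflexive (e₁ k))) ⟩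
      (suc k ^ 4) ^ k               ≡⟨ ^-swap (suc k) 4 k ⟩
      (suc k ^ k) ^ 4               ≤⟨ ^-monoˡ-≤ 4 one ⟩
      (2 ^ 2 * k ^ k) ^ 4           ≡⟨ ^-distribʳ-* (2 ^ 2) (k ^ k) 4 ⟩
      2 ^ 8 * (k ^ k) ^ 4           ≡⟨ cong (2 ^ 8 *_) (^-swap k k 4) ⟩
      2 ^ 8 * (k ^ 4) ^ k           ≡⟨ cong (2 ^ 8 *_) (^-distribʳ-* k (k ^ 3) k) ⟩
      2 ^ 8 * (k ^ k * (k ^ 3) ^ k) ≡⟨ *-assoc (2 ^ 8) (k ^ k) _ ⟨
      2 ^ 8 * k ^ k * (k ^ 3) ^ k   ∎)
      where
      e₁ : ∀ k → (k + 4) * (k * (k * (k * 1))) + (6 * (k * k) + 4 * k + 1)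
               ≡ suc k * (suc k * (suc k * (suc k * 1)))
      e₁ = solve-∀

  -- The exponent 1/4 deteriorates to 3/10 only, because (10/9)^5 ≤ (11/10)^6.
  k^10≤8n³ : ∀ n k b → k * 9 ^ b ≤ 10 ^ b → 1 * (11 ^ 4) ^ b * 10 ^ 4 ≤ n * (10 ^ 4) ^ b * 11 ^ 4 → k ^ 10 ≤ 8 * n ^ 3
  k^10≤8n³ n k b k≤ n≥ = *-cancelʳ-≤ _ _ ((10 ^ 12) ^ b) {{m^n≢0 (10 ^ 12) b}} (begin
    k ^ 10 * (10 ^ 12) ^ b                 ≡⟨ cong₂ _*_ (sym (^-*-assoc k 5 2)) (square-base 10) ⟩
    (k ^ 5) ^ 2 * ((10 ^ 6) ^ b) ^ 2       ≡⟨ ^-distribʳ-* (k ^ 5) ((10 ^ 6) ^ b) 2 ⟨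
    (k ^ 5 * (10 ^ 6) ^ b) ^ 2             ≤⟨ ^-monoˡ-≤ 2 fifth ⟩
    ((11 ^ 6) ^ b) ^ 2                     ≡⟨ square-base 11 ⟨
    (11 ^ 12) ^ b                          ≡⟨ cube-base 11 ⟩
    ((11 ^ 4) ^ b) ^ 3                     ≤⟨ ^-monoˡ-≤ 3 base ⟩
    (2 * n * (10 ^ 4) ^ b) ^ 3             ≡⟨ ^-distribʳ-* (2 * n) ((10 ^ 4) ^ b) 3 ⟩
    (2 * n) ^ 3 * ((10 ^ 4) ^ b) ^ 3       ≡⟨ cong₂ _*_ (^-distribʳ-* 2 n 3) (sym (cube-base 10)) ⟩
    8 * n ^ 3 * (10 ^ 12) ^ b              ∎)
    where
    open ≤-Reasoning
    square-base : ∀ a → (a ^ 12) ^ b ≡ ((a ^ 6) ^ b) ^ 2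
    square-base a = trans (cong (_^ b) (sym (^-*-assoc a 6 2))) (^-swap (a ^ 6) 2 b)
    cube-base : ∀ a → (a ^ 12) ^ b ≡ ((a ^ 4) ^ b) ^ 3
    cube-base a = trans (cong (_^ b) (sym (^-*-assoc a 4 3))) (^-swap (a ^ 4) 3 b)
    fifth : k ^ 5 * (10 ^ 6) ^ b ≤ (11 ^ 6) ^ b
    fifth = *-cancelʳ-≤ _ _ ((9 ^ 5) ^ b) {{m^n≢0 (9 ^ 5) b}} (begin
      k ^ 5 * (10 ^ 6) ^ b * (9 ^ 5) ^ b     ≡⟨ e (k ^ 5) ((10 ^ 6) ^ b) ((9 ^ 5) ^ b) ⟩
      k ^ 5 * (9 ^ 5) ^ b * (10 ^ 6) ^ b     ≡⟨ cong (λ z → k ^ 5 * z * (10 ^ 6) ^ b) (^-swap 9 5 b) ⟩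
      k ^ 5 * (9 ^ b) ^ 5 * (10 ^ 6) ^ b     ≡⟨ cong (_* (10 ^ 6) ^ b) (^-distribʳ-* k (9 ^ b) 5) ⟨
      (k * 9 ^ b) ^ 5 * (10 ^ 6) ^ b         ≤⟨ *-monoˡ-≤ ((10 ^ 6) ^ b) (^-monoˡ-≤ 5 k≤) ⟩
      (10 ^ b) ^ 5 * (10 ^ 6) ^ b            ≡⟨ cong (_* (10 ^ 6) ^ b) (^-swap 10 b 5) ⟩
      (10 ^ 5) ^ b * (10 ^ 6) ^ b            ≡⟨ ^-distribʳ-* (10 ^ 5) (10 ^ 6) b ⟨
      (10 ^ 5 * 10 ^ 6) ^ b                  ≤⟨ ^-monoˡ-≤ b (≤ᵇ⇒≤ (10 ^ 5 * 10 ^ 6) (11 ^ 6 * 9 ^ 5) _) ⟩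
      (11 ^ 6 * 9 ^ 5) ^ b                   ≡⟨ ^-distribʳ-* (11 ^ 6) (9 ^ 5) b ⟩
      (11 ^ 6) ^ b * (9 ^ 5) ^ b             ∎)
      where
      e : ∀ a b c → a * b * c ≡ a * c * b
      e = solve-∀
    -- The bracket overshoots by at most (11/10)⁴ < 2; the cube of this 2 is the 8 in the result.
    base : (11 ^ 4) ^ b ≤ 2 * n * (10 ^ 4) ^ b
    base = *-cancelʳ-≤ _ _ (10 ^ 4) (begin
      (11 ^ 4) ^ b * 10 ^ 4                  ≡⟨ cong (_* 10 ^ 4) (*-identityˡ ((11 ^ 4) ^ b)) ⟨
      1 * (11 ^ 4) ^ b * 10 ^ 4              ≤⟨ n≥ ⟩
      n * (10 ^ 4) ^ b * 11 ^ 4              ≤⟨ *-monoʳ-≤ (n * (10 ^ 4) ^ b) (≤ᵇ⇒≤ (11 ^ 4) (2 * 10 ^ 4) _) ⟩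
      n * (10 ^ 4) ^ b * (2 * 10 ^ 4)        ≡⟨ e n ((10 ^ 4) ^ b) (10 ^ 4) ⟩
      2 * n * (10 ^ 4) ^ b * 10 ^ 4          ∎)
      where
      e : ∀ n X c → n * X * (2 * c) ≡ 2 * n * X * c
      e = solve-∀

  -- The reason for N = 2R with R = R′ + 1: it reads (N / M)^(2R′) ≤ (1 + 1/N)^(2R - 1). Replacing 1
  -- + 1/N by the larger N / M thus costs half of the gap between the exponents R′ and R, and the
  -- other half is the saving.
  step-ratio : ∀ R′ → let M = suc (2 * R′) ; N = suc M in
    N ^ (2 * R′) * N ^ suc (2 * R′) ≤ suc N ^ suc (2 * R′) * M ^ (2 * R′)
  step-ratio R′ = begin
    N ^ w * (N * N ^ w)               ≡⟨ e₀ (N ^ w) N ⟩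
    N * (N ^ w * N ^ w)               ≡⟨ cong (N *_) (^-distribʳ-* N N w) ⟨
    N * (N * N) ^ w                   ≤⟨ cancelled ⟩
    suc N * (suc N * M) ^ w           ≡⟨ cong (suc N *_) (^-distribʳ-* (suc N) M w) ⟩
    suc N * (suc N ^ w * M ^ w)       ≡⟨ *-assoc (suc N) (suc N ^ w) (M ^ w) ⟨
    suc N * suc N ^ w * M ^ w         ∎
    where
    open ≤-Reasoning
    w = 2 * R′
    M = suc w
    N = suc M
    e₀ : ∀ X N → X * (N * X) ≡ N * (X * X)
    e₀ = solve-∀
    N² : suc (suc N * M) ≡ N * N
    N² = e w
      where
      e : ∀ w → suc (suc (suc (suc w)) * suc w) ≡ suc (suc w) * suc (suc w)
      e = solve-∀
    -- q = N² - w, so Bernoulli gives (1 - 1/N²)^w ≥ q / N²; and (N + 1) q = N³ + N + 2 exceeds N³.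
    q = N * M + 2
    bern : q * (N * N) ^ w ≤ N * N * (suc N * M) ^ w
    bern = subst (λ P → q * P ^ w ≤ P * (suc N * M) ^ w) N² (bernoulli-down′ (suc N * M) w q (e w))
      where
      e : ∀ w → suc (suc w) * suc w + 2 + w ≡ suc (suc (suc (suc w)) * suc w)
      e = solve-∀
    cancelled : N * (N * N) ^ w ≤ suc N * (suc N * M) ^ w
    cancelled = *-cancelˡ-≤ (N * N) (begin
      N * N * (N * (N * N) ^ w)           ≡⟨ *-assoc (N * N) N ((N * N) ^ w) ⟨
      N * N * N * (N * N) ^ w             ≤⟨ *-monoˡ-≤ ((N * N) ^ w) (≤-trans (m≤m+n _ (N + 2)) (≤-reflexive (e₁ w))) ⟩
      suc N * q * (N * N) ^ w             ≡⟨ *-assoc (suc N) q ((N * N) ^ w) ⟩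
      suc N * (q * (N * N) ^ w)           ≤⟨ *-monoʳ-≤ (suc N) bern ⟩
      suc N * (N * N * (suc N * M) ^ w)   ≡⟨ e₂ (suc N) (N * N) ((suc N * M) ^ w) ⟩
      N * N * (suc N * (suc N * M) ^ w)   ∎)
      where
      e₁ : ∀ w → suc (suc w) * suc (suc w) * suc (suc w) + (suc (suc w) + 2) ≡ suc (suc (suc w)) * (suc (suc w) * suc w + 2)
      e₁ = solve-∀
      e₂ : ∀ a b c → a * (b * c) ≡ b * (a * c)
      e₂ = solve-∀

  -- (N / M)^(R′ q) plays the part of (n / k)^(1 - 1/R).
  power-saving : ∀ R′ n k h q G → let R = suc R′ ; M = suc (2 * R′) ; N = suc M in .{{_ : NonZero k}} →
    n * (N ^ R) ^ q ≤ k * (suc N ^ R) ^ q →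
    k * (suc N ^ R) ^ q * N ^ R ≤ n * (N ^ R) ^ q * suc N ^ R →
    k * (1024 * (G * G)) ^ R ≤ n → n ≤ k * (2 * h) →
    8 * G * N ^ (R′ * q) ≤ h * M ^ (R′ * q)
  power-saving R′ n k h q G lo hi large n≤ = ^-cancelʳ-≤ 2 (*-cancelʳ-≤ _ _ (a ^ w₁) {{a^w₁≢0}} (begin
    (8 * G * N ^ s) ^ 2 * a ^ w₁            ≡⟨ cong (_* a ^ w₁) (^-distribʳ-* (8 * G) (N ^ s) 2) ⟩
    (8 * G) ^ 2 * (N ^ s) ^ 2 * a ^ w₁      ≡⟨ *-assoc ((8 * G) ^ 2) ((N ^ s) ^ 2) (a ^ w₁) ⟩
    (8 * G) ^ 2 * ((N ^ s) ^ 2 * a ^ w₁)    ≤⟨ *-monoʳ-≤ ((8 * G) ^ 2) ratio ⟩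
    (8 * G) ^ 2 * (c ^ w₁ * (M ^ s) ^ 2)    ≡⟨ *-assoc ((8 * G) ^ 2) (c ^ w₁) ((M ^ s) ^ 2) ⟨
    (8 * G) ^ 2 * c ^ w₁ * (M ^ s) ^ 2      ≤⟨ *-monoˡ-≤ ((M ^ s) ^ 2) main ⟩
    h ^ 2 * a ^ w₁ * (M ^ s) ^ 2            ≡⟨ e₁ (h ^ 2) (a ^ w₁) ((M ^ s) ^ 2) ⟩
    h ^ 2 * (M ^ s) ^ 2 * a ^ w₁            ≡⟨ cong (_* a ^ w₁) (^-distribʳ-* h (M ^ s) 2) ⟨
    (h * M ^ s) ^ 2 * a ^ w₁                ∎))
    where
    open ≤-Reasoning
    R = suc R′
    w = 2 * R′
    M = suc w
    N = suc M
    w₁ = suc w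
    s = R′ * q
    a = N ^ q
    c = suc N ^ q
    a^w₁≢0 : NonZero (a ^ w₁)
    a^w₁≢0 = m^n≢0 a w₁ {{m^n≢0 N q}}
    c≢0 : NonZero c
    c≢0 = m^n≢0 (suc N) q
    e₁ : ∀ x y z → x * y * z ≡ x * z * y
    e₁ = solve-∀
    double : ∀ x → (x ^ w) ^ q ≡ (x ^ s) ^ 2
    double x = trans (^-*-assoc x w q) (trans (cong (x ^_) (e R′ q)) (sym (^-*-assoc x s 2)))
      where
      e : ∀ r q → 2 * r * q ≡ r * q * 2
      e = solve-∀
    ratio : (N ^ s) ^ 2 * a ^ w₁ ≤ c ^ w₁ * (M ^ s) ^ 2
    ratio = begin
      (N ^ s) ^ 2 * a ^ w₁                ≡⟨ cong₂ _*_ (sym (double N)) (^-swap N q w₁) ⟩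
      (N ^ w) ^ q * (N ^ w₁) ^ q          ≡⟨ ^-distribʳ-* (N ^ w) (N ^ w₁) q ⟨
      (N ^ w * N ^ w₁) ^ q                ≤⟨ ^-monoˡ-≤ q (step-ratio R′) ⟩
      (suc N ^ w₁ * M ^ w) ^ q            ≡⟨ ^-distribʳ-* (suc N ^ w₁) (M ^ w) q ⟩
      (suc N ^ w₁) ^ q * (M ^ w) ^ q      ≡⟨ cong₂ _*_ (^-swap (suc N) w₁ q) (double M) ⟩
      c ^ w₁ * (M ^ s) ^ 2                ∎
    gain : 1024 * (G * G) * a ≤ c
    gain = ^-cancelʳ-≤ R (*-cancelˡ-≤ k (begin
      k * (1024 * (G * G) * a) ^ R          ≡⟨ cong (k *_) (^-distribʳ-* (1024 * (G * G)) a R) ⟩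
      k * ((1024 * (G * G)) ^ R * a ^ R)    ≡⟨ *-assoc k ((1024 * (G * G)) ^ R) (a ^ R) ⟨
      k * (1024 * (G * G)) ^ R * a ^ R      ≤⟨ *-monoˡ-≤ (a ^ R) large ⟩
      n * a ^ R                             ≡⟨ cong (n *_) (^-swap N q R) ⟩
      n * (N ^ R) ^ q                       ≤⟨ lo ⟩
      k * (suc N ^ R) ^ q                   ≡⟨ cong (k *_) (^-swap (suc N) R q) ⟩
      k * c ^ R                             ∎))
    -- The bracket overshoots by (1 + 1/N)^R ≤ 2, and n / k ≤ 2 h gives the other factor 2.
    c^R≤ : c ^ R ≤ 4 * h * a ^ R
    c^R≤ = *-cancelˡ-≤ k (*-cancelʳ-≤ _ _ (N ^ R) {{m^n≢0 N R}} (begin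
      k * c ^ R * N ^ R                     ≡⟨ cong (λ z → k * z * N ^ R) (^-swap (suc N) q R) ⟩
      k * (suc N ^ R) ^ q * N ^ R           ≤⟨ hi ⟩
      n * (N ^ R) ^ q * suc N ^ R           ≤⟨ *-mono-≤ (*-monoˡ-≤ ((N ^ R) ^ q) n≤) (halve-down N R 1 2R≤ (≤-reflexive (sym (*-identityʳ R)))) ⟩
      k * (2 * h) * (N ^ R) ^ q * (2 * 1 * N ^ R) ≡⟨ cong (λ z → k * (2 * h) * z * (2 * 1 * N ^ R)) (^-swap N R q) ⟩
      k * (2 * h) * a ^ R * (2 * 1 * N ^ R) ≡⟨ e k h (a ^ R) (N ^ R) ⟩
      k * (4 * h * a ^ R) * N ^ R           ∎))
      where
      e : ∀ k h A B → k * (2 * h) * A * (2 * 1 * B) ≡ k * (4 * h * A) * B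
      e = solve-∀
      2R≤ : 2 * R ≤ suc N
      2R≤ = ≤-trans (≤-reflexive (e′ R′)) (n≤1+n N)
        where
        e′ : ∀ r → 2 * suc r ≡ suc (suc (2 * r))
        e′ = solve-∀
    -- (c / a)^(2R - 1) is the square of (c / a)^R divided by c / a, hence at most (4 h)² / (1024
    -- G²) = (h / (8 G))². This fixes the constant 1024.
    main : (8 * G) ^ 2 * c ^ w₁ ≤ h ^ 2 * a ^ w₁
    main = *-cancelʳ-≤ _ _ c {{c≢0}} (begin
      (8 * G) ^ 2 * c ^ w₁ * c              ≡⟨ e₂ ((8 * G) ^ 2) (c ^ w₁) c ⟩
      (8 * G) ^ 2 * (c * c ^ w₁)            ≡⟨ cong ((8 * G) ^ 2 *_) (trans (cong (c ^_) (e₃ R′)) (sym (^-*-assoc c R 2))) ⟩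
      (8 * G) ^ 2 * (c ^ R) ^ 2             ≤⟨ *-monoʳ-≤ ((8 * G) ^ 2) (^-monoˡ-≤ 2 c^R≤) ⟩
      (8 * G) ^ 2 * (4 * h * a ^ R) ^ 2     ≡⟨ cong ((8 * G) ^ 2 *_) (trans (^-distribʳ-* (4 * h) (a ^ R) 2) (cong ((4 * h) ^ 2 *_) (trans (^-*-assoc a R 2) (cong (a ^_) (sym (e₃ R′)))))) ⟩
      (8 * G) ^ 2 * ((4 * h) ^ 2 * (a * a ^ w₁)) ≡⟨ e₄ G h a (a ^ w₁) ⟩
      h ^ 2 * a ^ w₁ * (1024 * (G * G) * a) ≤⟨ *-monoʳ-≤ (h ^ 2 * a ^ w₁) gain ⟩
      h ^ 2 * a ^ w₁ * c                    ∎)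
      where
      e₂ : ∀ x y z → x * y * z ≡ x * (z * y)
      e₂ = solve-∀
      e₃ : ∀ r → suc (suc (2 * r)) ≡ suc r * 2
      e₃ = solve-∀
      e₄ : ∀ G h a X → 8 * G * (8 * G * 1) * (4 * h * (4 * h * 1) * (a * X)) ≡ h * (h * 1) * X * (1024 * (G * G) * a)
      e₄ = solve-∀

  -- Up to a constant k³ is at most n^(9/10), and the remaining n^(1/10) absorbs 2^E; tenth powers
  -- clear the fractional exponents.
  tenth-power : ∀ n k E {X} → k ^ 10 ≤ 8 * n ^ 3 → X ≤ 2 ^ E * k ^ 3 → 2 ^ (E * 10 + 9) ≤ n → X ≤ n
  tenth-power n k E {X} k^10≤ X≤ small = ^-cancelʳ-≤ 10 (begin
    X ^ 10                              ≤⟨ ^-monoˡ-≤ 10 X≤ ⟩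
    (2 ^ E * k ^ 3) ^ 10                ≡⟨ ^-distribʳ-* (2 ^ E) (k ^ 3) 10 ⟩
    (2 ^ E) ^ 10 * (k ^ 3) ^ 10         ≡⟨ cong₂ _*_ (^-*-assoc 2 E 10) (^-swap k 3 10) ⟩
    2 ^ (E * 10) * (k ^ 10) ^ 3         ≤⟨ *-monoʳ-≤ (2 ^ (E * 10)) (^-monoˡ-≤ 3 k^10≤) ⟩
    2 ^ (E * 10) * (8 * n ^ 3) ^ 3      ≡⟨ cong (2 ^ (E * 10) *_) (trans (^-distribʳ-* 8 (n ^ 3) 3) (cong (2 ^ 9 *_) (^-*-assoc n 3 3))) ⟩
    2 ^ (E * 10) * (2 ^ 9 * n ^ 9)      ≡⟨ *-assoc (2 ^ (E * 10)) (2 ^ 9) (n ^ 9) ⟨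
    2 ^ (E * 10) * 2 ^ 9 * n ^ 9        ≡⟨ cong (_* n ^ 9) (^-distribˡ-+-* 2 (E * 10) 9) ⟨
    2 ^ (E * 10 + 9) * n ^ 9            ≤⟨ *-monoˡ-≤ (n ^ 9) small ⟩
    n ^ 10                              ∎)
    where open ≤-Reasoning

  -- ℓ is the binary logarithm of n up to rounding. The threshold 2^(D D) for n makes g = ℓ / D at
  -- least D, so that every constant depending on R is absorbed by a multiple of g.
  module Sizes (R D n k ℓ : ℕ) .{{nz-R : NonZero R}} .{{nz-D : NonZero D}}
    (D≡ : D ≡ 320 * R) (large : 2 ^ (D * D) ≤ n) (n≤ : n ≤ 2 ^ ℓ) (n≥ : 2 ^ ℓ ≤ 2 * n) (k^10≤ : k ^ 10 ≤ 8 * n ^ 3)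
    where
    open ≤-Reasoning

    -- The horizon is k g rounds, G bounds the growth (1 + 4/k)^(kg) of the excess, 2^(-L) the failure probability of a step;
    -- the factor 320 in D makes 2^(160 g R), a power of G, smaller than √n.
    g G L : ℕ
    g = ℓ / D
    G = 2 ^ (8 * g)
    L = 5 * ℓ

    1≤n : 1 ≤ n
    1≤n = ≤-trans (m^n>0 2 (D * D)) large

    D≤g : D ≤ g
    D≤g = ≤-/ D D (^-cancelˡ-≤ 2 (s≤s (s≤s z≤n)) (≤-trans large n≤))

    320R≤D : 320 * R ≤ D
    320R≤D = ≤-reflexive (sym D≡)

    320≤D : 320 ≤ D
    320≤D = ≤-trans (m≤m*n 320 R) 320R≤D

    1≤g : 1 ≤ g
    1≤g = ≤-trans (≤-trans (s≤s z≤n) 320≤D) D≤g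

    Dg≤ℓ : D * g ≤ ℓ
    Dg≤ℓ = ≤-trans (≤-reflexive (*-comm D g)) (m/n*n≤m ℓ D)

    ℓ≤ : ℓ ≤ D * suc g
    ℓ≤ = <⇒≤ (n<m[1+n/m] ℓ D)

    ℓ≤2Dg : ℓ ≤ 2 * D * g
    ℓ≤2Dg = begin
      ℓ             ≤⟨ ℓ≤ ⟩
      D * suc g     ≤⟨ *-monoʳ-≤ D (+-monoˡ-≤ g 1≤g) ⟩
      D * (g + g)   ≡⟨ e D g ⟩
      2 * D * g     ∎
      where
      e : ∀ D g → D * (g + g) ≡ 2 * D * g
      e = solve-∀

    power-≤-n : ∀ e → suc e ≤ ℓ → 2 ^ e ≤ n
    power-≤-n e le = *-cancelˡ-≤ 2 (≤-trans (^-monoʳ-≤ 2 le) n≥)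

    G² : G * G ≡ 2 ^ (16 * g)
    G² = trans (sym (^-distribˡ-+-* 2 (8 * g) (8 * g))) (cong (2 ^_) (e g))
      where
      e : ∀ g → 8 * g + 8 * g ≡ 16 * g
      e = solve-∀

    -- Nonemptiness of the window for the starting excess: k √(h L), enlarged by G, must stay below
    -- h, that is k² L G² below h up to a constant, and h is about n / k.
    noise-room : 864 * (k * k) * L * (G * G) * k ≤ n
    noise-room = tenth-power n k (D + 17 * g + 13) k^10≤ step₁ (power-≤-n ((D + 17 * g + 13) * 10 + 9) E≤)
      where
      ℓ≤2^ : ℓ ≤ 2 ^ D * 2 ^ g
      ℓ≤2^ = ≤-trans ℓ≤ (*-mono-≤ (<⇒≤ (n<2^n D)) (n<2^n g))
      e₁ : ∀ k ℓ X → 864 * (k * k) * (5 * ℓ) * X * k ≡ ℓ * X * 4320 * (k * (k * (k * 1)))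
      e₁ = solve-∀
      step₁ : 864 * (k * k) * L * (G * G) * k ≤ 2 ^ (D + 17 * g + 13) * k ^ 3
      step₁ = begin
        864 * (k * k) * (5 * ℓ) * (G * G) * k       ≡⟨ e₁ k ℓ (G * G) ⟩
        ℓ * (G * G) * 4320 * k ^ 3                  ≡⟨ cong (λ z → ℓ * z * 4320 * k ^ 3) G² ⟩
        ℓ * 2 ^ (16 * g) * 4320 * k ^ 3
          ≤⟨ *-monoˡ-≤ (k ^ 3) (*-mono-≤ (*-monoˡ-≤ (2 ^ (16 * g)) ℓ≤2^) (≤ᵇ⇒≤ 4320 (2 ^ 13) _)) ⟩
        2 ^ D * 2 ^ g * 2 ^ (16 * g) * 2 ^ 13 * k ^ 3 ≡⟨ cong (_* k ^ 3) powers ⟩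
        2 ^ (D + 17 * g + 13) * k ^ 3               ∎
        where
        powers : 2 ^ D * 2 ^ g * 2 ^ (16 * g) * 2 ^ 13 ≡ 2 ^ (D + 17 * g + 13)
        powers = trans (cong (_* 2 ^ 13) (trans (*-assoc (2 ^ D) (2 ^ g) (2 ^ (16 * g)))
            (trans (cong (2 ^ D *_) (sym (^-distribˡ-+-* 2 g (16 * g)))) (sym (^-distribˡ-+-* 2 D (17 * g))))))
          (sym (^-distribˡ-+-* 2 (D + 17 * g) 13))
      -- With 1 ≤ g and D ≤ g all contributions to the exponent fit into 320 g ≤ D g ≤ ℓ.
      E≤ : suc ((D + 17 * g + 13) * 10 + 9) ≤ ℓ
      E≤ = begin
        suc ((D + 17 * g + 13) * 10 + 9)            ≡⟨ e₃ D g ⟩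
        140 * 1 + 10 * D + 170 * g                  ≤⟨ +-monoˡ-≤ (170 * g) (+-mono-≤ (*-monoʳ-≤ 140 1≤g) (*-monoʳ-≤ 10 D≤g)) ⟩
        140 * g + 10 * g + 170 * g                  ≡⟨ e₄ g ⟩
        320 * g                                     ≤⟨ *-monoˡ-≤ g 320≤D ⟩
        D * g                                       ≤⟨ Dg≤ℓ ⟩
        ℓ                                           ∎
        where
        e₃ : ∀ D g → suc ((D + 17 * g + 13) * 10 + 9) ≡ 140 * 1 + 10 * D + 170 * g
        e₃ = solve-∀
        e₄ : ∀ g → 140 * g + 10 * g + 170 * g ≡ 320 * g
        e₄ = solve-∀

    -- (n / k)^(1/R) has to beat the constant 1024 and the growth G². Since the R-th power of G²
    -- appears, D must be a multiple of R.
    saving-room : k * (1024 * (G * G)) ^ R ≤ n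
    saving-room = ^-cancelʳ-≤ 10 (begin
      (k * Z) ^ 10                    ≡⟨ ^-distribʳ-* k Z 10 ⟩
      k ^ 10 * Z ^ 10                 ≤⟨ *-monoˡ-≤ (Z ^ 10) k^10≤ ⟩
      8 * n ^ 3 * Z ^ 10              ≡⟨ e₁ 8 (n ^ 3) (Z ^ 10) ⟩
      8 * Z ^ 10 * n ^ 3              ≤⟨ *-monoˡ-≤ (n ^ 3) small ⟩
      n ^ 4                           ≤⟨ ^-monoʳ-≤ n {{>-nonZero 1≤n}} (≤ᵇ⇒≤ 4 10 _) ⟩
      n ^ 10                          ∎)
      where
      Z = (1024 * (G * G)) ^ R
      F = (10 + 16 * g) * R * 10
      e₁ : ∀ a b c → a * b * c ≡ a * c * b
      e₁ = solve-∀
      Z^10 : Z ^ 10 ≡ 2 ^ F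
      Z^10 = trans (cong (λ z → (z ^ R) ^ 10) (trans (cong (1024 *_) G²) (sym (^-distribˡ-+-* 2 10 (16 * g)))))
        (trans (cong (_^ 10) (^-*-assoc 2 (10 + 16 * g) R)) (^-*-assoc 2 ((10 + 16 * g) * R) 10))
      small : 8 * Z ^ 10 ≤ n
      small = begin
        8 * Z ^ 10        ≡⟨ cong (8 *_) Z^10 ⟩
        2 ^ 3 * 2 ^ F     ≡⟨ trans (^-distribˡ-+-* 2 F 3) (*-comm (2 ^ F) (2 ^ 3)) ⟨
        2 ^ (F + 3)       ≤⟨ power-≤-n (F + 3) F≤ ⟩
        n                 ∎
        where
        F≤ : suc (F + 3) ≤ ℓ
        F≤ = begin
          suc ((10 + 16 * g) * R * 10 + 3)      ≡⟨ e₂ g R ⟩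
          4 + 100 * R + 160 * g * R             ≤⟨ +-monoˡ-≤ (160 * g * R) (+-monoˡ-≤ (100 * R) (*-monoʳ-≤ 4 {1} {R} (>-nonZero⁻¹ R))) ⟩
          4 * R + 100 * R + 160 * g * R         ≡⟨ e₃ g R ⟩
          104 * (1 * R) + 160 * (g * R)         ≤⟨ +-monoˡ-≤ (160 * (g * R)) (*-mono-≤ (≤ᵇ⇒≤ 104 160 _) (*-monoˡ-≤ R 1≤g)) ⟩
          160 * (g * R) + 160 * (g * R)         ≡⟨ e₄ g R ⟩
          320 * R * g                           ≤⟨ *-monoˡ-≤ g 320R≤D ⟩
          D * g                                 ≤⟨ Dg≤ℓ ⟩
          ℓ                                     ∎
          where
          e₂ : ∀ g R → suc ((10 + 16 * g) * R * 10 + 3) ≡ 4 + 100 * R + 160 * g * R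
          e₂ = solve-∀
          e₃ : ∀ g R → 4 * R + 100 * R + 160 * g * R ≡ 104 * (1 * R) + 160 * (g * R)
          e₃ = solve-∀
          e₄ : ∀ g R → 160 * (g * R) + 160 * (g * R) ≡ 320 * R * g
          e₄ = solve-∀

    1≤ℓ : 1 ≤ ℓ
    1≤ℓ = ≤-trans 1≤g (m/n≤m ℓ D)

    -- There are k g rounds with k colours each, at most 2^(3ℓ) events; L = 5ℓ leaves the total
    -- failure probability 2^(-2ℓ) that `probability-bound` asks for.
    union-room : k ≤ n → k * g * k * 2 ^ (2 * ℓ) ≤ 2 ^ L
    union-room k≤n = begin
      k * g * k * 2 ^ (2 * ℓ)       ≤⟨ *-monoˡ-≤ (2 ^ (2 * ℓ)) (*-mono-≤ (*-mono-≤ k≤2^ g≤2^) k≤2^) ⟩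
      2 ^ ℓ * 2 ^ ℓ * 2 ^ ℓ * 2 ^ (2 * ℓ)
        ≡⟨ cong (_* 2 ^ (2 * ℓ)) (trans (cong (_* 2 ^ ℓ) (sym (^-distribˡ-+-* 2 ℓ ℓ))) (sym (^-distribˡ-+-* 2 (ℓ + ℓ) ℓ))) ⟩
      2 ^ (ℓ + ℓ + ℓ) * 2 ^ (2 * ℓ) ≡⟨ ^-distribˡ-+-* 2 (ℓ + ℓ + ℓ) (2 * ℓ) ⟨
      2 ^ (ℓ + ℓ + ℓ + 2 * ℓ)       ≡⟨ cong (2 ^_) (e ℓ) ⟩
      2 ^ (5 * ℓ)                   ∎
      where
      k≤2^ : k ≤ 2 ^ ℓ
      k≤2^ = ≤-trans k≤n n≤
      g≤2^ : g ≤ 2 ^ ℓ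
      g≤2^ = ≤-trans (m/n≤m ℓ D) (<⇒≤ (n<2^n ℓ))
      e : ∀ l → l + l + l + 2 * l ≡ 5 * l
      e = solve-∀

  module Start (k h L G : ℕ) .{{nz-k : NonZero k}} .{{nz-L : NonZero L}} .{{nz-G : NonZero G}}
    (room : 864 * (k * k) * L * (G * G) ≤ h) where
    open ≤-Reasoning

    -- 4 G Δ₀ equals m U. Hence m = h / U makes the starting excess as large as its growth by G
    -- permits: Δ₀ lies between h / (8 G) and h / (4 G).
    U : ℕ
    U = 24 * (k * (L * G))

    instance
      U≢0 : NonZero U
      U≢0 = m*n≢0 24 _ {{_}} {{m*n≢0 k _ {{nz-k}} {{m*n≢0 L G}}}}

    m : ℕ
    m = h / U

    -- The 864 in `room` is 36 times the 24 of U. The 36 comes from `noise`, where 3 h ≤ 6 m U = 4 m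
    -- (36 k G) L has to be at most 4 m² L.
    36kG≤m : 36 * (k * G) ≤ m
    36kG≤m = ≤-/ (36 * (k * G)) U (≤-trans (≤-reflexive (e k L G)) room)
      where
      e : ∀ k L G → 36 * (k * G) * (24 * (k * (L * G))) ≡ 864 * (k * k) * L * (G * G)
      e = solve-∀

    1≤m : 1 ≤ m
    1≤m = ≤-trans (≤-trans (>-nonZero⁻¹ (k * G) {{m*n≢0 k G}}) (m≤n*m (k * G) 36)) 36kG≤m

    h≤2mU : h ≤ 2 * m * U
    h≤2mU = begin
      h               ≤⟨ <⇒≤ (n<m[1+n/m] h U) ⟩
      U * suc m       ≤⟨ *-monoʳ-≤ U (+-monoˡ-≤ m 1≤m) ⟩
      U * (m + m)     ≡⟨ e U m ⟩
      2 * m * U       ∎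
      where
      e : ∀ U m → U * (m + m) ≡ 2 * m * U
      e = solve-∀

    2≤h : 2 ≤ h
    2≤h = begin
      2             ≤⟨ ≤ᵇ⇒≤ 2 24 _ ⟩
      24 * 1        ≤⟨ *-monoʳ-≤ 24 (>-nonZero⁻¹ (k * (L * G)) {{m*n≢0 k _ {{nz-k}} {{m*n≢0 L G}}}}) ⟩
      U             ≤⟨ m≤n*m U m {{>-nonZero 1≤m}} ⟩
      m * U         ≤⟨ m/n*n≤m h U ⟩
      h             ∎

    noise : 3 * h ≤ 4 * (m * m) * L
    noise = begin
      3 * h                                     ≤⟨ *-monoʳ-≤ 3 h≤2mU ⟩
      3 * (2 * m * (24 * (k * (L * G))))        ≡⟨ e₁ m k L G ⟩
      4 * (m * (36 * (k * G))) * L              ≤⟨ *-monoˡ-≤ L (*-monoʳ-≤ 4 (*-monoʳ-≤ m 36kG≤m)) ⟩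
      4 * (m * m) * L                           ∎
      where
      e₁ : ∀ m k L G → 3 * (2 * m * (24 * (k * (L * G)))) ≡ 4 * (m * (36 * (k * G))) * L
      e₁ = solve-∀

    Δ₀ : ℕ
    Δ₀ = 6 * (m * L) * k

    4GΔ₀≤h : 4 * Δ₀ * G ≤ h
    4GΔ₀≤h = ≤-trans (≤-reflexive (e m L k G)) (m/n*n≤m h U)
      where
      e : ∀ m L k G → 4 * (6 * (m * L) * k) * G ≡ m * (24 * (k * (L * G)))
      e = solve-∀

    h≤8GΔ₀ : h ≤ 8 * G * Δ₀
    h≤8GΔ₀ = ≤-trans h≤2mU (≤-reflexive (e m L k G))
      where
      e : ∀ m L k G → 2 * m * (24 * (k * (L * G))) ≡ 8 * G * (6 * (m * L) * k)
      e = solve-∀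

    upper : ∀ T → (k + 4) ^ T ≤ G * k ^ T → 4 * Δ₀ * (k + 4) ^ T ≤ h * k ^ T
    upper T grow = begin
      4 * Δ₀ * (k + 4) ^ T      ≤⟨ *-monoʳ-≤ (4 * Δ₀) grow ⟩
      4 * Δ₀ * (G * k ^ T)      ≡⟨ *-assoc (4 * Δ₀) G (k ^ T) ⟨
      4 * Δ₀ * G * k ^ T        ≤⟨ *-monoˡ-≤ (k ^ T) 4GΔ₀≤h ⟩
      h * k ^ T                 ∎

    -- X / Y is the allowed initial excess over n / k, at most h / (8 G) and so at most Δ₀. The
    -- fractional part of n / k disappears because k c < k (h + Δ₀ + 1) is strict.
    colours : ∀ {n c X Y} .{{_ : NonZero Y}} → n < k * suc h →
      8 * G * X ≤ h * Y → k * c * Y ≤ n * Y + k * X → c ≤ h + Δ₀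
    colours {n} {c} {X} {Y} n< X≤ c≤ = ≤-pred (*-cancelˡ-< k c (suc (h + Δ₀)) (begin-strict
      k * c                   ≤⟨ *-cancelʳ-≤ _ _ Y kcY ⟩
      n + k * Δ₀              <⟨ +-monoˡ-< (k * Δ₀) n< ⟩
      k * suc h + k * Δ₀      ≡⟨ *-distribˡ-+ k (suc h) Δ₀ ⟨
      k * suc (h + Δ₀)        ∎))
      where
      X≤Δ₀Y : X ≤ Δ₀ * Y
      X≤Δ₀Y = *-cancelˡ-≤ (8 * G) {{m*n≢0 8 G}} (begin
        8 * G * X             ≤⟨ X≤ ⟩
        h * Y                 ≤⟨ *-monoˡ-≤ Y h≤8GΔ₀ ⟩
        8 * G * Δ₀ * Y        ≡⟨ *-assoc (8 * G) Δ₀ Y ⟩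
        8 * G * (Δ₀ * Y)      ∎)
      kcY : k * c * Y ≤ (n + k * Δ₀) * Y
      kcY = begin
        k * c * Y             ≤⟨ c≤ ⟩
        n * Y + k * X         ≤⟨ +-monoʳ-≤ (n * Y) (*-monoʳ-≤ k X≤Δ₀Y) ⟩
        n * Y + k * (Δ₀ * Y)  ≡⟨ e n Y k Δ₀ ⟩
        (n + k * Δ₀) * Y      ∎
        where
        e : ∀ n Y k D → n * Y + k * (D * Y) ≡ (n + k * D) * Y
        e = solve-∀

  -- Two colours force h ≤ n / 2, so that a class of at most 5 h / 4 nodes has at most 5 n / 8 < n.
  not-monochromatic : ∀ {n k h c} → 1 ≤ n → 2 ≤ k → k * h ≤ n → 4 * c ≤ 5 * h → c ≢ n
  not-monochromatic {n} {k} {h} 1≤n 2≤k kh≤n 4c≤5h refl = <⇒≱ (*-monoˡ-< n {{>-nonZero 1≤n}} (≤ᵇ⇒≤ 7 8 _)) (begin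
    8 * n             ≡⟨ *-assoc 2 4 n ⟩
    2 * (4 * n)       ≤⟨ *-monoʳ-≤ 2 4c≤5h ⟩
    2 * (5 * h)       ≡⟨ e h ⟩
    5 * (2 * h)       ≤⟨ *-monoʳ-≤ 5 (≤-trans (*-monoˡ-≤ h 2≤k) kh≤n) ⟩
    5 * n             ≤⟨ *-monoˡ-≤ n (≤ᵇ⇒≤ 5 6 _) ⟩
    6 * n             ∎)
    where
    open ≤-Reasoning
    e : ∀ h → 2 * (5 * h) ≡ 5 * (2 * h)
    e = solve-∀

  ∑-complement : ∀ {X : Set} (p : X → Bool) (xs : List X) → length (filterᵇ p xs) + ∑ xs (𝟙 ∘ not ∘ p) ≡ length xs
  ∑-complement p xs = begin
    length (filterᵇ p xs) + ∑ xs (𝟙 ∘ not ∘ p)   ≡⟨ cong (_+ ∑ xs (𝟙 ∘ not ∘ p)) (length-filterᵇ p xs) ⟩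
    ∑ xs (𝟙 ∘ p) + ∑ xs (𝟙 ∘ not ∘ p)            ≡⟨ ∑-+ xs (𝟙 ∘ p) (𝟙 ∘ not ∘ p) ⟨
    ∑ xs (λ x → 𝟙 (p x) + 𝟙 (not (p x)))         ≡⟨ ∑-cong xs (λ x → one (p x)) ⟩
    ∑ xs (λ _ → 1)                               ≡⟨ length≡∑1 xs ⟨
    length xs                                    ∎
    where
    open ≡-Reasoning
    one : ∀ b → 𝟙 b + 𝟙 (not b) ≡ 1
    one true  = refl
    one false = refl

  few-bad : ∀ {bad a K Q W} .{{_ : NonZero Q}} → bad * Q ≤ a * W → a * K ≤ Q → bad * K ≤ W
  few-bad {bad} {a} {K} {Q} {W} bad≤ aK≤ = *-cancelʳ-≤ _ _ Q (begin
    bad * K * Q     ≡⟨ e₁ bad K Q ⟩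
    bad * Q * K     ≤⟨ *-monoˡ-≤ K bad≤ ⟩
    a * W * K       ≡⟨ e₂ a W K ⟩
    W * (a * K)     ≤⟨ *-monoʳ-≤ W aK≤ ⟩
    W * Q           ∎)
    where
    open ≤-Reasoning
    e₁ : ∀ a b c → a * b * c ≡ a * c * b
    e₁ = solve-∀
    e₂ : ∀ a b c → a * b * c ≡ b * (a * c)
    e₂ = solve-∀

module Analysis where

  open Counting using (n<2^n)
  open import Defs
  open import Data.Integer as ℤ using (+_)
  import Data.Integer.Properties as ℤ
  open import Data.Nat as ℕ using (ℕ; zero; suc; _!; z≤n; s≤s)
  import Data.Nat.Properties as ℕ
  open import Data.Nat.Properties using (_!≢0)
  open import Data.Product using (_×_; _,_; proj₁; proj₂; ∃-syntax)
  open import Data.Rational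
  open import Data.Rational.Properties
  import Data.Rational.Unnormalised as ℚᵘ
  import Data.Rational.Unnormalised.Properties as ℚᵘ
  open import Data.Sum using (inj₁; inj₂)
  open import Level using (0ℓ)
  open import Relation.Binary.PropositionalEquality
  open import Relation.Nullary using (yes; no; contradiction)
  open import Relation.Nullary.Decidable using (dec⇒maybe)
  open import Tactic.RingSolver using (solve-∀)
  open import Tactic.RingSolver.Core.AlmostCommutativeRing using (AlmostCommutativeRing; fromCommutativeRing)

  -- Rational arithmetic and the embedding of the natural numbers

  ring : AlmostCommutativeRing 0ℓ 0ℓ
  ring = fromCommutativeRing +-*-commutativeRing λ x → dec⇒maybe (0ℚ ≟ x)

  ≤-by : ∀ {p q} d → 0ℚ ≤ d → p + d ≡ q → p ≤ q
  ≤-by {p} d 0≤d e = ≤-trans (≤-reflexive (sym (+-identityʳ p))) (≤-trans (+-monoʳ-≤ p 0≤d) (≤-reflexive e))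

  0≤-diff : ∀ {p q} → p ≤ q → 0ℚ ≤ q - p
  0≤-diff {p} {q} p≤q = ≤-trans (≤-reflexive (sym (+-inverseʳ p))) (+-monoˡ-≤ (- p) p≤q)

  ≤-diff : ∀ {p q} → 0ℚ ≤ q - p → p ≤ q
  ≤-diff {p} {q} le = ≤-by (q - p) le (e p q)
    where
    e : ∀ p q → p + (q - p) ≡ q
    e = solve-∀ ring

  *-monoʳ : ∀ {r p q} → 0ℚ ≤ r → p ≤ q → r * p ≤ r * q
  *-monoʳ {r} 0≤r = *-monoˡ-≤-nonNeg r {{nonNegative 0≤r}}

  *-monoˡ : ∀ {r p q} → 0ℚ ≤ r → p ≤ q → p * r ≤ q * r
  *-monoˡ {r} 0≤r = *-monoʳ-≤-nonNeg r {{nonNegative 0≤r}}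

  *-nonNeg : ∀ {p q} → 0ℚ ≤ p → 0ℚ ≤ q → 0ℚ ≤ p * q
  *-nonNeg {p} 0≤p 0≤q = ≤-trans (≤-reflexive (sym (*-zeroʳ p))) (*-monoʳ 0≤p 0≤q)

  +-nonNeg : ∀ {p q} → 0ℚ ≤ p → 0ℚ ≤ q → 0ℚ ≤ p + q
  +-nonNeg 0≤p 0≤q = ≤-trans (≤-reflexive (sym (+-identityˡ 0ℚ))) (+-mono-≤ 0≤p 0≤q)

  *-mono : ∀ {p q r s} → 0ℚ ≤ r → 0ℚ ≤ q → p ≤ q → r ≤ s → p * r ≤ q * s
  *-mono 0≤r 0≤q p≤q r≤s = ≤-trans (*-monoˡ 0≤r p≤q) (*-monoʳ 0≤q r≤s)

  *-cancelˡ : ∀ {r p q} → 0ℚ < r → r * p ≤ r * q → p ≤ q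
  *-cancelˡ {r} 0<r = *-cancelˡ-≤-pos r {{positive 0<r}}

  *-pos : ∀ {p q} → 0ℚ < p → 0ℚ < q → 0ℚ < p * q
  *-pos {p} {q} 0<p 0<q = positive⁻¹ (p * q) {{pos*pos⇒pos p {{positive 0<p}} q {{positive 0<q}}}}

  0<1 : 0ℚ < 1ℚ
  0<1 = positive⁻¹ 1ℚ

  0≤1 : 0ℚ ≤ 1ℚ
  0≤1 = <⇒≤ 0<1

  p≤∣p∣ : ∀ p → p ≤ ∣ p ∣
  p≤∣p∣ p with ≤-total 0ℚ p
  ... | inj₁ 0≤p = ≤-reflexive (sym (0≤p⇒∣p∣≡p 0≤p))
  ... | inj₂ p≤0 = ≤-trans p≤0 (0≤∣p∣ p)

  -p≤∣p∣ : ∀ p → - p ≤ ∣ p ∣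
  -p≤∣p∣ p = ≤-trans (p≤∣p∣ (- p)) (≤-reflexive (∣-p∣≡∣p∣ p))

  fromℕ : ℕ → ℚ
  fromℕ n = + n / 1

  private
    toℚᵘ-fromℕ : ∀ n → toℚᵘ (fromℕ n) ℚᵘ.≃ ℚᵘ.mkℚᵘ (+ n) 0
    toℚᵘ-fromℕ n = toℚᵘ-fromℚᵘ (ℚᵘ.mkℚᵘ (+ n) 0)

  fromℕ-+ : ∀ a b → fromℕ (a ℕ.+ b) ≡ fromℕ a + fromℕ b
  fromℕ-+ a b = toℚᵘ-injective (ℚᵘ.≃-trans (toℚᵘ-fromℕ (a ℕ.+ b)) (ℚᵘ.≃-trans (ℚᵘ.*≡* e)
    (ℚᵘ.≃-sym (ℚᵘ.≃-trans (toℚᵘ-homo-+ (fromℕ a) (fromℕ b)) (ℚᵘ.+-cong (toℚᵘ-fromℕ a) (toℚᵘ-fromℕ b))))))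
    where
    e : + (a ℕ.+ b) ℤ.* + 1 ≡ (+ a ℤ.* + 1 ℤ.+ + b ℤ.* + 1) ℤ.* + 1
    e = cong (ℤ._* + 1) (trans (ℤ.pos-+ a b) (sym (cong₂ ℤ._+_ (ℤ.*-identityʳ (+ a)) (ℤ.*-identityʳ (+ b)))))

  fromℕ-* : ∀ a b → fromℕ (a ℕ.* b) ≡ fromℕ a * fromℕ b
  fromℕ-* a b = toℚᵘ-injective (ℚᵘ.≃-trans (toℚᵘ-fromℕ (a ℕ.* b)) (ℚᵘ.≃-trans (ℚᵘ.*≡* e)
    (ℚᵘ.≃-sym (ℚᵘ.≃-trans (toℚᵘ-homo-* (fromℕ a) (fromℕ b)) (ℚᵘ.*-cong (toℚᵘ-fromℕ a) (toℚᵘ-fromℕ b))))))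
    where
    e : + (a ℕ.* b) ℤ.* + 1 ≡ (+ a ℤ.* + b) ℤ.* + 1
    e = cong (ℤ._* + 1) (ℤ.pos-* a b)

  fromℕ-mono : ∀ {a b} → a ℕ.≤ b → fromℕ a ≤ fromℕ b
  fromℕ-mono {a} {b} a≤b = toℚᵘ-cancel-≤ (ℚᵘ.≤-respˡ-≃ (ℚᵘ.≃-sym (toℚᵘ-fromℕ a)) (ℚᵘ.≤-respʳ-≃ (ℚᵘ.≃-sym (toℚᵘ-fromℕ b))
    (ℚᵘ.*≤* (ℤ.*-monoʳ-≤-nonNeg (+ 1) (ℤ.+≤+ a≤b)))))

  fromℕ-cancel : ∀ {a b} → fromℕ a ≤ fromℕ b → a ℕ.≤ b
  fromℕ-cancel {a} {b} le with ℚᵘ.≤-respˡ-≃ (toℚᵘ-fromℕ a) (ℚᵘ.≤-respʳ-≃ (toℚᵘ-fromℕ b) (toℚᵘ-mono-≤ le))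
  ... | ℚᵘ.*≤* le′ = ℤ.drop‿+≤+ (subst₂ ℤ._≤_ (ℤ.*-identityʳ (+ a)) (ℤ.*-identityʳ (+ b)) le′)

  0≤fromℕ : ∀ n → 0ℚ ≤ fromℕ n
  0≤fromℕ n = fromℕ-mono {0} {n} z≤n

  1≤fromℕ : ∀ n .{{_ : ℕ.NonZero n}} → 1ℚ ≤ fromℕ n
  1≤fromℕ n = fromℕ-mono {1} {n} (ℕ.>-nonZero⁻¹ n)

  0<fromℕ : ∀ n .{{_ : ℕ.NonZero n}} → 0ℚ < fromℕ n
  0<fromℕ n = <-≤-trans 0<1 (1≤fromℕ n)

  fromℕ-suc : ∀ n → fromℕ (suc n) ≡ 1ℚ + fromℕ n
  fromℕ-suc n = fromℕ-+ 1 n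

  fromℕ-^ : ∀ a b → fromℕ (a ℕ.^ b) ≡ fromℕ a ^ℚ b
  fromℕ-^ a zero    = refl
  fromℕ-^ a (suc b) = trans (fromℕ-* a (a ℕ.^ b)) (cong (fromℕ a *_) (fromℕ-^ a b))

  fromℕ*inv : ∀ d .{{_ : ℕ.NonZero d}} → fromℕ d * (+ 1 / d) ≡ 1ℚ
  fromℕ*inv d@(suc d-1) = toℚᵘ-injective (ℚᵘ.≃-trans (toℚᵘ-homo-* (fromℕ d) (+ 1 / d))
    (ℚᵘ.≃-trans (ℚᵘ.*-cong (toℚᵘ-fromℕ d) (toℚᵘ-fromℚᵘ (ℚᵘ.mkℚᵘ (+ 1) d-1))) (ℚᵘ.*≡* e)))
    where
    e : (+ d ℤ.* + 1) ℤ.* + 1 ≡ + 1 ℤ.* + (1 ℕ.* d)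
    e = trans (ℤ.*-identityʳ _) (trans (ℤ.*-identityʳ _) (trans (cong +_ (sym (ℕ.*-identityˡ d))) (sym (ℤ.*-identityˡ _))))

  0<inv : ∀ d .{{_ : ℕ.NonZero d}} → 0ℚ < + 1 / d
  0<inv d = positive⁻¹ (+ 1 / d) {{normalize-pos 1 d}}

  recip-inverse : ∀ {q} → 0ℚ < q → q * recip q ≡ 1ℚ
  recip-inverse {q} 0<q with q ≟ 0ℚ
  ... | yes refl = contradiction 0<q (<-irrefl refl)
  ... | no q≢0   = *-inverseʳ q {{≢-nonZero q≢0}}

  0<recip : ∀ {q} → 0ℚ < q → 0ℚ < recip q
  0<recip {q} 0<q with q ≟ 0ℚ
  ... | yes refl = contradiction 0<q (<-irrefl refl)
  ... | no q≢0   = positive⁻¹ _ {{1/pos⇒pos q {{positive 0<q}}}}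

  -- The numerator of a positive rational is at least 1, so its denominator is an explicit witness.
  archimedean : ∀ δ → 0ℚ < δ → 1ℚ ≤ δ * fromℕ (↧ₙ δ)
  archimedean δ@(mkℚ (+ suc a) d-1 c) 0<δ = begin
    1ℚ                                ≤⟨ fromℕ-mono {1} {suc a} (s≤s z≤n) ⟩
    fromℕ (suc a)                     ≡⟨ e ⟨
    δ * fromℕ (suc d-1)               ∎
    where
    open ≤-Reasoning
    e : δ * fromℕ (suc d-1) ≡ fromℕ (suc a)
    e = toℚᵘ-injective (ℚᵘ.≃-trans (toℚᵘ-homo-* δ (fromℕ (suc d-1)))
      (ℚᵘ.≃-trans (ℚᵘ.*-cong (ℚᵘ.≃-refl {toℚᵘ δ}) (toℚᵘ-fromℕ (suc d-1)))
      (ℚᵘ.≃-trans (ℚᵘ.*≡* e′) (ℚᵘ.≃-sym (toℚᵘ-fromℕ (suc a))))))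
      where
      e′ : (+ suc a ℤ.* + suc d-1) ℤ.* + 1 ≡ + suc a ℤ.* + (suc d-1 ℕ.* 1)
      e′ = trans (ℤ.*-identityʳ _) (cong (λ z → + suc a ℤ.* + z) (sym (ℕ.*-identityʳ (suc d-1))))
  archimedean (mkℚ (+ zero) _ _) (*<* (ℤ.+<+ ()))
  archimedean (mkℚ (ℤ.-[1+ _ ]) _ _) (*<* ())

  -- Finite sums and powers of rationals

  ∑<-cong : ∀ m {f g} → (∀ i → i ℕ.< m → f i ≡ g i) → ∑< m f ≡ ∑< m g
  ∑<-cong zero    e = refl
  ∑<-cong (suc m) e = cong₂ _+_ (∑<-cong m (λ i i<m → e i (ℕ.m≤n⇒m≤1+n i<m))) (e m ℕ.≤-refl)

  ∑<-mono : ∀ m {f g} → (∀ i → f i ≤ g i) → ∑< m f ≤ ∑< m g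
  ∑<-mono zero    e = ≤-refl
  ∑<-mono (suc m) e = +-mono-≤ (∑<-mono m e) (e m)

  ∑<-mono-< : ∀ m {f g} → (∀ i → i ℕ.< m → f i ≤ g i) → ∑< m f ≤ ∑< m g
  ∑<-mono-< zero    e = ≤-refl
  ∑<-mono-< (suc m) e = +-mono-≤ (∑<-mono-< m (λ i i<m → e i (ℕ.m≤n⇒m≤1+n i<m))) (e m ℕ.≤-refl)

  ∑<-nonNeg : ∀ m {f} → (∀ i → 0ℚ ≤ f i) → 0ℚ ≤ ∑< m f
  ∑<-nonNeg zero    e = ≤-refl
  ∑<-nonNeg (suc m) e = +-nonNeg (∑<-nonNeg m e) (e m)

  ∑<-first : ∀ m {f} → (∀ i → 0ℚ ≤ f i) → f 0 ≤ ∑< (suc m) f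
  ∑<-first zero    {f} e = ≤-reflexive (sym (+-identityˡ (f 0)))
  ∑<-first (suc m) {f} e = ≤-trans (∑<-first m e) (≤-by (f (suc m)) (e (suc m)) refl)

  +-interchange : ∀ a b c d → (a + b) + (c + d) ≡ (a + c) + (b + d)
  +-interchange = solve-∀ ring

  ∑<-+ : ∀ m f g → ∑< m (λ i → f i + g i) ≡ ∑< m f + ∑< m g
  ∑<-+ zero    f g = refl
  ∑<-+ (suc m) f g = trans (cong (_+ (f m + g m)) (∑<-+ m f g)) (+-interchange (∑< m f) (∑< m g) (f m) (g m))

  ∑<-*ˡ : ∀ m a f → ∑< m (λ i → a * f i) ≡ a * ∑< m f
  ∑<-*ˡ zero    a f = sym (*-zeroʳ a)
  ∑<-*ˡ (suc m) a f = trans (cong (_+ a * f m) (∑<-*ˡ m a f)) (sym (*-distribˡ-+ a _ (f m)))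

  ∑<-*ʳ : ∀ m a f → ∑< m (λ i → f i * a) ≡ ∑< m f * a
  ∑<-*ʳ m a f = trans (∑<-cong m (λ i _ → *-comm (f i) a)) (trans (∑<-*ˡ m a f) (*-comm a _))

  ∣∑<∣ : ∀ m f → ∣ ∑< m f ∣ ≤ ∑< m (λ i → ∣ f i ∣)
  ∣∑<∣ zero    f = ≤-refl
  ∣∑<∣ (suc m) f = ≤-trans (∣p+q∣≤∣p∣+∣q∣ (∑< m f) (f m)) (+-monoˡ-≤ ∣ f m ∣ (∣∑<∣ m f))

  ^-nonNeg : ∀ {a} i → 0ℚ ≤ a → 0ℚ ≤ a ^ℚ i
  ^-nonNeg zero    0≤a = 0≤1
  ^-nonNeg (suc i) 0≤a = *-nonNeg 0≤a (^-nonNeg i 0≤a)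

  ^-mono : ∀ {a b} i → 0ℚ ≤ a → a ≤ b → a ^ℚ i ≤ b ^ℚ i
  ^-mono zero    0≤a a≤b = ≤-refl
  ^-mono (suc i) 0≤a a≤b = *-mono (^-nonNeg i 0≤a) (≤-trans 0≤a a≤b) a≤b (^-mono i 0≤a a≤b)

  ^-distrib-* : ∀ a b i → (a * b) ^ℚ i ≡ a ^ℚ i * b ^ℚ i
  ^-distrib-* a b zero    = refl
  ^-distrib-* a b (suc i) = trans (cong (a * b *_) (^-distrib-* a b i)) (e a b (a ^ℚ i) (b ^ℚ i))
    where
    e : ∀ a b c d → a * b * (c * d) ≡ a * c * (b * d)
    e = solve-∀ ring

  -- Mean value inequality for powers, with the derivative taken at the right end.
  ^-increment : ∀ {a u} i → 0ℚ ≤ a → 0ℚ ≤ u →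
    (a + u) ^ℚ suc i ≤ a ^ℚ suc i + fromℕ (suc i) * (u * (a + u) ^ℚ i)
  ^-increment {a} {u} zero    0≤a 0≤u = ≤-reflexive (e a u)
    where
    e : ∀ a u → (a + u) * 1ℚ ≡ a * 1ℚ + 1ℚ * (u * 1ℚ)
    e = solve-∀ ring
  ^-increment {a} {u} (suc i) 0≤a 0≤u = begin
    (a + u) * (a + u) ^ℚ suc i
      ≤⟨ *-monoʳ 0≤a+u (^-increment i 0≤a 0≤u) ⟩
    (a + u) * (a ^ℚ suc i + fromℕ (suc i) * (u * (a + u) ^ℚ i))
      ≡⟨ e₁ a u (a ^ℚ suc i) (fromℕ (suc i)) ((a + u) ^ℚ i) ⟩
    a * a ^ℚ suc i + (u * a ^ℚ suc i + fromℕ (suc i) * (u * (a + u) ^ℚ suc i))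
      ≤⟨ +-monoʳ-≤ (a * a ^ℚ suc i) (+-monoˡ-≤ _ (*-monoʳ 0≤u (^-mono (suc i) 0≤a (≤-by u 0≤u refl)))) ⟩
    a * a ^ℚ suc i + (u * (a + u) ^ℚ suc i + fromℕ (suc i) * (u * (a + u) ^ℚ suc i))
      ≡⟨ cong (λ z → a * a ^ℚ suc i + z) (e₂ (u * (a + u) ^ℚ suc i) (fromℕ (suc i))) ⟩
    a * a ^ℚ suc i + (1ℚ + fromℕ (suc i)) * (u * (a + u) ^ℚ suc i)
      ≡⟨ cong (λ z → a * a ^ℚ suc i + z * (u * (a + u) ^ℚ suc i)) (fromℕ-suc (suc i)) ⟨
    a * a ^ℚ suc i + fromℕ (suc (suc i)) * (u * (a + u) ^ℚ suc i) ∎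
    where
    open ≤-Reasoning
    0≤a+u = +-nonNeg 0≤a 0≤u
    e₁ : ∀ a u A c B → (a + u) * (A + c * (u * B)) ≡ a * A + (u * A + c * (u * ((a + u) * B)))
    e₁ = solve-∀ ring
    e₂ : ∀ x c → x + c * x ≡ (1ℚ + c) * x
    e₂ = solve-∀ ring

  -- The exponential series

  invFact : ℕ → ℚ
  invFact i = (+ 1 / (i !)) {{i !≢0}}

  term : ℚ → ℕ → ℚ
  term x i = x ^ℚ i * invFact i

  expSum : ℕ → ℚ → ℚ
  expSum m x = ∑< m (term x)

  0≤invFact : ∀ i → 0ℚ ≤ invFact i
  0≤invFact i = <⇒≤ (0<inv (i !) {{i !≢0}})

  invFact-suc : ∀ i → fromℕ (suc i) * invFact (suc i) ≡ invFact i
  invFact-suc i = begin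
    s * r′               ≡⟨ *-identityˡ (s * r′) ⟨
    1ℚ * (s * r′)        ≡⟨ cong (_* (s * r′)) (fromℕ*inv (i !) {{i !≢0}}) ⟨
    f * r * (s * r′)     ≡⟨ e f r s r′ ⟩
    r * (s * f * r′)     ≡⟨ cong (λ z → r * (z * r′)) (fromℕ-* (suc i) (i !)) ⟨
    r * (fromℕ (suc i !) * r′) ≡⟨ cong (r *_) (fromℕ*inv (suc i !) {{suc i !≢0}}) ⟩
    r * 1ℚ               ≡⟨ *-identityʳ r ⟩
    r                    ∎
    where
    open ≡-Reasoning
    s = fromℕ (suc i)
    f = fromℕ (i !)
    r = invFact i
    r′ = invFact (suc i)
    e : ∀ f r s r′ → f * r * (s * r′) ≡ r * (s * f * r′)
    e = solve-∀ ring

  term-nonNeg : ∀ {x} i → 0ℚ ≤ x → 0ℚ ≤ term x i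
  term-nonNeg i 0≤x = *-nonNeg (^-nonNeg i 0≤x) (0≤invFact i)

  term-suc : ∀ x i → fromℕ (suc i) * term x (suc i) ≡ x * term x i
  term-suc x i = trans (e (fromℕ (suc i)) x (x ^ℚ i) (invFact (suc i)))
    (cong (λ z → x * (x ^ℚ i * z)) (invFact-suc i))
    where
    e : ∀ s x X r → s * (x * X * r) ≡ x * (X * (s * r))
    e = solve-∀ ring

  expSum-nonNeg : ∀ m {x} → 0ℚ ≤ x → 0ℚ ≤ expSum m x
  expSum-nonNeg m 0≤x = ∑<-nonNeg m (λ i → term-nonNeg i 0≤x)

  expSum-mono : ∀ m {x y} → 0ℚ ≤ x → x ≤ y → expSum m x ≤ expSum m y
  expSum-mono m 0≤x x≤y = ∑<-mono m (λ i → *-monoˡ (0≤invFact i) (^-mono i 0≤x x≤y))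

  expSum-0 : ∀ m → expSum m 0ℚ ≤ 1ℚ
  expSum-0 zero          = 0≤1
  expSum-0 (suc zero)    = ≤-refl
  expSum-0 (suc (suc m)) = ≤-trans (≤-reflexive (e (expSum (suc m) 0ℚ) (0ℚ ^ℚ m) (invFact (suc m)))) (expSum-0 (suc m))
    where
    e : ∀ a X r → a + 0ℚ * X * r ≡ a
    e = solve-∀ ring

  -- `^-increment` summed over the series: the derivative of the sum of m + 1 terms is the sum of m
  -- terms.
  expSum-increment : ∀ m {a u} → 0ℚ ≤ a → 0ℚ ≤ u →
    expSum (suc m) (a + u) ≤ expSum (suc m) a + u * expSum m (a + u)
  expSum-increment zero    {a} {u} 0≤a 0≤u = ≤-by 0ℚ ≤-refl (e u)
    where
    e : ∀ u → 0ℚ + 1ℚ * 1ℚ + 0ℚ ≡ 0ℚ + 1ℚ * 1ℚ + u * 0ℚ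
    e = solve-∀ ring
  expSum-increment (suc m) {a} {u} 0≤a 0≤u = begin
    expSum (suc m) (a + u) + (a + u) ^ℚ suc m * r
      ≤⟨ +-mono-≤ (expSum-increment m 0≤a 0≤u) (*-monoˡ (0≤invFact (suc m)) (^-increment m 0≤a 0≤u)) ⟩
    expSum (suc m) a + u * expSum m (a + u) + (a ^ℚ suc m + fromℕ (suc m) * (u * (a + u) ^ℚ m)) * r
      ≡⟨ e₁ (expSum (suc m) a) u (expSum m (a + u)) (a ^ℚ suc m) (fromℕ (suc m)) ((a + u) ^ℚ m) r ⟩
    expSum (suc m) a + a ^ℚ suc m * r + u * (expSum m (a + u) + (a + u) ^ℚ m * (fromℕ (suc m) * r))
      ≡⟨ cong (λ z → expSum (suc m) a + a ^ℚ suc m * r + u * (expSum m (a + u) + (a + u) ^ℚ m * z)) (invFact-suc m) ⟩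
    expSum (suc (suc m)) a + u * expSum (suc m) (a + u) ∎
    where
    open ≤-Reasoning
    r = invFact (suc m)
    e₁ : ∀ A u B X s Y r → A + u * B + (X + s * (u * Y)) * r ≡ A + X * r + u * (B + Y * (s * r))
    e₁ = solve-∀ ring

  -- The truncated form of exp u ≤ 1 / (1 - u). Truncations do not satisfy exp (a + u) = exp a exp
  -- u, so it is derived from `expSum-increment`, the missing top term being added to the
  -- derivative.
  expSum-shift : ∀ m {a u} → 0ℚ ≤ a → 0ℚ ≤ u → (1ℚ - u) * expSum m (a + u) ≤ expSum m a
  expSum-shift zero    {a} {u} 0≤a 0≤u = ≤-reflexive (*-zeroʳ (1ℚ - u))
  expSum-shift (suc m) {a} {u} 0≤a 0≤u = ≤-diff (≤-trans (0≤-diff (≤-trans (expSum-increment m 0≤a 0≤u)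
      (+-monoʳ-≤ (expSum (suc m) a) (*-monoʳ 0≤u (≤-by (term (a + u) m) (term-nonNeg m (+-nonNeg 0≤a 0≤u)) refl)))))
    (≤-reflexive (e (expSum (suc m) a) u (expSum (suc m) (a + u)))))
    where
    e : ∀ A u B → A + u * B - B ≡ A - (1ℚ - u) * B
    e = solve-∀ ring

  inv : ∀ N .{{_ : ℕ.NonZero N}} → ℚ
  inv N = + 1 / N

  -- exp (1/N) ≤ (1 - 1/N)⁻¹ with N = 1 + M, iterated.
  expSum-≤ : ∀ m M b {y} → 0ℚ ≤ y → y ≤ fromℕ b * inv (suc M) →
    fromℕ (M ℕ.^ b) * expSum m y ≤ fromℕ (suc M ℕ.^ b)
  expSum-≤ m M b {y} 0≤y y≤ = ≤-trans (*-monoʳ (0≤fromℕ (M ℕ.^ b)) (expSum-mono m 0≤y y≤)) (go b)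
    where
    open ≤-Reasoning
    N = suc M
    u = inv N
    0≤u : 0ℚ ≤ u
    0≤u = <⇒≤ (0<inv N)
    e₀ : ∀ a u → a * u + u ≡ (1ℚ + a) * u
    e₀ = solve-∀ ring
    e₁ : ∀ N u → N * (1ℚ - u) ≡ N - N * u
    e₁ = solve-∀ ring
    e₂ : ∀ M → 1ℚ + M - 1ℚ ≡ M
    e₂ = solve-∀ ring
    e₃ : ∀ P N v E → N * v * P * E ≡ N * (P * (v * E))
    e₃ = solve-∀ ring
    M≡ : fromℕ N * (1ℚ - u) ≡ fromℕ M
    M≡ = trans (e₁ (fromℕ N) u) (trans (cong₂ _-_ (fromℕ-suc M) (fromℕ*inv N)) (e₂ (fromℕ M)))
    go : ∀ b → fromℕ (M ℕ.^ b) * expSum m (fromℕ b * u) ≤ fromℕ (N ℕ.^ b)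
    go zero    = begin
      1ℚ * expSum m (0ℚ * u) ≡⟨ cong (λ z → 1ℚ * expSum m z) (*-zeroˡ u) ⟩
      1ℚ * expSum m 0ℚ       ≡⟨ *-identityˡ _ ⟩
      expSum m 0ℚ            ≤⟨ expSum-0 m ⟩
      1ℚ                     ∎
    go (suc b) = begin
      fromℕ (M ℕ.* M ℕ.^ b) * expSum m (fromℕ (suc b) * u)
        ≡⟨ cong₂ (λ x y → x * expSum m y) (trans (fromℕ-* M (M ℕ.^ b)) (cong (_* P) (sym M≡)))
                 (trans (cong (_* u) (fromℕ-suc b)) (sym (e₀ (fromℕ b) u))) ⟩
      fromℕ N * (1ℚ - u) * P * expSum m (fromℕ b * u + u)
        ≡⟨ e₃ P (fromℕ N) (1ℚ - u) (expSum m (fromℕ b * u + u)) ⟩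
      fromℕ N * (P * ((1ℚ - u) * expSum m (fromℕ b * u + u)))
        ≤⟨ *-monoʳ (0≤fromℕ N) (*-monoʳ (0≤fromℕ (M ℕ.^ b)) (expSum-shift m (*-nonNeg (0≤fromℕ b) 0≤u) 0≤u)) ⟩
      fromℕ N * (P * expSum m (fromℕ b * u)) ≤⟨ *-monoʳ (0≤fromℕ N) (go b) ⟩
      fromℕ N * fromℕ (N ℕ.^ b)              ≡⟨ fromℕ-* N (N ℕ.^ b) ⟨
      fromℕ (N ℕ.* N ℕ.^ b)                  ∎
      where P = fromℕ (M ℕ.^ b)

  -- The Cauchy product of the series of exp y and exp (- y): each coefficient of positive degree s, multiplied by s,
  -- is a telescoping sum.
  module _ (y : ℚ) where

    private
      f g : ℕ → ℚ
      f = term (- y)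
      g = term y

      conv : ℕ → ℚ
      conv s = ∑< (suc s) (λ j → f j * g (s ℕ.∸ j))

      split : ∀ t s → t ℕ.≤ s → fromℕ s ≡ fromℕ t + fromℕ (s ℕ.∸ t)
      split t s t≤s = trans (cong fromℕ (sym (ℕ.m+[n∸m]≡n t≤s))) (fromℕ-+ t (s ℕ.∸ t))

      -- Write s = j + (s - j) in the summand j. By `term-suc`, j f_j = -y f_(j-1) and (s - j)
      -- g_(s-j) = y g_(s-j-1), so neighbouring contributions cancel.
      telescope : ∀ s t → t ℕ.< s →
        fromℕ s * ∑< (suc t) (λ j → f j * g (s ℕ.∸ j)) ≡ y * (f t * g (s ℕ.∸ suc t))
      telescope (suc s) zero t<s = begin
        fromℕ (suc s) * (0ℚ + 1ℚ * 1ℚ * g (suc s)) ≡⟨ e₁ (fromℕ (suc s)) (g (suc s)) ⟩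
        fromℕ (suc s) * g (suc s)                  ≡⟨ term-suc y s ⟩
        y * g s                                    ≡⟨ e₂ y (g s) ⟩
        y * (1ℚ * 1ℚ * g s)                        ∎
        where
        open ≡-Reasoning
        e₁ : ∀ a b → a * (0ℚ + 1ℚ * 1ℚ * b) ≡ a * b
        e₁ = solve-∀ ring
        e₂ : ∀ a b → a * b ≡ a * (1ℚ * 1ℚ * b)
        e₂ = solve-∀ ring
      telescope s (suc t) t<s = begin
        fromℕ s * (S + f (suc t) * g (s ℕ.∸ suc t))
          ≡⟨ *-distribˡ-+ (fromℕ s) S _ ⟩
        fromℕ s * S + fromℕ s * (f (suc t) * g (s ℕ.∸ suc t))
          ≡⟨ cong₂ _+_ (telescope s t (ℕ.<-trans (ℕ.n<1+n t) t<s)) (cong (_* (f (suc t) * g (s ℕ.∸ suc t))) (split (suc t) s (ℕ.<⇒≤ t<s))) ⟩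
        y * (f t * g (s ℕ.∸ suc t)) + (fromℕ (suc t) + fromℕ (s ℕ.∸ suc t)) * (f (suc t) * g (s ℕ.∸ suc t))
          ≡⟨ cong (λ q → y * (f t * g q) + (fromℕ (suc t) + fromℕ q) * (f (suc t) * g q)) q≡ ⟩
        y * (f t * g (suc q)) + (fromℕ (suc t) + fromℕ (suc q)) * (f (suc t) * g (suc q))
          ≡⟨ e₁ y (f t) (g (suc q)) (fromℕ (suc t)) (fromℕ (suc q)) (f (suc t)) ⟩
        (y * f t + fromℕ (suc t) * f (suc t)) * g (suc q) + f (suc t) * (fromℕ (suc q) * g (suc q))
          ≡⟨ cong₂ (λ a b → (y * f t + a) * g (suc q) + f (suc t) * b) (term-suc (- y) t) (term-suc y q) ⟩
        (y * f t + - y * f t) * g (suc q) + f (suc t) * (y * g q)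
          ≡⟨ e₂ y (f t) (g (suc q)) (f (suc t)) (g q) ⟩
        y * (f (suc t) * g q) ∎
        where
        open ≡-Reasoning
        S = ∑< (suc t) (λ j → f j * g (s ℕ.∸ j))
        q = s ℕ.∸ suc (suc t)
        q≡ : s ℕ.∸ suc t ≡ suc q
        q≡ = trans (sym (ℕ.suc-pred (s ℕ.∸ suc t) {{ℕ.>-nonZero (ℕ.m<n⇒0<n∸m t<s)}})) (cong suc (ℕ.pred[m∸n]≡m∸[1+n] s (suc t)))
        e₁ : ∀ y a b t q c → y * (a * b) + (t + q) * (c * b) ≡ (y * a + t * c) * b + c * (q * b)
        e₁ = solve-∀ ring
        e₂ : ∀ y a b c d → (y * a + - y * a) * b + c * (y * d) ≡ y * (c * d)
        e₂ = solve-∀ ring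

      conv-0 : conv 0 ≡ 1ℚ
      conv-0 = refl

      -- `telescope` stops before the last summand, whose multiple by s + 1 is exactly the negative
      -- of what is left over.
      conv-suc : ∀ s → conv (suc s) ≡ 0ℚ
      conv-suc s = *-cancelˡ-≡ (begin
        n * (S + f (suc s) * g (s ℕ.∸ s))      ≡⟨ cong (λ q → n * (S + f (suc s) * g q)) (ℕ.n∸n≡0 s) ⟩
        n * (S + f (suc s) * (1ℚ * 1ℚ))        ≡⟨ e₁ n S (f (suc s)) ⟩
        n * S + n * f (suc s)                  ≡⟨ cong₂ _+_ (telescope (suc s) s ℕ.≤-refl) (term-suc (- y) s) ⟩
        y * (f s * g (s ℕ.∸ s)) + - y * f s    ≡⟨ cong (λ q → y * (f s * g q) + - y * f s) (ℕ.n∸n≡0 s) ⟩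
        y * (f s * (1ℚ * 1ℚ)) + - y * f s      ≡⟨ e₂ y (f s) ⟩
        0ℚ                                     ≡⟨ *-zeroʳ n ⟨
        n * 0ℚ                                 ∎)
        where
        open ≡-Reasoning
        n = fromℕ (suc s)
        S = ∑< (suc s) (λ j → f j * g (suc s ℕ.∸ j))
        *-cancelˡ-≡ : ∀ {p q} → n * p ≡ n * q → p ≡ q
        *-cancelˡ-≡ e = ≤-antisym (*-cancelˡ (0<fromℕ (suc s)) (≤-reflexive e)) (*-cancelˡ (0<fromℕ (suc s)) (≤-reflexive (sym e)))
        e₁ : ∀ n S x → n * (S + x * (1ℚ * 1ℚ)) ≡ n * S + n * x
        e₁ = solve-∀ ring
        e₂ : ∀ y x → y * (x * (1ℚ * 1ℚ)) + - y * x ≡ 0ℚ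
        e₂ = solve-∀ ring

      -- Summation of f_j g_i over i + j ≤ m by antidiagonals, of which only the one of degree 0
      -- contributes.
      triangle : ∀ m → ∑< (suc m) (λ j → f j * expSum (suc m ℕ.∸ j) y) ≡ 1ℚ
      triangle m = begin
        ∑< (suc m) (λ j → f j * expSum (suc m ℕ.∸ j) y)
          ≡⟨ ∑<-cong (suc m) (λ j j≤m → trans (cong (λ q → f j * expSum q y) (ℕ.+-∸-assoc 1 (ℕ.≤-pred j≤m))) (*-distribˡ-+ (f j) _ _)) ⟩
        ∑< (suc m) (λ j → f j * expSum (m ℕ.∸ j) y + f j * g (m ℕ.∸ j))
          ≡⟨ ∑<-+ (suc m) _ _ ⟩
        ∑< m (λ j → f j * expSum (m ℕ.∸ j) y) + f m * expSum (m ℕ.∸ m) y + conv m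
          ≡⟨ cong (λ q → ∑< m (λ j → f j * expSum (m ℕ.∸ j) y) + f m * expSum q y + conv m) (ℕ.n∸n≡0 m) ⟩
        ∑< m (λ j → f j * expSum (m ℕ.∸ j) y) + f m * 0ℚ + conv m
          ≡⟨ e₁ (∑< m (λ j → f j * expSum (m ℕ.∸ j) y)) (f m) (conv m) ⟩
        ∑< m (λ j → f j * expSum (m ℕ.∸ j) y) + conv m
          ≡⟨ last m ⟩
        1ℚ ∎
        where
        open ≡-Reasoning
        e₁ : ∀ a b c → a + b * 0ℚ + c ≡ a + c
        e₁ = solve-∀ ring
        last : ∀ m → ∑< m (λ j → f j * expSum (m ℕ.∸ j) y) + conv m ≡ 1ℚ
        last zero    = trans (+-identityˡ (conv 0)) conv-0
        last (suc m) = trans (cong₂ _+_ (triangle m) (conv-suc m)) (+-identityʳ 1ℚ)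

      two : ℚ
      two = fromℕ 2

      doubled-term : ∀ j → two ^ℚ j * g j ≡ term (two * y) j
      doubled-term j = trans (sym (*-assoc (two ^ℚ j) (y ^ℚ j) (invFact j))) (cong (_* invFact j) (sym (^-distrib-* two y j)))

      0≤two : 0ℚ ≤ two
      0≤two = 0≤fromℕ 2

      ^ℚ-+ : ∀ a i j → a ^ℚ (i ℕ.+ j) ≡ a ^ℚ i * a ^ℚ j
      ^ℚ-+ a zero    j = sym (*-identityˡ _)
      ^ℚ-+ a (suc i) j = trans (cong (a *_) (^ℚ-+ a i j)) (sym (*-assoc a (a ^ℚ i) (a ^ℚ j)))

      1≤2^ : ∀ i → 1ℚ ≤ two ^ℚ i
      1≤2^ i = subst (1ℚ ≤_) (fromℕ-^ 2 i) (1≤fromℕ (2 ℕ.^ i) {{ℕ.m^n≢0 2 i}})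

      -- Doubling y multiplies a term of degree i ≥ p by 2^i ≥ 2^p.
      tail : 0ℚ ≤ y → ∀ p j → two ^ℚ p * (expSum (j ℕ.+ p) y - expSum p y) ≤ expSum (j ℕ.+ p) (two * y) - expSum p (two * y)
      tail 0≤y p zero    = ≤-reflexive (e (two ^ℚ p) (expSum p y) (expSum p (two * y)))
        where
        e : ∀ a b c → a * (b - b) ≡ c - c
        e = solve-∀ ring
      tail 0≤y p (suc j) = begin
        two ^ℚ p * (expSum (j ℕ.+ p) y + g (j ℕ.+ p) - expSum p y)
          ≡⟨ e₁ (two ^ℚ p) (expSum (j ℕ.+ p) y) (g (j ℕ.+ p)) (expSum p y) ⟩
        two ^ℚ p * (expSum (j ℕ.+ p) y - expSum p y) + two ^ℚ p * g (j ℕ.+ p)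
          ≤⟨ +-mono-≤ (tail 0≤y p j) (*-monoˡ (term-nonNeg (j ℕ.+ p) 0≤y) pow) ⟩
        expSum (j ℕ.+ p) (two * y) - expSum p (two * y) + two ^ℚ (j ℕ.+ p) * g (j ℕ.+ p)
          ≡⟨ cong (λ z → expSum (j ℕ.+ p) (two * y) - expSum p (two * y) + z) (doubled-term (j ℕ.+ p)) ⟩
        expSum (j ℕ.+ p) (two * y) - expSum p (two * y) + term (two * y) (j ℕ.+ p)
          ≡⟨ e₂ (expSum (j ℕ.+ p) (two * y)) (expSum p (two * y)) (term (two * y) (j ℕ.+ p)) ⟩
        expSum (j ℕ.+ p) (two * y) + term (two * y) (j ℕ.+ p) - expSum p (two * y) ∎
        where
        open ≤-Reasoning
        e₁ : ∀ a b c d → a * (b + c - d) ≡ a * (b - d) + a * c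
        e₁ = solve-∀ ring
        e₂ : ∀ a b c → a - b + c ≡ a + c - b
        e₂ = solve-∀ ring
        pow : two ^ℚ p ≤ two ^ℚ (j ℕ.+ p)
        pow = ≤-trans (≤-reflexive (sym (*-identityˡ _)))
                (≤-trans (*-monoˡ (^-nonNeg p 0≤two) (1≤2^ j)) (≤-reflexive (sym (^ℚ-+ two j p))))

      ∣^∣ : 0ℚ ≤ y → ∀ j → ∣ (- y) ^ℚ j ∣ ≡ y ^ℚ j
      ∣^∣ 0≤y zero    = refl
      ∣^∣ 0≤y (suc j) = trans (∣p*q∣≡∣p∣*∣q∣ (- y) ((- y) ^ℚ j)) (cong₂ _*_ (trans (∣-p∣≡∣p∣ y) (0≤p⇒∣p∣≡p 0≤y)) (∣^∣ 0≤y j))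

      ∣f∣ : 0ℚ ≤ y → ∀ j → ∣ f j ∣ ≡ g j
      ∣f∣ 0≤y j = trans (∣p*q∣≡∣p∣*∣q∣ ((- y) ^ℚ j) (invFact j)) (cong₂ _*_ (∣^∣ 0≤y j) (0≤p⇒∣p∣≡p (0≤invFact j)))

    -- By `triangle` the error consists of the products of total degree at least m′ within the
    -- square of indices. Passing from y to 2 y enlarges them by 2^m′ or more, and in absolute value
    -- they are then bounded by the whole square.
    expSum-inverse : 0ℚ ≤ y → ∀ m → let m′ = suc m in
      fromℕ (2 ℕ.^ m′) * ∣ expSum m′ (- y) * expSum m′ y - 1ℚ ∣ ≤ expSum m′ (two * y) * expSum m′ (two * y)
    expSum-inverse 0≤y m = begin
      fromℕ (2 ℕ.^ m′) * ∣ E⁻ * E - 1ℚ ∣          ≡⟨ cong (λ z → fromℕ (2 ℕ.^ m′) * ∣ z ∣) remainder ⟩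
      fromℕ (2 ℕ.^ m′) * ∣ ∑< m′ (λ j → f j * D j) ∣ ≤⟨ *-monoʳ (0≤fromℕ (2 ℕ.^ m′)) (∣∑<∣ m′ (λ j → f j * D j)) ⟩
      fromℕ (2 ℕ.^ m′) * ∑< m′ (λ j → ∣ f j * D j ∣) ≡⟨ ∑<-*ˡ m′ (fromℕ (2 ℕ.^ m′)) (λ j → ∣ f j * D j ∣) ⟨
      ∑< m′ (λ j → fromℕ (2 ℕ.^ m′) * ∣ f j * D j ∣) ≤⟨ ∑<-mono-< m′ (λ j j<m′ → bound j (ℕ.<⇒≤ j<m′)) ⟩
      ∑< m′ (λ j → term Y j * expSum m′ Y)         ≡⟨ ∑<-*ʳ m′ (expSum m′ Y) (term Y) ⟩
      expSum m′ Y * expSum m′ Y                    ∎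
      where
      open ≤-Reasoning
      m′ = suc m
      Y = two * y
      E⁻ = expSum m′ (- y)
      E = expSum m′ y
      D : ℕ → ℚ
      D j = E - expSum (m′ ℕ.∸ j) y
      0≤Y : 0ℚ ≤ Y
      0≤Y = *-nonNeg 0≤two 0≤y
      remainder : E⁻ * E - 1ℚ ≡ ∑< m′ (λ j → f j * D j)
      remainder = begin-equality
        E⁻ * E - 1ℚ
          ≡⟨ cong₂ _-_ (sym (∑<-*ʳ m′ E f)) (sym (triangle m)) ⟩
        ∑< m′ (λ j → f j * E) - T
          ≡⟨ cong (_- T) (∑<-cong m′ (λ j _ → e₁ (f j) E (expSum (m′ ℕ.∸ j) y))) ⟩
        ∑< m′ (λ j → f j * D j + f j * expSum (m′ ℕ.∸ j) y) - T
          ≡⟨ cong (_- T) (∑<-+ m′ (λ j → f j * D j) (λ j → f j * expSum (m′ ℕ.∸ j) y)) ⟩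
        ∑< m′ (λ j → f j * D j) + T - T
          ≡⟨ e₂ (∑< m′ (λ j → f j * D j)) T ⟩
        ∑< m′ (λ j → f j * D j) ∎
        where
        T = ∑< m′ (λ j → f j * expSum (m′ ℕ.∸ j) y)
        e₁ : ∀ a b c → a * b ≡ a * (b - c) + a * c
        e₁ = solve-∀ ring
        e₂ : ∀ a b → a + b - b ≡ a
        e₂ = solve-∀ ring
      bound : ∀ j → j ℕ.≤ m′ → fromℕ (2 ℕ.^ m′) * ∣ f j * D j ∣ ≤ term Y j * expSum m′ Y
      bound j j≤m′ = begin
        fromℕ (2 ℕ.^ m′) * ∣ f j * D j ∣
          ≡⟨ cong₂ _*_ pow (trans (∣p*q∣≡∣p∣*∣q∣ (f j) (D j)) (cong₂ _*_ (∣f∣ 0≤y j) (0≤p⇒∣p∣≡p 0≤D))) ⟩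
        two ^ℚ j * two ^ℚ p * (g j * D j)
          ≡⟨ e₁ (two ^ℚ j) (two ^ℚ p) (g j) (D j) ⟩
        two ^ℚ j * g j * (two ^ℚ p * D j)
          ≡⟨ cong (_* (two ^ℚ p * D j)) (doubled-term j) ⟩
        term Y j * (two ^ℚ p * D j)
          ≤⟨ *-monoʳ (term-nonNeg j 0≤Y) tail′ ⟩
        term Y j * expSum m′ Y ∎
        where
        p = m′ ℕ.∸ j
        j+p : j ℕ.+ p ≡ m′
        j+p = ℕ.m+[n∸m]≡n j≤m′
        pow : fromℕ (2 ℕ.^ m′) ≡ two ^ℚ j * two ^ℚ p
        pow = trans (fromℕ-^ 2 m′) (trans (cong (two ^ℚ_) (sym j+p)) (^ℚ-+ two j p))
        e₁ : ∀ a b c d → a * b * (c * d) ≡ a * c * (b * d)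
        e₁ = solve-∀ ring
        prefix : ∀ i → expSum p y ≤ expSum (i ℕ.+ p) y
        prefix zero    = ≤-refl
        prefix (suc i) = ≤-trans (prefix i) (≤-by (g (i ℕ.+ p)) (term-nonNeg (i ℕ.+ p) 0≤y) refl)
        0≤D : 0ℚ ≤ D j
        0≤D = 0≤-diff (subst (λ q → expSum p y ≤ expSum q y) j+p (prefix j))
        tail′ : two ^ℚ p * D j ≤ expSum m′ Y
        tail′ = ≤-trans (subst (λ q → two ^ℚ p * (expSum q y - expSum p y) ≤ expSum q Y - expSum p Y) j+p (tail 0≤y p j))
                  (≤-by (expSum p Y) (expSum-nonNeg p 0≤Y) (e₂ (expSum m′ Y) (expSum p Y)))
          where
          e₂ : ∀ a b → a - b + b ≡ a
          e₂ = solve-∀ ring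

  -- The logarithm series

  cayley : ℚ → ℚ
  cayley x = (x - 1ℚ) * recip (x + 1ℚ)

  odd : ℕ → ℕ
  odd i = suc (2 ℕ.* i)

  artanhSum : ℕ → ℚ → ℚ
  artanhSum m z = ∑< m (λ i → z ^ℚ odd i * inv (odd i))

  logSum : ℕ → ℚ → ℚ
  logSum m x = fromℕ 2 * artanhSum m (cayley x)

  0≤inv : ∀ d .{{_ : ℕ.NonZero d}} → 0ℚ ≤ inv d
  0≤inv d = <⇒≤ (0<inv d)

  artanhSum-mono : ∀ m {z z′} → 0ℚ ≤ z → z ≤ z′ → artanhSum m z ≤ artanhSum m z′
  artanhSum-mono m 0≤z z≤z′ = ∑<-mono m (λ i → *-monoˡ (0≤inv (odd i)) (^-mono (odd i) 0≤z z≤z′))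

  geometric : ∀ m z → (1ℚ - z * z) * ∑< m (λ i → z ^ℚ (2 ℕ.* i)) + z ^ℚ (2 ℕ.* m) ≡ 1ℚ
  geometric zero    z = e z
    where
    e : ∀ z → (1ℚ - z * z) * 0ℚ + 1ℚ ≡ 1ℚ
    e = solve-∀ ring
  geometric (suc m) z = begin
    (1ℚ - z * z) * (S + Z) + z ^ℚ (2 ℕ.* suc m) ≡⟨ cong (λ q → (1ℚ - z * z) * (S + Z) + z ^ℚ q) (ℕ.*-suc 2 m) ⟩
    (1ℚ - z * z) * (S + Z) + z * (z * Z)        ≡⟨ e z S Z ⟩
    (1ℚ - z * z) * S + Z                        ≡⟨ geometric m z ⟩
    1ℚ                                          ∎
    where
    open ≡-Reasoning
    S = ∑< m (λ i → z ^ℚ (2 ℕ.* i))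
    Z = z ^ℚ (2 ℕ.* m)
    e : ∀ z S Z → (1ℚ - z * z) * (S + Z) + z * (z * Z) ≡ (1ℚ - z * z) * S + Z
    e = solve-∀ ring

  -- Mean value inequality with the derivative, a sum of even powers, at the right end z + w; by
  -- `geometric` its product with 1 - (z + w)² is at most 1.
  artanhSum-increment : ∀ m {z w} → 0ℚ ≤ z → 0ℚ ≤ w →
    (z + w) * (z + w) ≤ 1ℚ →
    (1ℚ - (z + w) * (z + w)) * (artanhSum m (z + w) - artanhSum m z) ≤ w
  artanhSum-increment m {z} {w} 0≤z 0≤w ≤1 = begin
    (1ℚ - z′ * z′) * (artanhSum m z′ - artanhSum m z)
      ≤⟨ *-monoʳ (0≤-diff ≤1) (≤-diff (≤-trans (0≤-diff sums) (≤-reflexive (e₁ (artanhSum m z) (w * S) (artanhSum m z′))))) ⟩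
    (1ℚ - z′ * z′) * (w * S)
      ≡⟨ e₂ (1ℚ - z′ * z′) w S ⟩
    w * ((1ℚ - z′ * z′) * S)
      ≤⟨ *-monoʳ 0≤w (≤-by (z′ ^ℚ (2 ℕ.* m)) (^-nonNeg (2 ℕ.* m) 0≤z′) (geometric m z′)) ⟩
    w * 1ℚ ≡⟨ *-identityʳ w ⟩
    w ∎
    where
    open ≤-Reasoning
    z′ = z + w
    0≤z′ : 0ℚ ≤ z′
    0≤z′ = +-nonNeg 0≤z 0≤w
    S = ∑< m (λ i → z′ ^ℚ (2 ℕ.* i))
    e₁ : ∀ a b c → a + b - c ≡ b - (c - a)
    e₁ = solve-∀ ring
    e₂ : ∀ a b c → a * (b * c) ≡ b * (a * c)
    e₂ = solve-∀ ring
    e₃ : ∀ Z s w X r → (Z + s * (w * X)) * r ≡ Z * r + s * r * (w * X)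
    e₃ = solve-∀ ring
    summand : ∀ i → z′ ^ℚ odd i * inv (odd i) ≤ z ^ℚ odd i * inv (odd i) + w * z′ ^ℚ (2 ℕ.* i)
    summand i = begin
      z′ ^ℚ odd i * inv (odd i)
        ≤⟨ *-monoˡ (0≤inv (odd i)) (^-increment (2 ℕ.* i) 0≤z 0≤w) ⟩
      (z ^ℚ odd i + fromℕ (odd i) * (w * z′ ^ℚ (2 ℕ.* i))) * inv (odd i)
        ≡⟨ e₃ (z ^ℚ odd i) (fromℕ (odd i)) w (z′ ^ℚ (2 ℕ.* i)) (inv (odd i)) ⟩
      z ^ℚ odd i * inv (odd i) + fromℕ (odd i) * inv (odd i) * (w * z′ ^ℚ (2 ℕ.* i))
        ≡⟨ cong (λ q → z ^ℚ odd i * inv (odd i) + q) (trans (cong (_* (w * z′ ^ℚ (2 ℕ.* i))) (fromℕ*inv (odd i))) (*-identityˡ _)) ⟩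
      z ^ℚ odd i * inv (odd i) + w * z′ ^ℚ (2 ℕ.* i) ∎
    sums : artanhSum m z′ ≤ artanhSum m z + w * S
    sums = begin
      artanhSum m z′ ≤⟨ ∑<-mono m summand ⟩
      ∑< m (λ i → z ^ℚ odd i * inv (odd i) + w * z′ ^ℚ (2 ℕ.* i)) ≡⟨ ∑<-+ m _ _ ⟩
      artanhSum m z + ∑< m (λ i → w * z′ ^ℚ (2 ℕ.* i)) ≡⟨ cong (λ q → artanhSum m z + q) (∑<-*ˡ m w _) ⟩
      artanhSum m z + w * S ∎

  -- In terms of p = 1 / (x + 1) both (x - 1) / (x + 1) = 1 - 2 p and x / (x + 1) = 1 - p are
  -- affine.
  module Cayley {x} (1≤x : 1ℚ ≤ x) where
    0≤x : 0ℚ ≤ x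
    0≤x = ≤-trans 0≤1 1≤x
    0<x : 0ℚ < x
    0<x = <-≤-trans 0<1 1≤x
    0<x+1 : 0ℚ < x + 1ℚ
    0<x+1 = <-≤-trans 0<1 (≤-trans (≤-reflexive (sym (+-identityˡ 1ℚ))) (+-monoˡ-≤ 1ℚ 0≤x))
    p : ℚ
    p = recip (x + 1ℚ)
    inverse : (x + 1ℚ) * p ≡ 1ℚ
    inverse = recip-inverse 0<x+1
    0<p : 0ℚ < p
    0<p = 0<recip 0<x+1
    0≤p : 0ℚ ≤ p
    0≤p = <⇒≤ 0<p
    z≡ : cayley x ≡ 1ℚ - fromℕ 2 * p
    z≡ = trans (e x p) (cong (_- fromℕ 2 * p) inverse)
      where
      e : ∀ x p → (x - 1ℚ) * p ≡ (x + 1ℚ) * p - (1ℚ + 1ℚ) * p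
      e = solve-∀ ring
    xp : x * p ≡ 1ℚ - p
    xp = trans (e x p) (cong (_- p) inverse)
      where
      e : ∀ x p → x * p ≡ (x + 1ℚ) * p - p
      e = solve-∀ ring
    0≤z : 0ℚ ≤ cayley x
    0≤z = *-nonNeg (0≤-diff 1≤x) 0≤p

  cayley-mono : ∀ {x x′} → 1ℚ ≤ x → x ≤ x′ → recip (x′ + 1ℚ) ≤ recip (x + 1ℚ) × cayley x ≤ cayley x′
  cayley-mono {x} {x′} 1≤x x≤x′ = p′≤p , ≤-trans (≤-reflexive X.z≡) (≤-trans
      (+-monoʳ-≤ 1ℚ (neg-antimono-≤ (*-monoʳ (0≤fromℕ 2) p′≤p))) (≤-reflexive (sym X′.z≡)))
    where
    module X = Cayley 1≤x
    module X′ = Cayley (≤-trans 1≤x x≤x′)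
    open ≤-Reasoning
    p′≤p : X′.p ≤ X.p
    p′≤p = begin
      X′.p                       ≡⟨ trans (cong (X′.p *_) X.inverse) (*-identityʳ X′.p) ⟨
      X′.p * ((x + 1ℚ) * X.p)    ≤⟨ *-monoʳ X′.0≤p (*-monoˡ X.0≤p (+-monoˡ-≤ 1ℚ x≤x′)) ⟩
      X′.p * ((x′ + 1ℚ) * X.p)   ≡⟨ e X′.p (x′ + 1ℚ) X.p ⟩
      (x′ + 1ℚ) * X′.p * X.p     ≡⟨ trans (cong (_* X.p) X′.inverse) (*-identityˡ X.p) ⟩
      X.p                        ∎
      where
      e : ∀ a b c → a * (b * c) ≡ b * a * c
      e = solve-∀ ring

  logSum-mono : ∀ m {x x′} → 1ℚ ≤ x → x ≤ x′ → logSum m x ≤ logSum m x′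
  logSum-mono m 1≤x x≤x′ = *-monoʳ (0≤fromℕ 2) (artanhSum-mono m (Cayley.0≤z 1≤x) (proj₂ (cayley-mono 1≤x x≤x′)))

  -- The derivative of the series in z is at most 1 / (1 - z²), and 1 - z² = 4 p (1 - p) for p = 1 / (x + 1).
  logSum-scale : ∀ m {x x′ u} → 1ℚ ≤ x → x ≤ x′ → x′ ≤ x + u * x → 0ℚ ≤ u → logSum m x′ ≤ logSum m x + u
  logSum-scale m {x} {x′} {u} 1≤x x≤x′ x′≤ 0≤u = ≤-diff (≤-trans (0≤-diff scaled) (≤-reflexive (e₀ (artanhSum m z′) (artanhSum m z) u)))
    where
    open ≤-Reasoning
    module X = Cayley 1≤x
    module X′ = Cayley (≤-trans 1≤x x≤x′)
    p = X.p
    p′ = X′.p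
    z = cayley x
    z′ = cayley x′
    w = z′ - z
    2ℚ = fromℕ 2
    p′≤p : p′ ≤ p
    p′≤p = proj₁ (cayley-mono 1≤x x≤x′)
    z+w : z + w ≡ z′
    z+w = e z z′
      where
      e : ∀ a b → a + (b - a) ≡ b
      e = solve-∀ ring
    e₀ : ∀ a b u → u - (1ℚ + 1ℚ) * (a - b) ≡ (1ℚ + 1ℚ) * b + u - (1ℚ + 1ℚ) * a
    e₀ = solve-∀ ring
    K = 2ℚ * 2ℚ * (p′ * (1ℚ - p′))
    1-z² : 1ℚ - z′ * z′ ≡ K
    1-z² = trans (cong (λ q → 1ℚ - q * q) X′.z≡) (e p′)
      where
      e : ∀ p → 1ℚ - (1ℚ - (1ℚ + 1ℚ) * p) * (1ℚ - (1ℚ + 1ℚ) * p) ≡ (1ℚ + 1ℚ) * (1ℚ + 1ℚ) * (p * (1ℚ - p))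
      e = solve-∀ ring
    0<1-p′ : 0ℚ < 1ℚ - p′
    0<1-p′ = subst (0ℚ <_) X′.xp (*-pos X′.0<x X′.0<p)
    0<K : 0ℚ < K
    0<K = *-pos (*-pos (0<fromℕ 2) (0<fromℕ 2)) (*-pos X′.0<p 0<1-p′)
    inc : K * (artanhSum m z′ - artanhSum m z) ≤ w
    inc = subst₂ (λ k q → k * (artanhSum m q - artanhSum m z) ≤ w) 1-z² z+w
      (subst (λ q → (1ℚ - q * q) * (artanhSum m (z + w) - artanhSum m z) ≤ w) z+w
        (artanhSum-increment m X.0≤z (0≤-diff (proj₂ (cayley-mono 1≤x x≤x′)))
          (subst (λ q → q * q ≤ 1ℚ) (sym z+w) (≤-diff (≤-trans (<⇒≤ 0<K) (≤-reflexive (sym 1-z²)))))))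
    -- z′ - z = 2 (p - p′) = 2 p p′ (x′ - x), where x′ - x ≤ u x and x p = 1 - p ≤ 1 - p′.
    w≤ : 2ℚ * w ≤ K * u
    w≤ = begin
      2ℚ * (z′ - z)                            ≡⟨ cong (2ℚ *_) (cong₂ _-_ X′.z≡ X.z≡) ⟩
      2ℚ * ((1ℚ - 2ℚ * p′) - (1ℚ - 2ℚ * p))    ≡⟨ e₁ p p′ ⟩
      2ℚ * 2ℚ * (1ℚ * p - 1ℚ * p′)             ≡⟨ cong₂ (λ a b → 2ℚ * 2ℚ * (a * p - b * p′)) (sym X′.inverse) (sym X.inverse) ⟩
      2ℚ * 2ℚ * ((x′ + 1ℚ) * p′ * p - (x + 1ℚ) * p * p′) ≡⟨ e₂ x x′ p p′ ⟩
      2ℚ * 2ℚ * (p * p′ * (x′ - x))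
        ≤⟨ *-monoʳ 0≤4 (*-monoʳ (*-nonNeg X.0≤p X′.0≤p) (≤-diff (≤-trans (0≤-diff x′≤) (≤-reflexive (e₃ x u x′))))) ⟩
      2ℚ * 2ℚ * (p * p′ * (u * x))             ≡⟨ e₄ p p′ u x ⟩
      2ℚ * 2ℚ * (p′ * u * (x * p))             ≡⟨ cong (λ q → 2ℚ * 2ℚ * (p′ * u * q)) X.xp ⟩
      2ℚ * 2ℚ * (p′ * u * (1ℚ - p))
        ≤⟨ *-monoʳ 0≤4 (*-monoʳ (*-nonNeg X′.0≤p 0≤u) (+-monoʳ-≤ 1ℚ (neg-antimono-≤ p′≤p))) ⟩
      2ℚ * 2ℚ * (p′ * u * (1ℚ - p′))           ≡⟨ e₅ p′ u ⟩
      K * u                                    ∎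
      where
      0≤4 : 0ℚ ≤ 2ℚ * 2ℚ
      0≤4 = *-nonNeg (0≤fromℕ 2) (0≤fromℕ 2)
      e₁ : ∀ p p′ → (1ℚ + 1ℚ) * ((1ℚ - (1ℚ + 1ℚ) * p′) - (1ℚ - (1ℚ + 1ℚ) * p)) ≡ (1ℚ + 1ℚ) * (1ℚ + 1ℚ) * (1ℚ * p - 1ℚ * p′)
      e₁ = solve-∀ ring
      e₂ : ∀ x x′ p p′ → (1ℚ + 1ℚ) * (1ℚ + 1ℚ) * ((x′ + 1ℚ) * p′ * p - (x + 1ℚ) * p * p′) ≡ (1ℚ + 1ℚ) * (1ℚ + 1ℚ) * (p * p′ * (x′ - x))
      e₂ = solve-∀ ring
      e₃ : ∀ x u x′ → x + u * x - x′ ≡ u * x - (x′ - x)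
      e₃ = solve-∀ ring
      e₄ : ∀ p p′ u x → (1ℚ + 1ℚ) * (1ℚ + 1ℚ) * (p * p′ * (u * x)) ≡ (1ℚ + 1ℚ) * (1ℚ + 1ℚ) * (p′ * u * (x * p))
      e₄ = solve-∀ ring
      e₅ : ∀ p u → (1ℚ + 1ℚ) * (1ℚ + 1ℚ) * (p * u * (1ℚ - p)) ≡ (1ℚ + 1ℚ) * (1ℚ + 1ℚ) * (p * (1ℚ - p)) * u
      e₅ = solve-∀ ring
    scaled : 2ℚ * (artanhSum m z′ - artanhSum m z) ≤ u
    scaled = *-cancelˡ 0<K (begin
      K * (2ℚ * (artanhSum m z′ - artanhSum m z)) ≡⟨ e K 2ℚ (artanhSum m z′ - artanhSum m z) ⟩
      2ℚ * (K * (artanhSum m z′ - artanhSum m z)) ≤⟨ *-monoʳ (0≤fromℕ 2) inc ⟩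
      2ℚ * w                                     ≤⟨ w≤ ⟩
      K * u                                      ∎)
      where
      e : ∀ a b c → a * (b * c) ≡ b * (a * c)
      e = solve-∀ ring

  logSum-1 : ∀ m → logSum m 1ℚ ≡ 0ℚ
  logSum-1 m = trans (cong (fromℕ 2 *_) (zeros m)) (*-zeroʳ (fromℕ 2))
    where
    e : ∀ z r → 0ℚ + 0ℚ * z * r ≡ 0ℚ
    e = solve-∀ ring
    zeros : ∀ m → artanhSum m (cayley 1ℚ) ≡ 0ℚ
    zeros zero    = refl
    zeros (suc m) = trans (cong₂ (λ a c → a + c * c ^ℚ (2 ℕ.* m) * inv (odd m)) (zeros m) (*-zeroˡ (recip (1ℚ + 1ℚ)))) (e (0ℚ ^ℚ (2 ℕ.* m)) (inv (odd m)))

  logSum-nonNeg : ∀ m {x} → 1ℚ ≤ x → 0ℚ ≤ logSum m x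
  logSum-nonNeg m 1≤x = ≤-trans (≤-reflexive (sym (logSum-1 m))) (logSum-mono m ≤-refl 1≤x)

  1≤^ : ∀ {r} a → 1ℚ ≤ r → 1ℚ ≤ r ^ℚ a
  1≤^ zero    1≤r = ≤-refl
  1≤^ (suc a) 1≤r = ≤-trans (≤-reflexive (sym (*-identityˡ 1ℚ))) (*-mono 0≤1 (≤-trans 0≤1 1≤r) 1≤r (1≤^ a 1≤r))

  -- Truncations are not additive on products, so the factors 1 + u are removed singly by
  -- `logSum-scale`; an x already below the smaller power goes straight to the induction hypothesis.
  logSum-^ : ∀ m {x u} a → 0ℚ ≤ u → 1ℚ ≤ x → x ≤ (1ℚ + u) ^ℚ a → logSum m x ≤ fromℕ a * u
  logSum-^ m {x} {u} zero    0≤u 1≤x x≤ = ≤-reflexive (trans (cong (logSum m) (≤-antisym x≤ 1≤x)) (trans (logSum-1 m) (sym (*-zeroˡ u))))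
  logSum-^ m {x} {u} (suc a) 0≤u 1≤x x≤ with ≤-total x ((1ℚ + u) ^ℚ a)
  ... | inj₁ le = ≤-trans (logSum-^ m a 0≤u 1≤x le) (*-monoˡ 0≤u (fromℕ-mono (ℕ.n≤1+n a)))
  ... | inj₂ ge = begin
    logSum m x              ≤⟨ logSum-scale m 1≤y ge (≤-trans x≤ (≤-reflexive (e₁ u y))) 0≤u ⟩
    logSum m y + u          ≤⟨ +-monoˡ-≤ u (logSum-^ m a 0≤u 1≤y ≤-refl) ⟩
    fromℕ a * u + u         ≡⟨ e₂ (fromℕ a) u ⟩
    (1ℚ + fromℕ a) * u      ≡⟨ cong (_* u) (fromℕ-suc a) ⟨
    fromℕ (suc a) * u       ∎
    where
    open ≤-Reasoning
    y = (1ℚ + u) ^ℚ a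
    1≤y : 1ℚ ≤ y
    1≤y = 1≤^ a (≤-by u 0≤u refl)
    e₁ : ∀ u y → (1ℚ + u) * y ≡ y + u * y
    e₁ = solve-∀ ring
    e₂ : ∀ a u → a * u + u ≡ (1ℚ + a) * u
    e₂ = solve-∀ ring

  logSum-≤ : ∀ m N a {x} .{{_ : ℕ.NonZero N}} → 1ℚ ≤ x → fromℕ (N ℕ.^ a) * x ≤ fromℕ (suc N ℕ.^ a) → logSum m x ≤ fromℕ a * inv N
  logSum-≤ m N a {x} 1≤x le = logSum-^ m a (0≤inv N) 1≤x (*-cancelˡ (0<fromℕ (N ℕ.^ a) {{ℕ.m^n≢0 N a}}) (≤-trans le (≤-reflexive (begin
    fromℕ (suc N ℕ.^ a)                   ≡⟨ fromℕ-^ (suc N) a ⟩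
    fromℕ (suc N) ^ℚ a                    ≡⟨ cong (_^ℚ a) base ⟩
    (fromℕ N * (1ℚ + inv N)) ^ℚ a         ≡⟨ ^-distrib-* (fromℕ N) (1ℚ + inv N) a ⟩
    fromℕ N ^ℚ a * (1ℚ + inv N) ^ℚ a      ≡⟨ cong (_* (1ℚ + inv N) ^ℚ a) (fromℕ-^ N a) ⟨
    fromℕ (N ℕ.^ a) * (1ℚ + inv N) ^ℚ a   ∎))))
    where
    open ≡-Reasoning
    base : fromℕ (suc N) ≡ fromℕ N * (1ℚ + inv N)
    base = trans (fromℕ-suc N) (trans (cong (_+ fromℕ N) (sym (fromℕ*inv N))) (e (fromℕ N) (inv N)))
      where
      e : ∀ a b → a * b + a ≡ a * (1ℚ + b)
      e = solve-∀ ring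

  -- At 3 the argument (x - 1) / (x + 1) is 1/2, so the first term of the series alone is 2 times
  -- 1/2.
  1≤logSum : ∀ m {x} → fromℕ 3 ≤ x → 1ℚ ≤ logSum (suc m) x
  1≤logSum m {x} 3≤x = begin
    1ℚ                              ≡⟨ refl ⟩
    fromℕ 2 * (cayley (fromℕ 3) ^ℚ odd 0 * inv (odd 0))
      ≤⟨ *-monoʳ (0≤fromℕ 2) (∑<-first m (λ i → *-nonNeg (^-nonNeg (odd i) 0≤z) (0≤inv (odd i)))) ⟩
    logSum (suc m) (fromℕ 3)        ≤⟨ logSum-mono (suc m) 1≤3 3≤x ⟩
    logSum (suc m) x                ∎
    where
    open ≤-Reasoning
    1≤3 : 1ℚ ≤ fromℕ 3
    1≤3 = 1≤fromℕ 3
    0≤z : 0ℚ ≤ cayley (fromℕ 3)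
    0≤z = Cayley.0≤z 1≤3

  -- Limits

  ≤-limit : ∀ {p q} → (∀ δ → 0ℚ < δ → p ≤ q + δ) → p ≤ q
  ≤-limit {p} {q} h with p ≤? q
  ... | yes p≤q = p≤q
  ... | no p≰q with <-dense (≰⇒> p≰q)
  ... | r , q<r , r<p = contradiction (≤-<-trans (h (r - q) 0<r-q) (≤-<-trans (≤-reflexive (e q r)) r<p)) (<-irrefl refl)
    where
    e : ∀ q r → q + (r - q) ≡ r
    e = solve-∀ ring
    0<r-q : 0ℚ < r - q
    0<r-q = ≤-<-trans (≤-reflexive (sym (+-inverseʳ q))) (+-monoˡ-< (- q) q<r)

  ≤-divide : ∀ a .{{_ : ℕ.NonZero a}} {p q} → fromℕ a * p ≤ q → p ≤ q * inv a
  ≤-divide a {p} {q} le = *-cancelˡ (0<fromℕ a) (≤-trans le (≤-reflexive (begin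
    q                       ≡⟨ *-identityʳ q ⟨
    q * 1ℚ                  ≡⟨ cong (q *_) (fromℕ*inv a) ⟨
    q * (fromℕ a * inv a)   ≡⟨ e q (fromℕ a) (inv a) ⟩
    fromℕ a * (q * inv a)   ∎)))
    where
    open ≡-Reasoning
    e : ∀ a b c → a * (b * c) ≡ b * (a * c)
    e = solve-∀ ring

  natural-bound : ∀ p → ∃[ W ] p ≤ fromℕ W
  natural-bound p with ≤-total p 0ℚ | 0ℚ <? p
  ... | inj₁ p≤0 | _       = 0 , p≤0
  ... | inj₂ 0≤p | no ¬0<p = 0 , ≮⇒≥ ¬0<p
  ... | inj₂ 0≤p | yes 0<p = W , (begin
    p                           ≡⟨ *-identityʳ p ⟨
    p * 1ℚ                      ≤⟨ *-monoʳ 0≤p (archimedean (recip p) (0<recip 0<p)) ⟩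
    p * (recip p * fromℕ W)     ≡⟨ *-assoc p (recip p) (fromℕ W) ⟨
    p * recip p * fromℕ W       ≡⟨ cong (_* fromℕ W) (recip-inverse 0<p) ⟩
    1ℚ * fromℕ W                ≡⟨ *-identityˡ (fromℕ W) ⟩
    fromℕ W                     ∎)
    where
    open ≤-Reasoning
    W = ↧ₙ (recip p)

  1≤expSum : ∀ m {y} → 0ℚ ≤ y → 1ℚ ≤ expSum (suc m) y
  1≤expSum m {y} 0≤y = ∑<-first m (λ i → term-nonNeg i 0≤y)

  -- exp (1/2) ≤ 2, the case N = 2 of `expSum-≤`.
  expSum-≤2^ : ∀ m b {y} → 0ℚ ≤ y → y ≤ fromℕ b * inv 2 → expSum m y ≤ fromℕ (2 ℕ.^ b)
  expSum-≤2^ m b {y} 0≤y y≤ = ≤-trans (≤-reflexive (sym (trans (cong (_* expSum m y) (cong fromℕ (ℕ.^-zeroˡ b))) (*-identityˡ (expSum m y))))) (expSum-≤ m 1 b 0≤y y≤)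

  -- Uniformity in y is essential: in the applications the argument of the exponential is itself an
  -- approximation that varies with m.
  exp-inverse : ∀ W δ → 0ℚ < δ → ∃[ N ] ∀ m → N ℕ.≤ m → ∀ y → 0ℚ ≤ y → y ≤ fromℕ W →
    ∣ expSum (suc m) (- y) * expSum (suc m) y - 1ℚ ∣ ≤ δ
  exp-inverse W δ 0<δ = N , bound
    where
    open ≤-Reasoning
    -- K bounds exp (2 W) because exp (1/2) ≤ 2. The error K² / 2^(m + 1) is at most δ once m
    -- reaches N.
    K = 2 ℕ.^ (4 ℕ.* W)
    N = ↧ₙ δ ℕ.* (K ℕ.* K)
    bound : ∀ m → N ℕ.≤ m → ∀ y → 0ℚ ≤ y → y ≤ fromℕ W → ∣ expSum (suc m) (- y) * expSum (suc m) y - 1ℚ ∣ ≤ δ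
    bound m N≤m y 0≤y y≤W = *-cancelˡ (0<fromℕ (2 ℕ.^ suc m) {{ℕ.m^n≢0 2 (suc m)}}) (begin
      fromℕ (2 ℕ.^ suc m) * ∣ expSum (suc m) (- y) * expSum (suc m) y - 1ℚ ∣ ≤⟨ expSum-inverse y 0≤y m ⟩
      expSum (suc m) (fromℕ 2 * y) * expSum (suc m) (fromℕ 2 * y) ≤⟨ *-mono (expSum-nonNeg (suc m) 0≤2y) (0≤fromℕ K) small small ⟩
      fromℕ K * fromℕ K                ≡⟨ fromℕ-* K K ⟨
      fromℕ (K ℕ.* K)                  ≡⟨ *-identityˡ _ ⟨
      1ℚ * fromℕ (K ℕ.* K)             ≤⟨ *-monoˡ (0≤fromℕ (K ℕ.* K)) (archimedean δ 0<δ) ⟩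
      δ * fromℕ (↧ₙ δ) * fromℕ (K ℕ.* K) ≡⟨ trans (*-assoc δ _ _) (cong (δ *_) (sym (fromℕ-* (↧ₙ δ) (K ℕ.* K)))) ⟩
      δ * fromℕ N                      ≤⟨ *-monoʳ (<⇒≤ 0<δ) (fromℕ-mono (ℕ.≤-trans N≤m (ℕ.≤-trans (ℕ.n≤1+n m) (ℕ.<⇒≤ (n<2^n (suc m)))))) ⟩
      δ * fromℕ (2 ℕ.^ suc m)          ≡⟨ *-comm δ _ ⟩
      fromℕ (2 ℕ.^ suc m) * δ          ∎)
      where
      0≤2y : 0ℚ ≤ fromℕ 2 * y
      0≤2y = *-nonNeg (0≤fromℕ 2) 0≤y
      small : expSum (suc m) (fromℕ 2 * y) ≤ fromℕ K
      small = expSum-≤2^ (suc m) (4 ℕ.* W) 0≤2y (begin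
        fromℕ 2 * y                 ≤⟨ *-monoʳ (0≤fromℕ 2) y≤W ⟩
        fromℕ 2 * fromℕ W           ≡⟨ cong (_* fromℕ W) four-halves ⟩
        fromℕ 4 * inv 2 * fromℕ W   ≡⟨ e (fromℕ 4) (inv 2) (fromℕ W) ⟩
        fromℕ 4 * fromℕ W * inv 2   ≡⟨ cong (_* inv 2) (fromℕ-* 4 W) ⟨
        fromℕ (4 ℕ.* W) * inv 2     ∎)
        where
        four-halves : fromℕ 2 ≡ fromℕ 4 * inv 2
        four-halves = refl
        e : ∀ a b c → a * b * c ≡ a * c * b
        e = solve-∀ ring

  near-inverse-≤ : ∀ {a b δ} → 0ℚ ≤ δ → 1ℚ ≤ b → ∣ a * b - 1ℚ ∣ ≤ δ → a ≤ 1ℚ + δ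
  near-inverse-≤ {a} {b} {δ} 0≤δ 1≤b close with ≤-total a 0ℚ
  ... | inj₁ a≤0 = ≤-trans a≤0 (+-nonNeg 0≤1 0≤δ)
  ... | inj₂ 0≤a = begin
    a                    ≡⟨ *-identityʳ a ⟨
    a * 1ℚ               ≤⟨ *-monoʳ 0≤a 1≤b ⟩
    a * b                ≡⟨ e (a * b) ⟩
    1ℚ + (a * b - 1ℚ)    ≤⟨ +-monoʳ-≤ 1ℚ (≤-trans (p≤∣p∣ (a * b - 1ℚ)) close) ⟩
    1ℚ + δ               ∎
    where
    open ≤-Reasoning
    e : ∀ x → x ≡ 1ℚ + (x - 1ℚ)
    e = solve-∀ ring

  near-inverse-≥ : ∀ {a b δ} K .{{_ : ℕ.NonZero K}} → 0ℚ ≤ δ → 1ℚ ≤ b → b ≤ fromℕ K → ∣ a * b - 1ℚ ∣ ≤ δ → inv K ≤ a + δ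
  near-inverse-≥ {a} {b} {δ} K 0≤δ 1≤b b≤K close = *-cancelˡ (0<fromℕ K) (begin
    fromℕ K * inv K      ≡⟨ fromℕ*inv K ⟩
    1ℚ                   ≤⟨ prod ⟩
    b * (a + δ)          ≤⟨ *-monoˡ 0≤a+δ b≤K ⟩
    fromℕ K * (a + δ)    ∎)
    where
    open ≤-Reasoning
    0<b : 0ℚ < b
    0<b = <-≤-trans 0<1 1≤b
    e₁ : ∀ x δ → δ - (- (x - 1ℚ)) ≡ x + 1ℚ * δ - 1ℚ
    e₁ = solve-∀ ring
    e₂ : ∀ a b d → a * b + b * d ≡ b * (a + d)
    e₂ = solve-∀ ring
    prod : 1ℚ ≤ b * (a + δ)
    prod = begin
      1ℚ                 ≤⟨ ≤-diff (≤-trans (0≤-diff (≤-trans (-p≤∣p∣ (a * b - 1ℚ)) close)) (≤-reflexive (e₁ (a * b) δ))) ⟩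
      a * b + 1ℚ * δ     ≤⟨ +-monoʳ-≤ (a * b) (*-monoˡ 0≤δ 1≤b) ⟩
      a * b + b * δ      ≡⟨ e₂ a b δ ⟩
      b * (a + δ)        ∎
    0≤a+δ : 0ℚ ≤ a + δ
    0≤a+δ = *-cancelˡ 0<b (≤-trans (≤-reflexive (*-zeroʳ b)) (≤-trans 0≤1 prod))

  exp-neg-≤1 : ∀ W δ → 0ℚ < δ → ∃[ N ] ∀ m → N ℕ.≤ m → ∀ y → 0ℚ ≤ y → y ≤ fromℕ W → expSum (suc m) (- y) ≤ 1ℚ + δ
  exp-neg-≤1 W δ 0<δ = proj₁ (exp-inverse W δ 0<δ) , λ m N≤m y 0≤y y≤W →
    near-inverse-≤ {expSum (suc m) (- y)} {expSum (suc m) y} (<⇒≤ 0<δ) (1≤expSum m {y} 0≤y) (proj₂ (exp-inverse W δ 0<δ) m N≤m y 0≤y y≤W)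

  exp-neg-≥ : ∀ W δ → 0ℚ < δ → ∃[ N ] ∀ m → N ℕ.≤ m → ∀ y → 0ℚ ≤ y → y ≤ fromℕ W →
    inv (2 ℕ.^ (2 ℕ.* W)) {{ℕ.m^n≢0 2 (2 ℕ.* W)}} ≤ expSum (suc m) (- y) + δ
  exp-neg-≥ W δ 0<δ = proj₁ (exp-inverse W δ 0<δ) , λ m N≤m y 0≤y y≤W →
    near-inverse-≥ {expSum (suc m) (- y)} {expSum (suc m) y} K {{ℕ.m^n≢0 2 (2 ℕ.* W)}} (<⇒≤ 0<δ) (1≤expSum m {y} 0≤y)
      (expSum-≤2^ (suc m) (2 ℕ.* W) 0≤y (≤-trans y≤W (≤-reflexive halves))) (proj₂ (exp-inverse W δ 0<δ) m N≤m y 0≤y y≤W)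
    where
    K = 2 ℕ.^ (2 ℕ.* W)
    e : ∀ a b c → a * b * c ≡ a * c * b
    e = solve-∀ ring
    open ≡-Reasoning
    halves : fromℕ W ≡ fromℕ (2 ℕ.* W) * inv 2
    halves = begin
      fromℕ W                     ≡⟨ *-identityˡ (fromℕ W) ⟨
      1ℚ * fromℕ W                ≡⟨ cong (_* fromℕ W) (fromℕ*inv 2) ⟨
      fromℕ 2 * inv 2 * fromℕ W   ≡⟨ e (fromℕ 2) (inv 2) (fromℕ W) ⟩
      fromℕ 2 * fromℕ W * inv 2   ≡⟨ cong (_* inv 2) (fromℕ-* 2 W) ⟨
      fromℕ (2 ℕ.* W) * inv 2     ∎

  -- log 2 ≤ 1, the case N = 1 of `logSum-≤`.
  logSum-≤-exponent : ∀ m ℓ n .{{_ : ℕ.NonZero n}} → n ℕ.≤ 2 ℕ.^ ℓ → logSum m (fromℕ n) ≤ fromℕ ℓ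
  logSum-≤-exponent m ℓ n n≤ = ≤-trans (logSum-≤ m 1 ℓ (1≤fromℕ n)
      (≤-trans (≤-reflexive (trans (cong (λ a → fromℕ a * fromℕ n) (ℕ.^-zeroˡ ℓ)) (*-identityˡ (fromℕ n)))) (fromℕ-mono n≤)))
    (≤-reflexive (trans (cong (fromℕ ℓ *_) inv-1) (*-identityʳ (fromℕ ℓ))))
    where
    inv-1 : inv 1 ≡ 1ℚ
    inv-1 = refl

  -- Hypotheses and conclusion in integer form

  quotient-bounds : ∀ n l .{{_ : ℕ.NonZero n}} → 1ℚ ≤ l → l ≤ fromℕ n →
    1ℚ ≤ fromℕ n * recip l × fromℕ n * recip l ≤ fromℕ n
  quotient-bounds n l 1≤l l≤n = ≤-trans (≤-reflexive (sym (recip-inverse 0<l))) (*-monoˡ 0≤r l≤n) , (begin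
    fromℕ n * recip l            ≡⟨ cong (fromℕ n *_) (*-identityˡ (recip l)) ⟨
    fromℕ n * (1ℚ * recip l)     ≤⟨ *-monoʳ (0≤fromℕ n) (*-monoˡ 0≤r 1≤l) ⟩
    fromℕ n * (l * recip l)      ≡⟨ cong (fromℕ n *_) (recip-inverse 0<l) ⟩
    fromℕ n * 1ℚ                 ≡⟨ *-identityʳ (fromℕ n) ⟩
    fromℕ n                      ∎)
    where
    open ≤-Reasoning
    0<l : 0ℚ < l
    0<l = <-≤-trans 0<1 1≤l
    0≤r : 0ℚ ≤ recip l
    0≤r = <⇒≤ (0<recip 0<l)

  -- This bounds x^ρ for ρ = 1/d: log x ≤ d b / N, so the exponent is at most b / N, and `expSum-≤`
  -- applies.
  power-≤ : ∀ m M b d ρ x (let N = suc M) .{{_ : ℕ.NonZero (M ℕ.^ b)}} → 0ℚ ≤ ρ → ρ * fromℕ d ≡ 1ℚ → 1ℚ ≤ x →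
    fromℕ (N ℕ.^ (d ℕ.* b)) * x ≤ fromℕ (suc N ℕ.^ (d ℕ.* b)) →
    expSum m (ρ * logSum m x) ≤ fromℕ (N ℕ.^ b) * inv (M ℕ.^ b)
  power-≤ m M b d ρ x 0≤ρ ρd≡1 1≤x x≤ = ≤-divide (M ℕ.^ b) (expSum-≤ m M b (*-nonNeg 0≤ρ (logSum-nonNeg m 1≤x)) (begin
    ρ * logSum m x                     ≤⟨ *-monoʳ 0≤ρ (logSum-≤ m N (d ℕ.* b) 1≤x x≤) ⟩
    ρ * (fromℕ (d ℕ.* b) * inv N)      ≡⟨ cong (λ z → ρ * (z * inv N)) (fromℕ-* d b) ⟩
    ρ * (fromℕ d * fromℕ b * inv N)    ≡⟨ e ρ (fromℕ d) (fromℕ b) (inv N) ⟩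
    ρ * fromℕ d * (fromℕ b * inv N)    ≡⟨ trans (cong (_* (fromℕ b * inv N)) ρd≡1) (*-identityˡ (fromℕ b * inv N)) ⟩
    fromℕ b * inv N                    ∎))
    where
    open ≤-Reasoning
    N = suc M
    e : ∀ a b c d → a * (b * c * d) ≡ a * b * (c * d)
    e = solve-∀ ring

  clear-inv : ∀ k a c .{{_ : ℕ.NonZero a}} → fromℕ k ≤ fromℕ c * inv a → k ℕ.* a ℕ.≤ c
  clear-inv k a c le = fromℕ-cancel (begin
    fromℕ (k ℕ.* a)             ≡⟨ fromℕ-* k a ⟩
    fromℕ k * fromℕ a           ≤⟨ *-monoˡ (0≤fromℕ a) le ⟩
    fromℕ c * inv a * fromℕ a   ≡⟨ e (fromℕ c) (inv a) (fromℕ a) ⟩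
    fromℕ c * (fromℕ a * inv a) ≡⟨ trans (cong (fromℕ c *_) (fromℕ*inv a)) (*-identityʳ (fromℕ c)) ⟩
    fromℕ c                     ∎)
    where
    open ≤-Reasoning
    e : ∀ a b c → a * b * c ≡ a * (c * b)
    e = solve-∀ ring

  -- Here N = 10 and d = 4: log (n / log n) ≤ 4 b / 10, since n / log n lies between 1 and n, and
  -- exp (b / 10) ≤ (10/9)^b. The bound is the same for all truncations, so the slack δ can tend to
  -- 0.
  k-bound : ∀ n k b → 3 ℕ.≤ n → n ℕ.* 10 ℕ.^ (4 ℕ.* b) ℕ.≤ 11 ℕ.^ (4 ℕ.* b) →
    ι k ≤ʳ (ι n /ʳ log (ι n)) ^ʳ (ι 1 /ʳ ι 4) → k ℕ.* 9 ℕ.^ b ℕ.≤ 10 ℕ.^ b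
  k-bound n k b 3≤n n≤ hyp = clear-inv k (9 ℕ.^ b) (10 ℕ.^ b) (≤-limit limit)
    where
    instance
      n≢0 : ℕ.NonZero n
      n≢0 = ℕ.>-nonZero (ℕ.≤-trans (s≤s z≤n) 3≤n)
      9^b≢0 : ℕ.NonZero (9 ℕ.^ b)
      9^b≢0 = ℕ.m^n≢0 9 b
    1≤log : ∀ m → 1ℚ ≤ logSum (suc m) (fromℕ n)
    1≤log m = 1≤logSum m (fromℕ-mono 3≤n)
    base≤ : ∀ x → x ≤ fromℕ n → fromℕ (10 ℕ.^ (4 ℕ.* b)) * x ≤ fromℕ (11 ℕ.^ (4 ℕ.* b))
    base≤ x x≤n = ≤-trans (*-monoʳ (0≤fromℕ (10 ℕ.^ (4 ℕ.* b))) x≤n) (≤-trans (≤-reflexive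
      (trans (*-comm (fromℕ (10 ℕ.^ (4 ℕ.* b))) (fromℕ n)) (sym (fromℕ-* n (10 ℕ.^ (4 ℕ.* b)))))) (fromℕ-mono n≤))
    quarter : ℚ
    quarter = fromℕ 1 * recip (fromℕ 4)
    four-quarters : quarter * fromℕ 4 ≡ 1ℚ
    four-quarters = refl
    0≤quarter : 0ℚ ≤ quarter
    0≤quarter = *-nonNeg (0≤fromℕ 1) (<⇒≤ (0<recip (0<fromℕ 4)))
    value : ∀ m → expSum (suc m) (quarter * logSum (suc m) (fromℕ n * recip (logSum (suc m) (fromℕ n)))) ≤ fromℕ (10 ℕ.^ b) * inv (9 ℕ.^ b)
    value m = power-≤ (suc m) 9 b 4 quarter (fromℕ n * recip (logSum (suc m) (fromℕ n))) 0≤quarter four-quarters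
      (proj₁ bounds) (base≤ (fromℕ n * recip (logSum (suc m) (fromℕ n))) (proj₂ bounds))
      where
      bounds = quotient-bounds n (logSum (suc m) (fromℕ n)) (1≤log m) (logSum-≤-exponent (suc m) n n (ℕ.<⇒≤ (n<2^n n)))
    limit : ∀ δ → 0ℚ < δ → fromℕ k ≤ fromℕ (10 ℕ.^ b) * inv (9 ℕ.^ b) + δ
    -- The index is a successor, so that the truncated logarithm in the denominator is at least 1.
    limit δ 0<δ = ≤-trans (proj₂ (hyp δ 0<δ) (suc (proj₁ (hyp δ 0<δ))) (ℕ.n≤1+n _)) (+-monoˡ-≤ δ (value (proj₁ (hyp δ 0<δ))))

  clear-quotients : ∀ n k c a b .{{_ : ℕ.NonZero k}} .{{_ : ℕ.NonZero a}} →
    fromℕ c ≤ fromℕ n * recip (fromℕ k) + fromℕ b * inv a → k ℕ.* c ℕ.* a ℕ.≤ n ℕ.* a ℕ.+ k ℕ.* b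
  clear-quotients n k c a b le = fromℕ-cancel (begin
    fromℕ (k ℕ.* c ℕ.* a)             ≡⟨ trans (fromℕ-* (k ℕ.* c) a) (cong (_* fromℕ a) (fromℕ-* k c)) ⟩
    fromℕ k * fromℕ c * fromℕ a       ≤⟨ *-monoˡ (0≤fromℕ a) (*-monoʳ (0≤fromℕ k) le) ⟩
    fromℕ k * (fromℕ n * recip (fromℕ k) + fromℕ b * inv a) * fromℕ a
      ≡⟨ e (fromℕ k) (fromℕ n) (recip (fromℕ k)) (fromℕ b) (inv a) (fromℕ a) ⟩
    fromℕ n * fromℕ a * (fromℕ k * recip (fromℕ k)) + fromℕ k * fromℕ b * (fromℕ a * inv a)
      ≡⟨ cong₂ (λ p q → fromℕ n * fromℕ a * p + fromℕ k * fromℕ b * q) (recip-inverse (0<fromℕ k)) (fromℕ*inv a) ⟩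
    fromℕ n * fromℕ a * 1ℚ + fromℕ k * fromℕ b * 1ℚ
      ≡⟨ cong₂ _+_ (*-identityʳ (fromℕ n * fromℕ a)) (*-identityʳ (fromℕ k * fromℕ b)) ⟩
    fromℕ n * fromℕ a + fromℕ k * fromℕ b
      ≡⟨ cong₂ _+_ (fromℕ-* n a) (fromℕ-* k b) ⟨
    fromℕ (n ℕ.* a) + fromℕ (k ℕ.* b) ≡⟨ fromℕ-+ (n ℕ.* a) (k ℕ.* b) ⟨
    fromℕ (n ℕ.* a ℕ.+ k ℕ.* b)       ∎)
    where
    open ≤-Reasoning
    e : ∀ k n r b i a → k * (n * r + b * i) * a ≡ n * a * (k * r) + k * b * (a * i)
    e = solve-∀ ring

  1≤quotient : ∀ n k .{{_ : ℕ.NonZero k}} → k ℕ.≤ n → 1ℚ ≤ fromℕ n * recip (fromℕ k)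
  1≤quotient n k k≤n = ≤-trans (≤-reflexive (sym (recip-inverse (0<fromℕ k)))) (*-monoˡ (<⇒≤ (0<recip (0<fromℕ k))) (fromℕ-mono k≤n))

  quotient-≤ : ∀ n k A B .{{_ : ℕ.NonZero k}} → n ℕ.* A ℕ.≤ k ℕ.* B → fromℕ A * (fromℕ n * recip (fromℕ k)) ≤ fromℕ B
  quotient-≤ n k A B le = begin
    fromℕ A * (fromℕ n * r)     ≡⟨ e₁ (fromℕ A) (fromℕ n) r ⟩
    fromℕ n * fromℕ A * r       ≡⟨ cong (_* r) (fromℕ-* n A) ⟨
    fromℕ (n ℕ.* A) * r         ≤⟨ *-monoˡ (<⇒≤ (0<recip (0<fromℕ k))) (fromℕ-mono le) ⟩
    fromℕ (k ℕ.* B) * r         ≡⟨ cong (_* r) (fromℕ-* k B) ⟩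
    fromℕ k * fromℕ B * r       ≡⟨ e₂ (fromℕ k) (fromℕ B) r ⟩
    fromℕ k * r * fromℕ B       ≡⟨ trans (cong (_* fromℕ B) (recip-inverse (0<fromℕ k))) (*-identityˡ (fromℕ B)) ⟩
    fromℕ B                     ∎
    where
    open ≤-Reasoning
    r = recip (fromℕ k)
    e₁ : ∀ a b c → a * (b * c) ≡ b * a * c
    e₁ = solve-∀ ring
    e₂ : ∀ a b c → a * b * c ≡ a * c * b
    e₂ = solve-∀ ring

  1-inv : ∀ R′ q t → let R = suc R′ in (1ℚ - inv R) * (fromℕ (R ℕ.* q) * t) ≡ fromℕ (R′ ℕ.* q) * t
  1-inv R′ q t = begin
    (1ℚ - inv R) * (fromℕ (R ℕ.* q) * t)      ≡⟨ cong (λ z → (1ℚ - inv R) * (z * t)) (fromℕ-* R q) ⟩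
    (1ℚ - inv R) * (fromℕ R * fromℕ q * t)    ≡⟨ e₁ (inv R) (fromℕ R) (fromℕ q) t ⟩
    (fromℕ R - fromℕ R * inv R) * fromℕ q * t ≡⟨ cong (λ z → z * fromℕ q * t) (cong₂ _-_ (fromℕ-suc R′) (fromℕ*inv R)) ⟩
    (1ℚ + fromℕ R′ - 1ℚ) * fromℕ q * t        ≡⟨ e₂ (fromℕ R′) (fromℕ q) t ⟩
    fromℕ R′ * fromℕ q * t                    ≡⟨ cong (_* t) (fromℕ-* R′ q) ⟨
    fromℕ (R′ ℕ.* q) * t                      ∎
    where
    open ≡-Reasoning
    R = suc R′
    e₁ : ∀ i R q n → (1ℚ - i) * (R * q * n) ≡ (R - R * i) * q * n
    e₁ = solve-∀ ring
    e₂ : ∀ r q t → (1ℚ + r - 1ℚ) * q * t ≡ r * q * t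
    e₂ = solve-∀ ring

  -- A negative exponent (ε > 1) is handled by exp (- y) ≤ 1.
  exp-≤-eventually : ∀ (x : Seq) W V δ → 0ℚ < δ → 1ℚ ≤ V →
    (∃[ m₀ ] ∀ m → m₀ ℕ.≤ m → - fromℕ W ≤ x m × (0ℚ ≤ x m → expSum m (x m) ≤ V)) →
    ∃[ m₁ ] ∀ m → m₁ ℕ.≤ m → expSum m (x m) ≤ V + δ
  exp-≤-eventually x W V δ 0<δ 1≤V (m₀ , h) = suc (m₀ ℕ.+ N) , bound
    where
    N = proj₁ (exp-neg-≤1 W δ 0<δ)
    bound : ∀ m → suc (m₀ ℕ.+ N) ℕ.≤ m → expSum m (x m) ≤ V + δ
    bound (suc m) (s≤s le) with ≤-total 0ℚ (x (suc m)) | h (suc m) (ℕ.m≤n⇒m≤1+n (ℕ.≤-trans (ℕ.m≤m+n m₀ N) le))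
    ... | inj₁ 0≤x | _ , pos = ≤-trans (pos 0≤x) (≤-by δ (<⇒≤ 0<δ) refl)
    ... | inj₂ x≤0 | low , _ = ≤-trans (≤-reflexive (cong (expSum (suc m)) (sym (e (x (suc m))))))
      (≤-trans (proj₂ (exp-neg-≤1 W δ 0<δ) m (ℕ.≤-trans (ℕ.m≤n+m N m₀) le) (- x (suc m)) (neg-antimono-≤ x≤0)
        (≤-trans (neg-antimono-≤ low) (≤-reflexive (e (fromℕ W))))) (+-monoˡ-≤ δ 1≤V))
      where
      e : ∀ x → - (- x) ≡ x
      e = solve-∀ ring

  -- Eventually ε stays within 1 of one of its approximations. This limits how negative the exponent
  -- 1 - ε can become.
  bounded-above : ∀ (ε : ℝ) → ∃[ U ] ∃[ m₀ ] ∀ m → m₀ ℕ.≤ m → seq ε m ≤ 1ℚ + fromℕ U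
  bounded-above ε with ℝ.cauchy ε 1ℚ 0<1
  ... | m₀ , close with natural-bound (seq ε m₀)
  ... | U , le = U , m₀ , λ m m₀≤m → ≤-trans (≤-diff (≤-trans (0≤-diff (≤-trans (p≤∣p∣ (seq ε m - seq ε m₀)) (close m m₀ m₀≤m ℕ.≤-refl)))
      (≤-reflexive (e (seq ε m) (seq ε m₀))))) (+-monoʳ-≤ 1ℚ le)
    where
    e : ∀ a b → 1ℚ - (a - b) ≡ 1ℚ + b - a
    e = solve-∀ ring

  exponent-≥ : ∀ {ε l u A w} → 0ℚ ≤ l → l ≤ A → 0ℚ ≤ u → ε ≤ 1ℚ + u → u * A ≤ w → - w ≤ (1ℚ - ε) * l
  exponent-≥ {ε} {l} {u} {A} {w} 0≤l l≤A 0≤u ε≤ ≤w = begin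
    - w               ≤⟨ neg-antimono-≤ ≤w ⟩
    - (u * A)         ≤⟨ neg-antimono-≤ (*-monoʳ 0≤u l≤A) ⟩
    - (u * l)         ≡⟨ e₁ u l ⟩
    (1ℚ - (1ℚ + u)) * l ≤⟨ *-monoˡ 0≤l (+-monoʳ-≤ 1ℚ (neg-antimono-≤ ε≤)) ⟩
    (1ℚ - ε) * l      ∎
    where
    open ≤-Reasoning
    e₁ : ∀ u l → - (u * l) ≡ (1ℚ - (1ℚ + u)) * l
    e₁ = solve-∀ ring

  -- One slack comes from the hypothesis on the configuration and one from the bound on the power;
  -- each is taken as δ / 2.
  halving : ∀ {a x V} → (∀ δ → 0ℚ < δ → a ≤ x + (V + δ) + δ) → a ≤ x + V
  halving {a} {x} {V} h = ≤-limit λ δ 0<δ → ≤-trans (h (½ * δ) (*-pos (positive⁻¹ ½) 0<δ)) (≤-reflexive (trans (e x V ½ δ)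
      (cong (λ z → x + V + z) (trans (cong (_* δ) halves) (*-identityˡ δ)))))
    where
    e : ∀ x V h δ → x + (V + h * δ) + h * δ ≡ x + V + (h + h) * δ
    e = solve-∀ ring
    halves : ½ + ½ ≡ 1ℚ
    halves = refl

  ≤-replace : ∀ {a x e e′ δ} → a ≤ x + e + δ → e ≤ e′ → a ≤ x + e′ + δ
  ≤-replace {x = x} {δ = δ} a≤ e≤ = ≤-trans a≤ (+-monoˡ-≤ δ (+-monoʳ-≤ x e≤))

  -- Both ε and the logarithm vary with m, so only bounds uniform in m survive the limit. The
  -- exponent is eventually either in [0, (1 - ρ) A], where V bounds the exponential, or in [-W, 0],
  -- where 1 + δ does.
  power-limit : ∀ (ε : ℝ) (l : Seq) {A ρ V a x} → (∀ m → 0ℚ ≤ l m) → (∀ m → l m ≤ A) → ρ ≤ 1ℚ →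
    (∃[ m₀ ] ∀ m → m₀ ℕ.≤ m → ρ ≤ seq ε m) → 1ℚ ≤ V → (∀ m y → 0ℚ ≤ y → y ≤ (1ℚ - ρ) * A → expSum m y ≤ V) →
    (∀ δ → 0ℚ < δ → ∃[ m₁ ] ∀ m → m₁ ℕ.≤ m → a ≤ x + expSum m ((fromℕ 1 - seq ε m) * l m) + δ) →
    a ≤ x + V
  power-limit ε l {A} {ρ} {V} {a} {x} 0≤l l≤A ρ≤1 (m₀ , ε≥) 1≤V high hyp = halving {a} {x} {V} limit
    where
    U = proj₁ (bounded-above ε)
    m₁ = proj₁ (proj₂ (bounded-above ε))
    W = proj₁ (natural-bound (fromℕ U * A))
    y : Seq
    y m = (1ℚ - seq ε m) * l m
    low : ∀ m → m₁ ℕ.≤ m → - fromℕ W ≤ y m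
    low m m₁≤m = exponent-≥ {seq ε m} {l m} {fromℕ U} {A} {fromℕ W} (0≤l m) (l≤A m) (0≤fromℕ U)
      (proj₂ (proj₂ (bounded-above ε)) m m₁≤m) (proj₂ (natural-bound (fromℕ U * A)))
    high′ : ∀ m → m₀ ℕ.≤ m → 0ℚ ≤ y m → expSum m (y m) ≤ V
    high′ m m₀≤m 0≤y = high m (y m) 0≤y
      (*-mono {1ℚ - seq ε m} {1ℚ - ρ} {l m} {A} (0≤l m) (0≤-diff {ρ} {1ℚ} ρ≤1) (+-monoʳ-≤ 1ℚ (neg-antimono-≤ (ε≥ m m₀≤m))) (l≤A m))
    eventually : ∀ δ → 0ℚ < δ → ∃[ m₂ ] ∀ m → m₂ ℕ.≤ m → expSum m (y m) ≤ V + δ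
    eventually δ 0<δ = exp-≤-eventually y W V δ 0<δ 1≤V (m₀ ℕ.+ m₁ , λ m le →
      low m (ℕ.≤-trans (ℕ.m≤n+m m₁ m₀) le) , high′ m (ℕ.≤-trans (ℕ.m≤m+n m₀ m₁) le))
    exponent : ∀ m → (fromℕ 1 - seq ε m) * l m ≡ y m
    exponent m = cong (λ z → (z - seq ε m) * l m) one
      where
      one : fromℕ 1 ≡ 1ℚ
      one = refl
    limit : ∀ δ → 0ℚ < δ → a ≤ x + (V + δ) + δ
    limit δ 0<δ = ≤-replace {a} {x} {expSum m ((fromℕ 1 - seq ε m) * l m)} {V + δ} {δ}
      (proj₂ (hyp δ 0<δ) m (ℕ.m≤m+n (proj₁ (hyp δ 0<δ)) (proj₁ (eventually δ 0<δ))))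
      (subst (λ z → expSum m z ≤ V + δ) (sym (exponent m))
        (proj₂ (eventually δ 0<δ) m (ℕ.m≤n+m (proj₁ (eventually δ 0<δ)) (proj₁ (hyp δ 0<δ)))))
      where
      m = proj₁ (hyp δ 0<δ) ℕ.+ proj₁ (eventually δ 0<δ)

  inv≤1 : ∀ R .{{_ : ℕ.NonZero R}} → inv R ≤ 1ℚ
  inv≤1 R = *-cancelˡ {fromℕ R} {inv R} {1ℚ} (0<fromℕ R) (≤-trans (≤-reflexive (fromℕ*inv R))
    (≤-trans (1≤fromℕ R) (≤-reflexive (sym (*-identityʳ (fromℕ R))))))

  1≤ratio : ∀ a b .{{_ : ℕ.NonZero a}} → a ℕ.≤ b → 1ℚ ≤ fromℕ b * inv a
  1≤ratio a b a≤b = ≤-divide a {1ℚ} {fromℕ b} (≤-trans (≤-reflexive (*-identityʳ (fromℕ a))) (fromℕ-mono a≤b))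

  -- With x = n / k ≤ (1 + 1/N)^(Rq), x^(1 - ε) ≤ (1 - 1/N)^(-(R - 1) q).
  c-bound : ∀ (ε : ℝ) R′ n k q c M → let R = suc R′ ; N = suc M in .{{_ : ℕ.NonZero k}} .{{_ : ℕ.NonZero M}} →
    (∃[ m₀ ] ∀ m → m₀ ℕ.≤ m → inv R ≤ seq ε m) → k ℕ.≤ n →
    n ℕ.* N ℕ.^ (R ℕ.* q) ℕ.≤ k ℕ.* suc N ℕ.^ (R ℕ.* q) →
    ι c ≤ʳ (ι n /ʳ ι k) +ʳ (ι n /ʳ ι k) ^ʳ (ι 1 -ʳ seq ε) →
    k ℕ.* c ℕ.* M ℕ.^ (R′ ℕ.* q) ℕ.≤ n ℕ.* M ℕ.^ (R′ ℕ.* q) ℕ.+ k ℕ.* N ℕ.^ (R′ ℕ.* q)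
  c-bound ε R′ n k q c M ε≥ k≤n n≤ hyp = clear-quotients n k c (M ℕ.^ s) (N ℕ.^ s)
    (power-limit ε (λ m → logSum m x) {A} {inv R} {V} {fromℕ c} {x}
      (λ m → logSum-nonNeg m 1≤x)
      (λ m → logSum-≤ m N (R ℕ.* q) 1≤x (quotient-≤ n k (N ℕ.^ (R ℕ.* q)) (suc N ℕ.^ (R ℕ.* q)) n≤))
      (inv≤1 R) ε≥
      (1≤ratio (M ℕ.^ s) (N ℕ.^ s) (ℕ.^-monoˡ-≤ s (ℕ.n≤1+n M)))
      (λ m y 0≤y y≤ → ≤-divide (M ℕ.^ s) {expSum m y} {fromℕ (N ℕ.^ s)} (expSum-≤ m M s 0≤y (subst (y ≤_) (1-inv R′ q (inv N)) y≤)))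
      hyp)
    where
    R = suc R′
    N = suc M
    s = R′ ℕ.* q
    instance
      M^s≢0 : ℕ.NonZero (M ℕ.^ s)
      M^s≢0 = ℕ.m^n≢0 M s
    V : ℚ
    V = fromℕ (N ℕ.^ s) * inv (M ℕ.^ s)
    A : ℚ
    A = fromℕ (R ℕ.* q) * inv N
    x : ℚ
    x = fromℕ n * recip (fromℕ k)
    1≤x : 1ℚ ≤ x
    1≤x = 1≤quotient n k k≤n

  constant : ℚ → ℝ
  constant q = record { seq = const q ; cauchy = λ δ 0<δ → 0 , λ _ _ _ _ → ≤-trans (≤-reflexive (cong ∣_∣ (+-inverseʳ q))) (<⇒≤ 0<δ) }

  constant-pos : ∀ {q} → 0ℚ < q → ι 0 <ʳ seq (constant q)
  constant-pos {q} 0<q = q , 0<q , 0 , λ _ _ → ≤-reflexive (+-identityˡ q)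

  eventually-≥-inv : ∀ {x} → ι 0 <ʳ x → ∃[ R′ ] ∃[ m₀ ] ∀ m → m₀ ℕ.≤ m → inv (suc (suc R′)) ≤ x m
  eventually-≥-inv {x} (δ , 0<δ , m₀ , δ≤x) = ↧ₙ δ , m₀ , λ m m₀≤m → begin
    inv R                       ≡⟨ *-identityʳ (inv R) ⟨
    inv R * 1ℚ                  ≤⟨ *-monoʳ (0≤inv R) (archimedean δ 0<δ) ⟩
    inv R * (δ * fromℕ (↧ₙ δ))  ≤⟨ *-monoʳ (0≤inv R) (*-monoʳ (<⇒≤ 0<δ) (fromℕ-mono {↧ₙ δ} {R} (ℕ.≤-trans (ℕ.n≤1+n (↧ₙ δ)) (ℕ.n≤1+n (suc (↧ₙ δ)))))) ⟩
    inv R * (δ * fromℕ R)       ≡⟨ e (inv R) δ (fromℕ R) ⟩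
    δ * (fromℕ R * inv R)       ≡⟨ trans (cong (δ *_) (fromℕ*inv R)) (*-identityʳ δ) ⟩
    δ                           ≡⟨ +-identityˡ δ ⟨
    0ℚ + δ                      ≤⟨ δ≤x m m₀≤m ⟩
    x m                         ∎
    where
    open ≤-Reasoning
    R = suc (suc (↧ₙ δ))
    e : ∀ a b c → a * (b * c) ≡ b * (c * a)
    e = solve-∀ ring

  time-bound : ∀ B .{{_ : ℕ.NonZero B}} n k ℓ t → 1 ℕ.≤ n → n ℕ.≤ 2 ℕ.^ ℓ → k ℕ.* ℓ ℕ.≤ B ℕ.* t →
    const (inv B) *ʳ ι k *ʳ log (ι n) ≤ʳ ι t
  time-bound B n@(suc _) k ℓ t 1≤n n≤ kℓ≤ δ 0<δ = 0 , λ m _ → ≤-trans (begin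
    inv B * fromℕ k * logSum m (fromℕ n)
      ≤⟨ *-monoʳ (*-nonNeg (0≤inv B) (0≤fromℕ k)) (logSum-≤-exponent m ℓ n n≤) ⟩
    inv B * fromℕ k * fromℕ ℓ   ≡⟨ trans (*-assoc (inv B) _ _) (cong (inv B *_) (sym (fromℕ-* k ℓ))) ⟩
    inv B * fromℕ (k ℕ.* ℓ)     ≤⟨ *-monoʳ (0≤inv B) (fromℕ-mono kℓ≤) ⟩
    inv B * fromℕ (B ℕ.* t)     ≡⟨ cong (inv B *_) (fromℕ-* B t) ⟩
    inv B * (fromℕ B * fromℕ t) ≡⟨ e (inv B) (fromℕ B) (fromℕ t) ⟩
    fromℕ B * inv B * fromℕ t   ≡⟨ trans (cong (_* fromℕ t) (fromℕ*inv B)) (*-identityˡ (fromℕ t)) ⟩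
    fromℕ t                     ∎) (≤-by δ (<⇒≤ 0<δ) refl)
    where
    open ≤-Reasoning
    e : ∀ a b c → a * (b * c) ≡ b * a * c
    e = solve-∀ ring

  frequency-≥ : ∀ K good bad .{{_ : ℕ.NonZero K}} (let total = good ℕ.+ bad) → 0ℚ < fromℕ total →
    bad ℕ.* K ℕ.≤ total → 1ℚ - inv K ≤ fromℕ good * recip (fromℕ total)
  frequency-≥ K good bad 0<t bad≤ = begin
    1ℚ - inv K                ≡⟨ *-identityʳ (1ℚ - inv K) ⟨
    (1ℚ - inv K) * 1ℚ         ≡⟨ cong ((1ℚ - inv K) *_) (recip-inverse 0<t) ⟨
    (1ℚ - inv K) * (t * r)    ≡⟨ e₁ (inv K) t r ⟩
    (t - t * inv K) * r       ≤⟨ *-monoˡ (<⇒≤ (0<recip 0<t)) (+-monoʳ-≤ t (neg-antimono-≤ b≤)) ⟩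
    (t - b) * r               ≡⟨ cong (λ z → (z - b) * r) (fromℕ-+ good bad) ⟩
    (g + b - b) * r           ≡⟨ cong (_* r) (e₂ g b) ⟩
    g * r                     ∎
    where
    open ≤-Reasoning
    g = fromℕ good
    b = fromℕ bad
    t = fromℕ (good ℕ.+ bad)
    r = recip t
    b≤ : b ≤ t * inv K
    b≤ = ≤-divide K (≤-trans (≤-reflexive (trans (*-comm (fromℕ K) b) (sym (fromℕ-* bad K)))) (fromℕ-mono bad≤))
    e₁ : ∀ i t r → (1ℚ - i) * (t * r) ≡ (t - t * i) * r
    e₁ = solve-∀ ring
    e₂ : ∀ a b → a + b - b ≡ a
    e₂ = solve-∀ ring

  complement-≤ : ∀ {i E p δ} → i ≤ E + δ → 1ℚ - i ≤ p → 1ℚ - E ≤ p + δ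
  complement-≤ {i} {E} {p} {δ} i≤ p≥ = ≤-trans
    (≤-diff (≤-trans (0≤-diff i≤) (≤-reflexive (e E δ i)))) (+-monoˡ-≤ δ p≥)
    where
    e : ∀ E δ i → E + δ - i ≡ 1ℚ - i + δ - (1ℚ - E)
    e = solve-∀ ring

  -- The case α = 1. From log n ≤ ℓ and exp ℓ ≤ 4^ℓ the truncations of n^(-1) are eventually at
  -- least 2^(-2ℓ) - δ; the crude 4 in place of e is the reason for the exponent 2ℓ.
  probability-bound : ∀ n ℓ p .{{_ : ℕ.NonZero n}} → n ℕ.≤ 2 ℕ.^ ℓ → 1ℚ - inv (2 ℕ.^ (2 ℕ.* ℓ)) {{ℕ.m^n≢0 2 (2 ℕ.* ℓ)}} ≤ p →
    ι 1 -ʳ ι n ^ʳ (-ʳ const 1ℚ) ≤ʳ const p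
  probability-bound n ℓ p n≤ p≥ δ 0<δ = suc N , bound
    where
    N = proj₁ (exp-neg-≥ ℓ δ 0<δ)
    power : ∀ m → expSum m (- 1ℚ * logSum m (fromℕ n)) ≡ expSum m (- logSum m (fromℕ n))
    power m = cong (expSum m) (trans (sym (neg-distribˡ-* 1ℚ l)) (cong -_ (*-identityˡ l)))
      where l = logSum m (fromℕ n)
    bound′ : ∀ m → N ℕ.≤ m → 1ℚ - expSum (suc m) (- 1ℚ * logSum (suc m) (fromℕ n)) ≤ p + δ
    bound′ m N≤m = ≤-trans (≤-reflexive (cong (λ z → 1ℚ - z) (power (suc m))))
      (complement-≤ {_} {expSum (suc m) (- logSum (suc m) (fromℕ n))}
        (proj₂ (exp-neg-≥ ℓ δ 0<δ) m N≤m (logSum (suc m) (fromℕ n)) (logSum-nonNeg (suc m) (1≤fromℕ n)) (logSum-≤-exponent (suc m) ℓ n n≤)) p≥)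
    bound : ∀ m → suc N ℕ.≤ m → 1ℚ - expSum m (- 1ℚ * logSum m (fromℕ n)) ≤ p + δ
    bound (suc m) (s≤s N≤m) = bound′ m N≤m

-- Assembly of the counting and the analytic estimates

open import Defs
open import Data.Bool using (true; not)
open import Data.Fin using (Fin)
open import Data.List using (length; filterᵇ)
open import Data.Nat using (ℕ; suc; NonZero; _+_; _*_; _^_; _/_; _<_; _≤_; >-nonZero; z≤n; s≤s)
open import Data.Nat.DivMod using (m/n*n≤m)
open import Data.Nat.Properties
open import Data.Nat.Tactic.RingSolver using (solve-∀)
open import Data.Product using (_×_; _,_; proj₁; proj₂; Σ-syntax; ∃-syntax)
open import Data.Rational as ℚ using (1ℚ)
open import Function using (_∘_)
open import Relation.Binary.PropositionalEquality using (_≡_; refl; sym; trans; cong; subst; subst₂)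
open Counting
open Analysis using (fromℕ; 0<fromℕ; 0<inv; 0<1; inv; k-bound; c-bound; constant; constant-pos; eventually-≥-inv; time-bound; frequency-≥; probability-bound)

module Survival (ε : ℝ) (r D : ℕ) .{{nz-D : NonZero D}} (D≡ : D ≡ 320 * suc r)
  (ε≥ : ∃[ m₀ ] ∀ m → m₀ ≤ m → inv (suc r) ℚ.≤ seq ε m)
  (n k : ℕ) (large : 2 ^ (D * D) ≤ n) (2≤k : 2 ≤ k)
  (k≤ : ι k ≤ʳ (ι n /ʳ log (ι n)) ^ʳ (ι 1 /ʳ ι 4))
  (c : Fin k → ℕ) (c≤ : ι (maxCount c) ≤ʳ (ι n /ʳ ι k) +ʳ (ι n /ʳ ι k) ^ʳ (ι 1 -ʳ seq ε))
  (χ : Coloring n k) (χ≡c : ∀ j → configuration χ j ≡ c j)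
  where

  R M N : ℕ
  R = suc r
  M = suc (2 * r)
  N = suc M

  320≤D : 320 ≤ D
  320≤D = ≤-trans (m≤m*n 320 R) (≤-reflexive (sym D≡))

  1≤n : 1 ≤ n
  1≤n = ≤-trans (m^n>0 2 (D * D)) large

  3≤n : 3 ≤ n
  3≤n = ≤-trans (≤-trans (s≤s (s≤s (s≤s z≤n))) (^-monoʳ-≤ 2 (*-mono-≤ (≤-trans 2≤320 320≤D) (≤-trans 1≤320 320≤D)))) large
    where
    2≤320 : 2 ≤ 320
    2≤320 = s≤s (s≤s z≤n)
    1≤320 : 1 ≤ 320
    1≤320 = s≤s z≤n

  instance
    n≢0 : NonZero n
    n≢0 = >-nonZero 1≤n
    k≢0 : NonZero k
    k≢0 = >-nonZero (≤-trans (s≤s z≤n) 2≤k)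

  binary : ∃[ ℓ ] n * 1 ^ ℓ ≤ 1 * 2 ^ ℓ × 1 * 2 ^ ℓ * 1 ≤ n * 1 ^ ℓ * 2
  binary = bracket 1 n 1 2 (s≤s (s≤s z≤n)) 1≤n

  ℓ : ℕ
  ℓ = proj₁ binary

  n≤2^ℓ : n ≤ 2 ^ ℓ
  n≤2^ℓ = subst₂ _≤_ (trans (cong (n *_) (^-zeroˡ ℓ)) (*-identityʳ n)) (*-identityˡ (2 ^ ℓ)) (proj₁ (proj₂ binary))

  2^ℓ≤2n : 2 ^ ℓ ≤ 2 * n
  2^ℓ≤2n = subst₂ _≤_ (trans (*-identityʳ (1 * 2 ^ ℓ)) (*-identityˡ (2 ^ ℓ)))
    (trans (cong (_* 2) (trans (cong (n *_) (^-zeroˡ ℓ)) (*-identityʳ n))) (*-comm n 2)) (proj₂ (proj₂ binary))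

  -- The base is a fourth power, so that (11/10)^b is the fourth root of n up to a factor 11/10.
  eleven-tenths : ∃[ b ] n * (10 ^ 4) ^ b ≤ 1 * (11 ^ 4) ^ b × 1 * (11 ^ 4) ^ b * 10 ^ 4 ≤ n * (10 ^ 4) ^ b * 11 ^ 4
  eleven-tenths = bracket (10 ^ 4) n 1 (11 ^ 4) (^-monoˡ-< 4 (n<1+n 10)) 1≤n

  k^10≤ : k ^ 10 ≤ 8 * n ^ 3
  k^10≤ = k^10≤8n³ n k b (k-bound n k b 3≤n
      (subst₂ _≤_ (cong (n *_) (^-*-assoc 10 4 b)) (trans (*-identityˡ ((11 ^ 4) ^ b)) (^-*-assoc 11 4 b)) (proj₁ (proj₂ eleven-tenths))) k≤)
    (proj₂ (proj₂ eleven-tenths))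
    where
    b = proj₁ eleven-tenths

  open Sizes R D n k ℓ D≡ large n≤2^ℓ 2^ℓ≤2n k^10≤ hiding (1≤n; 320≤D)

  h T : ℕ
  h = n / k
  T = k * g

  instance
    L≢0 : NonZero L
    L≢0 = m*n≢0 5 ℓ {{_}} {{>-nonZero 1≤ℓ}}
    G≢0 : NonZero G
    G≢0 = m^n≢0 2 (8 * g)

  open Start k h L G (≤-/ (864 * (k * k) * L * (G * G)) k noise-room)

  instance
    m≢0 : NonZero m
    m≢0 = >-nonZero 1≤m

  kh≤n : k * h ≤ n
  kh≤n = ≤-trans (≤-reflexive (*-comm k h)) (m/n*n≤m n k)

  k≤n : k ≤ n
  k≤n = ≤-trans (m≤m*n k h {{>-nonZero (≤-trans (s≤s z≤n) 2≤h)}}) kh≤n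

  n<k[1+h] : n < k * suc h
  n<k[1+h] = n<m[1+n/m] n k

  n≤2kh : n ≤ k * (2 * h)
  n≤2kh = ≤-trans (<⇒≤ n<k[1+h]) (*-monoʳ-≤ k (+-mono-≤ (≤-trans (s≤s z≤n) 2≤h) (≤-reflexive (sym (+-identityʳ h)))))

  -- The base is an R-th power, so that (1 + 1/N)^q is (n / k)^(1/R) up to a factor 1 + 1/N.
  fine : ∃[ q ] n * (N ^ R) ^ q ≤ k * (suc N ^ R) ^ q × k * (suc N ^ R) ^ q * N ^ R ≤ n * (N ^ R) ^ q * suc N ^ R
  fine = bracket (N ^ R) n k {{m^n≢0 N R}} (suc N ^ R) (^-monoˡ-< R (n<1+n N)) k≤n

  q : ℕ
  q = proj₁ fine

  maxCount≤ : maxCount c ≤ h + Δ₀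
  maxCount≤ = colours {Y = M ^ (r * q)} {{m^n≢0 M (r * q)}} n<k[1+h]
    (power-saving r n k h q G (proj₁ (proj₂ fine)) (proj₂ (proj₂ fine)) saving-room n≤2kh)
    (c-bound ε r n k q (maxCount c) M ε≥ k≤n
      (subst₂ _≤_ (cong (n *_) (^-*-assoc N R q)) (cong (k *_) (^-*-assoc (suc N) R q)) (proj₁ (proj₂ fine))) c≤)

  open Rounds n k h m L kh≤n 2≤h noise

  initially : Admissible χ Δ₀ T
  initially = record
    { colours = λ j → ≤-trans (≤-reflexive (χ≡c j)) (≤-trans (≤-maxCount c j) maxCount≤)
    ; lower   = ≤-refl
    ; upper   = upper T (growth k g)
    }

  -- On the good event no class reaches n up to round T = k g, and ℓ ≤ 2 D g turns T into at least k
  -- ℓ / (2 D). This is the origin of γ = 1 / (2 D).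
  survival : ∀ ω → good χ Δ₀ (firstRounds T ω) ≡ true → ∀ t → Monochromatic n (C χ ω t) → k * ℓ ≤ 2 * D * t
  survival ω ok t (j , mono) = begin
    k * ℓ             ≤⟨ *-monoʳ-≤ k ℓ≤2Dg ⟩
    k * (2 * D * g)   ≡⟨ e k (2 * D) g ⟩
    2 * D * T         ≤⟨ *-monoʳ-≤ (2 * D) (<⇒≤ T<t) ⟩
    2 * D * t         ∎
    where
    open ≤-Reasoning
    e : ∀ k D g → k * (D * g) ≡ D * (k * g)
    e = solve-∀
    T<t : T < t
    T<t = ≰⇒> (λ t≤T → not-monochromatic {n} {k} {h} {C χ ω t j} 1≤n 2≤k kh≤n (good-sound T initially ω ok t t≤T j) mono)

  K : ℕ
  K = 2 ^ (2 * ℓ)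

  instance
    K≢0 : NonZero K
    K≢0 = m^n≢0 2 (2 * ℓ)

  outcomes≢0 : NonZero (length (vectors (allPicks n) T))
  outcomes≢0 = subst NonZero (sym (length-vectors (allPicks n) T)) (m^n≢0 P T {{picks≢0}})
    where
    picks≢0 : NonZero P
    picks≢0 = subst NonZero (sym (trans (length-vectors (triples n) n) (cong (_^ n) (length-triples n))))
      (m^n≢0 (n * (n * n)) n {{m*n≢0 n (n * n) {{n≢0}} {{m*n≢0 n n}}}})

  likely : 1ℚ ℚ.- inv K ℚ.≤ probability n T (good χ Δ₀)
  likely = subst (λ total → 1ℚ ℚ.- inv K ℚ.≤ fromℕ #good ℚ.* recip (fromℕ total)) sum≡
    (frequency-≥ K #good #bad (0<fromℕ (#good + #bad) {{subst NonZero (sym sum≡) outcomes≢0}}) bad≤)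
    where
    Ω = vectors (allPicks n) T
    #good = length (filterᵇ (good χ Δ₀) Ω)
    #bad = ∑ Ω (𝟙 ∘ not ∘ good χ Δ₀)
    sum≡ : #good + #bad ≡ length Ω
    sum≡ = ∑-complement (good χ Δ₀) Ω
    bad≤ : #bad * K ≤ #good + #bad
    bad≤ = ≤-trans (few-bad {#bad} {T * k} {K} {2 ^ L} {P ^ T} {{m^n≢0 2 L}} (∑-bad T initially) (union-room k≤n))
      (≤-reflexive (sym (trans sum≡ (length-vectors (allPicks n) T))))

  conclusion : ∀ .{{_ : NonZero (2 * D)}} → ℙ[ τ≥ χ (seq (constant (inv (2 * D))) *ʳ ι k *ʳ log (ι n)) ]≥ (ι 1 -ʳ ι n ^ʳ (-ʳ seq (constant 1ℚ)))
  conclusion = T , good χ Δ₀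
    , (λ ω ok t mono → time-bound (2 * D) n k ℓ t 1≤n n≤2^ℓ (survival ω ok t mono))
    , probability-bound n ℓ (probability n T (good χ Δ₀)) n≤2^ℓ likely

-- ε enters the constants only through R = r + 2 with 1 / R ≤ ε eventually: γ is 1 / (640 R), and α
-- is 1 for every ε.
with-rate : ∀ {ε : ℝ} r D → D ≡ 320 * suc (suc r) → (∃[ m₀ ] ∀ m → m₀ ≤ m → inv (suc (suc r)) ℚ.≤ seq ε m) →
    Σ[ γ ∈ ℝ ] Σ[ α ∈ ℝ ] Σ[ n₀ ∈ ℕ ]
      (ι 0 <ʳ seq γ) ×
      (ι 0 <ʳ seq α) ×
      (∀ (n : ℕ) → n₀ ≤ n →
       ∀ (k : ℕ) → 2 ≤ k →
       ι k ≤ʳ (ι n /ʳ log (ι n)) ^ʳ (ι 1 /ʳ ι 4) →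
       ∀ (c : Fin k → ℕ) → IsConfiguration n c →
       ι (maxCount c) ≤ʳ (ι n /ʳ ι k) +ʳ (ι n /ʳ ι k) ^ʳ (ι 1 -ʳ seq ε) →
       ∀ (χ : Coloring n k) → (∀ j → configuration χ j ≡ c j) →
       ℙ[ τ≥ χ (seq γ *ʳ ι k *ʳ log (ι n)) ]≥ (ι 1 -ʳ ι n ^ʳ (-ʳ seq α)))
with-rate {ε} r D@(suc _) D≡ ε≥ = constant (inv (2 * D)) , constant 1ℚ , 2 ^ (D * D) , constant-pos (0<inv (2 * D)) , constant-pos 0<1 ,
  λ n large k 2≤k k≤ c _ c≤ χ χ≡c → Survival.conclusion ε (suc r) D D≡ ε≥ n k large 2≤k k≤ c c≤ χ χ≡c

theorem4p2 :
    (ε : ℝ) → ι 0 <ʳ seq ε →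
    Σ[ γ ∈ ℝ ] Σ[ α ∈ ℝ ] Σ[ n₀ ∈ ℕ ]
      (ι 0 <ʳ seq γ) ×
      (ι 0 <ʳ seq α) ×
      (∀ (n : ℕ) → n₀ ≤ n →
       ∀ (k : ℕ) → 2 ≤ k →
       ι k ≤ʳ (ι n /ʳ log (ι n)) ^ʳ (ι 1 /ʳ ι 4) →
       ∀ (c : Fin k → ℕ) → IsConfiguration n c →
       ι (maxCount c) ≤ʳ (ι n /ʳ ι k) +ʳ (ι n /ʳ ι k) ^ʳ (ι 1 -ʳ seq ε) →
       ∀ (χ : Coloring n k) → (∀ j → configuration χ j ≡ c j) →
       ℙ[ τ≥ χ (seq γ *ʳ ι k *ʳ log (ι n)) ]≥ (ι 1 -ʳ ι n ^ʳ (-ʳ seq α)))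
theorem4p2 ε 0<ε = with-rate {ε} (proj₁ (eventually-≥-inv 0<ε)) (320 * suc (suc (proj₁ (eventually-≥-inv 0<ε)))) refl (proj₂ (eventually-≥-inv 0<ε))
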